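{- For every integer $n>0$, let $X_n$ be the set of noncrossing $(1,2)$-configurations on $[n-1]=\{1,\dots,n-1\}$, and let $C_{X_n}$ be the cyclic group of order $n-1$ acting on $X_n$ via the cyclic permutation $g$ of $[n-1]$ given by $g(i)=i+1$ for $i\neq n-1$ and $g(n-1)=1$ (applied elementwise to each ball and arc). Then the triple $(X_n, C_{X_n}, C_n(q))$ exhibits the cyclic sieving phenomenon, where $C_n(q)=\frac{1}{[n+1]_q}{2n \brack n}_q$. Concretely, for every integer $k$, \[\left|\{F\in X_n : g^k(F)=F\}\right| = C_n(q)\big|_{q=e^{2\pi i k/(n-1)}}.\]
   Context: A subset of $[m]=\{1,\dots,m\}$ is a ball if it has cardinality $1$ and an arc if it has cardinality $2$. A $(1,2)$-configuration on $[m]$ is a set of pairwise disjoint balls and arcs in $[m]$ (the empty configuration is allowed, and not every element must be covered). A $(1,2)$-configuration has a crossing if it contains arcs $\{i_1,i_2\}$ and $\{j_1,j_2\}$ with $i_1<j_1<i_2<j_2$; otherwise it is noncrossing. $q$-notation: $[n]_q=1+q+\dots+q^{n-1}$, $[n]_q!=[1]_q[2]_q\cdots[n]_q$, ${n\brack k}_q=\frac{[n]_q!}{[n-k]_q![k]_q!}$; the $q$-Catalan number $C_n(q)$ is a polynomial in $q$ with nonnegative integer coefficients. Cyclic sieving phenomenon: for a finite set $X$ with an action of a cyclic group $C$, a polynomial $X(q)$ with nonnegative integer coefficients, and an embedding $\omega: C\hookrightarrow\mathbb{C}^*$ onto the $|C|$-th roots of unity, the triple $(X,C,X(q))$ exhibits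 the CSP if $|\{x\in X: c(x)=x\}|=X(\omega(c))$ for all $c\in C$. Here $\omega(g^k)=e^{2\pi i k/(n-1)}$. -}

module Defs where

open import Data.Nat as ℕ using (ℕ; zero; suc; _∸_)
open import Data.Nat.Divisibility using (_∣?_)
open import Data.Nat.DivMod using (_mod_)
open import Data.Integer as ℤ using (ℤ; +_; -[1+_])
open import Data.Integer.DivMod using (_%ℕ_)
open import Data.Fin as Fin using (Fin; toℕ)
open import Data.Vec as Vec using (Vec; lookup; tabulate)
open import Data.List as List using (List; []; _∷_; [_]; map; foldr; replicate; _++_; reverse; take; filter; upTo; dropWhile; length)
open import Data.List.Relation.Unary.All using (All)
open import Data.Product using (Σ; ∃; _×_; _,_; proj₁)
open import Function using (_∘_)
open import Relation.Binary.PropositionalEquality using (_≡_; _≢_)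
open import Relation.Nullary using (¬_)

-- Integer polynomials, as coefficient lists (constant term first).

Poly : Set
Poly = List ℤ

infixl 6 _⊕_
infixl 7 _⊗_

_⊕_ : Poly → Poly → Poly
[] ⊕ q = q
(a ∷ p) ⊕ [] = a ∷ p
(a ∷ p) ⊕ (b ∷ q) = (a ℤ.+ b) ∷ (p ⊕ q)

scale : ℤ → Poly → Poly
scale c = map (c ℤ.*_)

negP : Poly → Poly
negP = scale (ℤ.- (+ 1))

_⊗_ : Poly → Poly → Poly
[] ⊗ q = []
(a ∷ p) ⊗ q = scale a q ⊕ (+ 0 ∷ (p ⊗ q))

prodP : List Poly → Poly
prodP = foldr _⊗_ [ + 1 ]

monomial : ℕ → Poly
monomial e = replicate e (+ 0) ++ [ + 1 ]

trim : Poly → Poly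
trim p = reverse (dropWhile (ℤ._≟ + 0) (reverse p))

coeff : Poly → ℕ → ℤ
coeff [] _ = + 0
coeff (a ∷ p) zero = a
coeff (a ∷ p) (suc i) = coeff p i

-- Euclidean division by a MONIC polynomial g (only ever used with monic g):
-- divModMonic g p = (quotient , remainder).
divModMonic : Poly → Poly → Poly × Poly
divModMonic g p = go p
  where
  g' = trim g
  d = length g' ∸ 1
  go : Poly → Poly × Poly
  go [] = [] , []
  go (a ∷ p) with go p
  ... | q' , r' = let s = a ∷ r'
                      c = coeff s d
                  in (c ∷ q') , take d (s ⊕ negP (scale c g'))

quotP : Poly → Poly → Poly
quotP p g = proj₁ (divModMonic g p)

remP : Poly → Poly → Poly
remP p g = Data.Product.proj₂ (divModMonic g p)
  where import Data.Product

substPow : ℕ → Poly → Poly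
substPow zero p = [ foldr ℤ._+_ (+ 0) p ]
substPow (suc e) p = foldr (λ a acc → a ∷ (replicate e (+ 0) ++ acc)) [] p

IsZeroP : Poly → Set
IsZeroP p = All (_≡ + 0) p

-- Cyclotomic polynomials:  x^m - 1 = ∏_{d ∣ m} Φ_d(x)  (m ≥ 1).

xPowMinus1 : ℕ → Poly
xPowMinus1 m = monomial m ⊕ [ ℤ.- (+ 1) ]

cycloF : ℕ → ℕ → Poly
cycloF zero m = [ + 1 ]
cycloF (suc f) m = quotP (xPowMinus1 m) (prodP (map (cycloF f) (filter (_∣? m) (upTo m))))

cyclotomic : ℕ → Poly
cyclotomic m = cycloF m m

-- P(ω^k) = N in ℂ, where ω = e^{2πi/r} (r ≥ 1), k ∈ ℤ, N ∈ ℤ.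
-- ℤ[ω] ⊂ ℂ is represented as ℤ[x]/(Φ_r(x)) with ω = x; since ω^r = 1,
-- ω^k = ω^(k mod r).
EvalAtRootOfUnity≡ : Poly → (r : ℕ) → ℤ → ℤ → Set
EvalAtRootOfUnity≡ P zero k N = IsZeroP (remP (substPow 0 P ⊕ negP [ N ]) (cyclotomic 1))
EvalAtRootOfUnity≡ P (suc r) k N =
  IsZeroP (remP (substPow (k %ℕ suc r) P ⊕ negP [ N ]) (cyclotomic (suc r)))

qInt : ℕ → Poly
qInt k = replicate k (+ 1)

qFact : ℕ → Poly
qFact zero = [ + 1 ]
qFact (suc k) = qFact k ⊗ qInt (suc k)

qBinom : ℕ → ℕ → Poly
qBinom a b = quotP (qFact a) (qFact (a ∸ b) ⊗ qFact b)

qCatalan : ℕ → Poly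
qCatalan n = quotP (qBinom (2 ℕ.* n) n) (qInt (suc n))

-- (1,2)-configurations on [m], with [m] = {1..m} represented by Fin m
-- (element i ∈ [m] ↔ index i-1).  A configuration is encoded by labelling
-- each element: uncovered, a ball {i}, or in the arc {i , j}.

data Label (m : ℕ) : Set where
  uncovered : Label m
  ball      : Label m
  arc       : Fin m → Label m

Config : ℕ → Set
Config m = Vec (Label m) m

-- the labelling describes a set of pairwise disjoint balls and arcs
ValidConfig : ∀ {m} → Config m → Set
ValidConfig {m} F = ∀ (i j : Fin m) → lookup F i ≡ arc j → (i ≢ j × lookup F j ≡ arc i)

HasCrossing : ∀ {m} → Config m → Set
HasCrossing {m} F = Σ (Fin m) λ i₁ → Σ (Fin m) λ j₁ → Σ (Fin m) λ i₂ → Σ (Fin m) λ j₂ →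
  lookup F i₁ ≡ arc i₂ × lookup F j₁ ≡ arc j₂ ×
  (i₁ Fin.< j₁) × (j₁ Fin.< i₂) × (i₂ Fin.< j₂)

NoncrossingConfig : ∀ {m} → Config m → Set
NoncrossingConfig F = ValidConfig F × ¬ HasCrossing F

rot : ∀ {m} → Fin m → Fin m
rot {suc m} i = suc (toℕ i) mod (suc m)

rotInv : ∀ {m} → Fin m → Fin m
rotInv {suc m} i = (toℕ i ℕ.+ m) mod (suc m)

iter : ∀ {A : Set} → ℕ → (A → A) → A → A
iter zero f x = x
iter (suc k) f x = f (iter k f x)

rotPow : ∀ {m} → ℤ → Fin m → Fin m
rotPow (+ k) = iter k rot
rotPow (-[1+ k ]) = iter (suc k) rotInv

mapLabel : ∀ {m} → (Fin m → Fin m) → Label m → Label m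
mapLabel σ uncovered = uncovered
mapLabel σ ball = ball
mapLabel σ (arc j) = arc (σ j)

-- g^k · F : apply g^k elementwise to every ball and arc of F.
-- (position p of g^k F carries the image of the label at g^{-k} p)
actPow : ∀ {m} → ℤ → Config m → Config m
actPow k F = tabulate λ p → mapLabel (rotPow k) (lookup F (rotPow (ℤ.- k) p))

{-# OPTIONS --safe #-}

-- Both sides are computed.  Let m = n - 1, c = gcd(k , m) and d = m / c.
--
-- Evaluation: C_n(q) is the Gaussian binomial (2n , n) minus q times (2n , n+1).  In ℤ[x]/Φ_m
-- the element y = x^k satisfies y^d = 1, and y^i - 1 is a non-zero-divisor for 0 < i < d, since
-- x^g - 1 divides the nonzero integer m / g modulo Φ_m for every proper divisor g of m.  This is
-- all that the q-Lucas theorem needs (irreducibility of Φ_m is not), and it gives the value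
-- C(2n , n) - C(2n , n+1), C(2c+1 , c+1) or C(2c , c) according as d = 1, d = 2 or d ≥ 3.
--
-- Counting: a configuration is fixed by g^k iff it is invariant under rotation by c.  Orienting
-- each arc along its short side turns it into a c-periodic word with letters none, single, opening,
-- closing, from which the arcs are recovered by matching parentheses.  For d ≥ 3 the words that
-- occur are the balanced ones.  For d = 2 a diameter is also possible, and is an unmatched closing
-- letter, so that words with one excess closing letter occur too.  For d = 1 arcs are instead
-- oriented from left to right, and the words are the 2-coloured Motzkin paths.

module Submission where

open import Defs
open import Data.Nat using (ℕ; _<_; _∸_; suc)
open import Data.Integer using (ℤ; +_)
open import Data.List using (List; length)
open import Data.List.Membership.Propositional using (_∈_)
open import Data.List.Relation.Unary.Unique.Propositional using (Unique)
open import Data.Product using (Σ; _×_)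
open import Function.Bundles using (_⇔_)
open import Relation.Binary.PropositionalEquality using (_≡_)

-- The division by `[n+1]` must be removed before a root of unity is substituted. Here n + 1 = m +
-- 2, so at y of order d ≥ 2 the divisor becomes 1 + y, which is zero for d = 2. The difference of
-- two Gaussian binomials has no denominator left. `cyclotomic` is defined by a division that
-- silently drops a remainder, so it has to be proved that this remainder is zero. The product of
-- the earlier factors divides x^n - 1 because each new Φ_k divides the cofactor found so far. This
-- needs the preceding factors to be non-zero-divisors modulo Φ_k. Exactness and the
-- non-zero-divisor property therefore support each other in one strong induction. On the
-- combinatorial side, configurations become periodic functions on ℕ that record forward distances.
-- Rotation is then translation, and invariance is a shorter period. One decoding relation serves
-- all orders. Only the rule that names one end of an arc as opening changes: for d = 1 the period
-- is the whole circle, every distance lies below it, and the short-side rule would call both ends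
-- opening.

module QAnalogues where
  open import Level using (_⊔_)
  open import Algebra.Bundles using (CommutativeRing)
  open import Data.Nat as ℕ using (ℕ; zero; suc; _<_; z≤n; s≤s; z<s; s<s; _∸_)
  import Data.Nat.Properties as ℕₚ
  open import Data.Nat.Combinatorics using (_C_; nCn≡1; nCk≡nC[n∸k]; k>n⇒nCk≡0; nCk+nC[k+1]≡[n+1]C[k+1])
  open import Data.Product using (∃; _,_)
  import Relation.Binary.Reasoning.Setoid as SetoidReasoning
  open import Relation.Binary.PropositionalEquality as ≡ using (_≡_)

  nC0≡1 : ∀ n → n C 0 ≡ 1
  nC0≡1 n = ≡.trans (nCk≡nC[n∸k] {0} {n} z≤n) (nCn≡1 n)

  -- Quotient of a commutative ring by a principal ideal.

  module QuotientRing {c ℓ} (R : CommutativeRing c ℓ) (g : CommutativeRing.Carrier R) where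
    open CommutativeRing R hiding (zero)
    open import Algebra.Solver.Ring.NaturalCoefficients.Default commutativeSemiring
    open import Algebra.Properties.Ring ring using (-‿distribʳ-*)
    open import Algebra.Properties.AbelianGroup +-abelianGroup using (⁻¹-∙-comm)
    open SetoidReasoning setoid

    -- Congruence modulo g, with a multiple of g on either side so that the
    -- closure properties are semiring identities.
    record _≈/_ (p q : Carrier) : Set (c ⊔ ℓ) where
      constructor mod≈
      field
        {u v} : Carrier
        eq : p + g * u ≈ q + g * v

    ≈⇒≈/ : ∀ {p q} → p ≈ q → p ≈/ q
    ≈⇒≈/ e = mod≈ {u = 0#} {0#} (+-congʳ e)

    ≈/-sym : ∀ {p q} → p ≈/ q → q ≈/ p
    ≈/-sym (mod≈ e) = mod≈ (sym e)

    ≈/-trans : ∀ {p q r} → p ≈/ q → q ≈/ r → p ≈/ r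
    ≈/-trans {p} {q} {r} (mod≈ {u} {v} e) (mod≈ {s} {t} f) = mod≈ {u = u + s} {v + t} (begin
      p + g * (u + s)        ≈⟨ solve 4 (λ p g u s → p :+ g :* (u :+ s) := (p :+ g :* u) :+ g :* s) refl p g u s ⟩
      (p + g * u) + g * s    ≈⟨ +-congʳ e ⟩
      (q + g * v) + g * s    ≈⟨ solve 4 (λ q g v s → (q :+ g :* v) :+ g :* s := (q :+ g :* s) :+ g :* v) refl q g v s ⟩
      (q + g * s) + g * v    ≈⟨ +-congʳ f ⟩
      (r + g * t) + g * v    ≈⟨ solve 4 (λ r g t v → (r :+ g :* t) :+ g :* v := r :+ g :* (v :+ t)) refl r g t v ⟩
      r + g * (v + t)        ∎)

    ≈/-+-cong : ∀ {p q r s} → p ≈/ q → r ≈/ s → (p + r) ≈/ (q + s)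
    ≈/-+-cong {p} {q} {r} {s} (mod≈ {u} {v} e) (mod≈ {w} {z} f) = mod≈ {u = u + w} {v + z} (begin
      (p + r) + g * (u + w)          ≈⟨ rearrange p r u w ⟩
      (p + g * u) + (r + g * w)      ≈⟨ +-cong e f ⟩
      (q + g * v) + (s + g * z)      ≈⟨ rearrange q s v z ⟨
      (q + s) + g * (v + z)          ∎)
      where
      rearrange : ∀ p r u w → (p + r) + g * (u + w) ≈ (p + g * u) + (r + g * w)
      rearrange = solve 5 (λ g p r u w → (p :+ r) :+ g :* (u :+ w) := (p :+ g :* u) :+ (r :+ g :* w)) refl g

    ≈/-*-congˡ : ∀ {p q} r → p ≈/ q → (r * p) ≈/ (r * q)
    ≈/-*-congˡ {p} {q} r (mod≈ {u} {v} e) = mod≈ {u = r * u} {r * v} (begin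
      r * p + g * (r * u)    ≈⟨ solve 4 (λ g r p u → r :* p :+ g :* (r :* u) := r :* (p :+ g :* u)) refl g r p u ⟩
      r * (p + g * u)        ≈⟨ *-congˡ e ⟩
      r * (q + g * v)        ≈⟨ solve 4 (λ g r p u → r :* p :+ g :* (r :* u) := r :* (p :+ g :* u)) refl g r q v ⟨
      r * q + g * (r * v)    ∎)

    ≈/-*-cong : ∀ {p q r s} → p ≈/ q → r ≈/ s → (p * r) ≈/ (q * s)
    ≈/-*-cong {p} {q} {r} {s} e f =
      ≈/-trans (≈/-*-congˡ p f) (≈/-trans (≈⇒≈/ (*-comm p s)) (≈/-trans (≈/-*-congˡ s e) (≈⇒≈/ (*-comm s q))))

    ≈/-neg-cong : ∀ {p q} → p ≈/ q → (- p) ≈/ (- q)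
    ≈/-neg-cong {p} {q} (mod≈ {u} {v} e) = mod≈ {u = - u} { - v} (begin
      - p + g * - u      ≈⟨ +-congˡ (-‿distribʳ-* g u) ⟨
      - p + - (g * u)    ≈⟨ ⁻¹-∙-comm p (g * u) ⟩
      - (p + g * u)      ≈⟨ -‿cong e ⟩
      - (q + g * v)      ≈⟨ ⁻¹-∙-comm q (g * v) ⟨
      - q + - (g * v)    ≈⟨ +-congˡ (-‿distribʳ-* g v) ⟩
      - q + g * - v      ∎)

    quotient : CommutativeRing c (c ⊔ ℓ)
    quotient = record
      { _≈_ = _≈/_ ; _+_ = _+_ ; _*_ = _*_ ; -_ = -_ ; 0# = 0# ; 1# = 1#
      ; isCommutativeRing = record
        { isRing = record
          { +-isAbelianGroup = record
            { isGroup = record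
              { isMonoid = record
                { isSemigroup = record
                  { isMagma = record
                    { isEquivalence = record { refl = ≈⇒≈/ refl ; sym = ≈/-sym ; trans = ≈/-trans }
                    ; ∙-cong = ≈/-+-cong }
                  ; assoc = λ x y z → ≈⇒≈/ (+-assoc x y z) }
                ; identity = (λ x → ≈⇒≈/ (+-identityˡ x)) , (λ x → ≈⇒≈/ (+-identityʳ x)) }
              ; inverse = (λ x → ≈⇒≈/ (-‿inverseˡ x)) , (λ x → ≈⇒≈/ (-‿inverseʳ x))
              ; ⁻¹-cong = ≈/-neg-cong }
            ; comm = λ x y → ≈⇒≈/ (+-comm x y) }
          ; *-cong = ≈/-*-cong
          ; *-assoc = λ x y z → ≈⇒≈/ (*-assoc x y z)
          ; *-identity = (λ x → ≈⇒≈/ (*-identityˡ x)) , (λ x → ≈⇒≈/ (*-identityʳ x))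
          ; distrib = (λ x y z → ≈⇒≈/ (distribˡ x y z)) , (λ x y z → ≈⇒≈/ (distribʳ x y z)) }
        ; *-comm = λ x y → ≈⇒≈/ (*-comm x y) } }

    ≈/0⇒multiple : ∀ {p} → p ≈/ 0# → ∃ λ q → p ≈ g * q
    ≈/0⇒multiple {p} (mod≈ {u} {v} e) = v + - u , ∙-cancelʳ (g * u) p (g * (v + - u)) (begin
      p + g * u                   ≈⟨ e ⟩
      0# + g * v                  ≈⟨ +-identityˡ _ ⟩
      g * v                       ≈⟨ *-congˡ (+-identityʳ v) ⟨
      g * (v + 0#)                ≈⟨ *-congˡ (+-congˡ (-‿inverseˡ u)) ⟨
      g * (v + (- u + u))         ≈⟨ solve 4 (λ g v w u → g :* (v :+ (w :+ u)) := g :* (v :+ w) :+ g :* u) refl g v (- u) u ⟩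
      g * (v + - u) + g * u       ∎)
      where open import Algebra.Properties.Group +-group using (∙-cancelʳ)

    multiple⇒≈/0 : ∀ {p q} → p ≈ g * q → p ≈/ 0#
    multiple⇒≈/0 {p} {q} e = mod≈ {u = 0#} {q} (begin
      p + g * 0#    ≈⟨ +-congˡ (zeroʳ g) ⟩
      p + 0#        ≈⟨ +-identityʳ p ⟩
      p             ≈⟨ e ⟩
      g * q         ≈⟨ +-identityˡ _ ⟨
      0# + g * q    ∎)

  -- Gaussian binomials and the q-Lucas theorem.

  module QSeries {c ℓ} (R : CommutativeRing c ℓ) (y : CommutativeRing.Carrier R) where
    open CommutativeRing R hiding (zero)
    open import Algebra.Solver.Ring.NaturalCoefficients.Default commutativeSemiring
    open import Algebra.Properties.Semiring.Exp semiring
    open import Algebra.Properties.Semiring.Mult semiring using (×-homo-+; ×-congˡ; ×-congʳ; ×-assoc-*) renaming (_×_ to _·_)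
    open import Algebra.Properties.Group +-group using (∙-cancelˡ; ∙-cancelʳ)
    open SetoidReasoning setoid

    -- The q-integer `[k]` at q = `y`, in Horner form.
    geom : ℕ → Carrier
    geom zero = 0#
    geom (suc k) = 1# + y * geom k

    -- This is (y - 1)[k] = y^k - 1 with the negative terms moved across, which keeps it within
    -- reach of a semiring solver.
    geom-telescope : ∀ k → y ^ k + geom k ≈ 1# + y * geom k
    geom-telescope zero = sym (+-congˡ (zeroʳ y))
    geom-telescope (suc k) = begin
      y * y ^ k + (1# + y * geom k)    ≈⟨ solve 3 (λ y a b → y :* a :+ (con 1 :+ y :* b) := con 1 :+ y :* (a :+ b)) refl y (y ^ k) (geom k) ⟩
      1# + y * (y ^ k + geom k)        ≈⟨ +-congˡ (*-congˡ (geom-telescope k)) ⟩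
      1# + y * (1# + y * geom k)       ∎

    geom-+ : ∀ a b → geom (a ℕ.+ b) ≈ geom a + y ^ a * geom b
    geom-+ zero b = sym (trans (+-identityˡ _) (*-identityˡ _))
    geom-+ (suc a) b = begin
      1# + y * geom (a ℕ.+ b)                    ≈⟨ +-congˡ (*-congˡ (geom-+ a b)) ⟩
      1# + y * (geom a + y ^ a * geom b)         ≈⟨ solve 4 (λ y a p b → con 1 :+ y :* (a :+ p :* b) := (con 1 :+ y :* a) :+ (y :* p) :* b) refl y (geom a) (y ^ a) (geom b) ⟩
      (1# + y * geom a) + (y * y ^ a) * geom b   ∎

    -- On elements fixed by `y` every power of `y` acts as 1, so `[k]` acts as the integer `k`.
    -- Later this turns a vanishing q-integer into integer torsion.
    geom-fixed : ∀ {p} → y * p ≈ p → ∀ k → geom k * p ≈ k · p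
    geom-fixed {p} e zero = zeroˡ p
    geom-fixed {p} e (suc k) = begin
      (1# + y * geom k) * p       ≈⟨ solve 3 (λ y a p → (con 1 :+ y :* a) :* p := p :+ a :* (y :* p)) refl y (geom k) p ⟩
      p + geom k * (y * p)        ≈⟨ +-congˡ (*-congˡ e) ⟩
      p + geom k * p              ≈⟨ +-congˡ (geom-fixed e k) ⟩
      p + k · p                   ∎

    ^-fixed : ∀ {p} → y * p ≈ p → ∀ k → y ^ k * p ≈ p
    ^-fixed {p} e zero = *-identityˡ p
    ^-fixed {p} e (suc k) = trans (*-assoc y (y ^ k) p) (trans (*-congˡ (^-fixed e k)) e)

    qfact : ℕ → Carrier
    qfact zero = 1#
    qfact (suc k) = qfact k * geom (suc k)

    -- Defined by the q-Pascal rule instead of a quotient of q-factorials: those can vanish in the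
    -- rings of interest, and the recursion commutes with substitution.
    gauss : ℕ → ℕ → Carrier
    gauss a zero = 1#
    gauss zero (suc b) = 0#
    gauss (suc a) (suc b) = gauss a b + y ^ suc b * gauss a (suc b)

    gauss-> : ∀ {a b} → a < b → gauss a b ≈ 0#
    gauss-> {zero} {suc b} _ = refl
    gauss-> {suc a} {suc b} (s<s a<b) = begin
      gauss a b + y ^ suc b * gauss a (suc b)    ≈⟨ +-cong (gauss-> a<b) (*-congˡ (gauss-> (ℕₚ.m<n⇒m<1+n a<b))) ⟩
      0# + y ^ suc b * 0#                        ≈⟨ +-identityˡ _ ⟩
      y ^ suc b * 0#                             ≈⟨ zeroʳ _ ⟩
      0#                                         ∎

    gauss-≡ : ∀ a → gauss a a ≈ 1#
    gauss-≡ zero = refl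
    gauss-≡ (suc a) = begin
      gauss a a + y ^ suc a * gauss a (suc a)    ≈⟨ +-cong (gauss-≡ a) (*-congˡ (gauss-> (ℕₚ.n<1+n a))) ⟩
      1# + y ^ suc a * 0#                        ≈⟨ +-congˡ (zeroʳ _) ⟩
      1# + 0#                                    ≈⟨ +-identityʳ _ ⟩
      1#                                         ∎

    -- Each half of the q-Pascal rule contributes a multiple of the q-factorial of a + b + 1. The
    -- cofactors `[a+1]` and y^(a+1)`[b+1]` add up to `[a+b+2]`.
    gauss-qfact : ∀ a b → gauss (a ℕ.+ b) a * (qfact a * qfact b) ≈ qfact (a ℕ.+ b)
    gauss-qfact zero b = trans (*-identityˡ _) (*-identityˡ _)
    gauss-qfact (suc a) zero rewrite ℕₚ.+-identityʳ a =
      trans (*-cong (gauss-≡ (suc a)) (*-identityʳ _)) (*-identityˡ _)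
    gauss-qfact (suc a) (suc b) = begin
      (gauss (a ℕ.+ suc b) a + y ^ suc a * gauss (a ℕ.+ suc b) (suc a)) * ((qfact a * geom (suc a)) * (qfact b * geom (suc b)))
        ≈⟨ solve 7 (λ G H p f u h v → (G :+ p :* H) :* ((f :* u) :* (h :* v))
             := (G :* (f :* (h :* v))) :* u :+ (H :* ((f :* u) :* h)) :* (p :* v)) refl
             (gauss (a ℕ.+ suc b) a) (gauss (a ℕ.+ suc b) (suc a)) (y ^ suc a) (qfact a) (geom (suc a)) (qfact b) (geom (suc b)) ⟩
      (gauss (a ℕ.+ suc b) a * (qfact a * qfact (suc b))) * geom (suc a)
        + (gauss (a ℕ.+ suc b) (suc a) * (qfact (suc a) * qfact b)) * (y ^ suc a * geom (suc b))
        ≈⟨ +-cong (*-congʳ (gauss-qfact a (suc b))) (*-congʳ (shifted (ℕₚ.+-suc a b))) ⟩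
      qfact (a ℕ.+ suc b) * geom (suc a) + qfact (a ℕ.+ suc b) * (y ^ suc a * geom (suc b))
        ≈⟨ distribˡ _ _ _ ⟨
      qfact (a ℕ.+ suc b) * (geom (suc a) + y ^ suc a * geom (suc b))
        ≈⟨ *-congˡ (geom-+ (suc a) (suc b)) ⟨
      qfact (a ℕ.+ suc b) * geom (suc a ℕ.+ suc b) ∎
      where
      shifted : a ℕ.+ suc b ≡ suc a ℕ.+ b →
        gauss (a ℕ.+ suc b) (suc a) * (qfact (suc a) * qfact b) ≈ qfact (a ℕ.+ suc b)
      shifted e rewrite e = gauss-qfact (suc a) b

    -- The last hypothesis says that y^i - 1 is a non-zero-divisor, stated without subtraction. It
    -- replaces primitivity of a root of unity in an integral domain.
    module Lucas (d : ℕ) (y^d≈1 : y ^ suc d ≈ 1#)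
      (nonZeroDivisor : ∀ {i p} → 0 < i → i < suc d → y ^ i * p ≈ p → p ≈ 0#) where

      private D = suc d

      -- `[i]` divides y^i - 1, so whatever it annihilates is fixed by y^i.
      geom-nonZeroDivisor : ∀ {i p} → 0 < i → i < D → geom i * p ≈ 0# → p ≈ 0#
      geom-nonZeroDivisor {i} {p} 0<i i<D e = nonZeroDivisor 0<i i<D (begin
        y ^ i * p                         ≈⟨ +-identityʳ _ ⟨
        y ^ i * p + 0#                    ≈⟨ +-congˡ e ⟨
        y ^ i * p + geom i * p            ≈⟨ distribʳ p _ _ ⟨
        (y ^ i + geom i) * p              ≈⟨ *-congʳ (geom-telescope i) ⟩
        (1# + y * geom i) * p             ≈⟨ solve 3 (λ y a p → (con 1 :+ y :* a) :* p := p :+ y :* (a :* p)) refl y (geom i) p ⟩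
        p + y * (geom i * p)              ≈⟨ +-congˡ (*-congˡ e) ⟩
        p + y * 0#                        ≈⟨ +-congˡ (zeroʳ y) ⟩
        p + 0#                            ≈⟨ +-identityʳ p ⟩
        p                                 ∎)

      qfact-nonZeroDivisor : ∀ {i p} → i < D → qfact i * p ≈ 0# → p ≈ 0#
      qfact-nonZeroDivisor {zero} {p} _ e = trans (sym (*-identityˡ p)) e
      qfact-nonZeroDivisor {suc i} {p} i<D e =
        geom-nonZeroDivisor z<s i<D (qfact-nonZeroDivisor (ℕₚ.<-trans (ℕₚ.n<1+n i) i<D)
          (trans (sym (*-assoc _ _ p)) e))

      -- (y - 1)[D] = y^D - 1 = 0, and y - 1 can be cancelled as soon as 1 is an exponent below `D`.
      geom-D≈0 : 1 < D → geom D ≈ 0#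
      geom-D≈0 1<D = nonZeroDivisor z<s 1<D (trans (*-congʳ (*-identityʳ y)) (sym
        (∙-cancelˡ 1# (geom D) (y * geom D) (begin
          1# + geom D          ≈⟨ +-congʳ y^d≈1 ⟨
          y ^ D + geom D       ≈⟨ geom-telescope D ⟩
          1# + y * geom D      ∎))))

      -- Multiplying by the q-factorials of b and D - b gives the q-factorial of D, which contains
      -- the factor `[D]` = 0. Both multipliers cancel because their indices are below `D`.
      gauss-D≈0 : ∀ {b} → 0 < b → b < D → gauss D b ≈ 0#
      gauss-D≈0 {b} 0<b b<D = qfact-nonZeroDivisor D∸b<D (qfact-nonZeroDivisor b<D (begin
        qfact b * (qfact (D ∸ b) * gauss D b)    ≈⟨ solve 3 (λ a b c → a :* (b :* c) := c :* (a :* b)) refl (qfact b) (qfact (D ∸ b)) (gauss D b) ⟩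
        gauss D b * (qfact b * qfact (D ∸ b))    ≈⟨ split (ℕₚ.m+[n∸m]≡n (ℕₚ.<⇒≤ b<D)) ⟩
        qfact D                                  ≈⟨ *-congˡ (geom-D≈0 (ℕₚ.≤-<-trans 0<b b<D)) ⟩
        qfact d * 0#                             ≈⟨ zeroʳ _ ⟩
        0#                                       ∎))
        where
        D∸b<D : D ∸ b < D
        D∸b<D = ℕₚ.∸-monoʳ-< 0<b (ℕₚ.<⇒≤ b<D)
        split : ∀ {k} → b ℕ.+ (D ∸ b) ≡ k → gauss k b * (qfact b * qfact (D ∸ b)) ≈ qfact k
        split ≡.refl = gauss-qfact b (D ∸ b)

      gauss-shift-< : ∀ a {b} → b < D → gauss (a ℕ.+ D) b ≈ gauss a b
      gauss-shift-< a {zero} _ = refl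
      gauss-shift-< zero {suc b} b<D = gauss-D≈0 z<s b<D
      gauss-shift-< (suc a) {suc b} b<D =
        +-cong (gauss-shift-< a (ℕₚ.<-trans (ℕₚ.n<1+n b) b<D)) (*-congˡ (gauss-shift-< a b<D))

      -- Pascal's rule in steps of `D`. The q-Pascal recursion in `a` preserves it because y^D = 1
      -- identifies the weights at lower indices that differ by `D`. Where the lower index falls
      -- below `D`, `gauss-shift-<` takes over.
      gauss-shift : ∀ a b → gauss (a ℕ.+ D) (b ℕ.+ D) ≈ gauss a (b ℕ.+ D) + gauss a b
      gauss-shift zero zero = trans (gauss-≡ D) (sym (+-identityˡ _))
      gauss-shift zero (suc b) = trans (gauss-> (s<s (ℕₚ.m≤n+m D b))) (sym (+-identityˡ _))
      gauss-shift (suc a) zero = begin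
        gauss (a ℕ.+ D) d + y ^ D * gauss (a ℕ.+ D) D    ≈⟨ +-cong (gauss-shift-< a (ℕₚ.n<1+n d)) (*-congˡ (gauss-shift a zero)) ⟩
        gauss a d + y ^ D * (gauss a D + 1#)             ≈⟨ solve 3 (λ u p v → u :+ p :* (v :+ con 1) := (u :+ p :* v) :+ p) refl (gauss a d) (y ^ D) (gauss a D) ⟩
        (gauss a d + y ^ D * gauss a D) + y ^ D          ≈⟨ +-congˡ y^d≈1 ⟩
        (gauss a d + y ^ D * gauss a D) + 1#             ∎
      gauss-shift (suc a) (suc b) = begin
        gauss (a ℕ.+ D) (b ℕ.+ D) + y ^ (suc b ℕ.+ D) * gauss (a ℕ.+ D) (suc b ℕ.+ D)
          ≈⟨ +-cong (gauss-shift a b) (*-congˡ (gauss-shift a (suc b))) ⟩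
        (gauss a (b ℕ.+ D) + gauss a b) + y ^ (suc b ℕ.+ D) * (gauss a (suc b ℕ.+ D) + gauss a (suc b))
          ≈⟨ solve 5 (λ u v p s t → (u :+ v) :+ p :* (s :+ t) := (u :+ p :* s) :+ (v :+ p :* t)) refl
               (gauss a (b ℕ.+ D)) (gauss a b) (y ^ (suc b ℕ.+ D)) (gauss a (suc b ℕ.+ D)) (gauss a (suc b)) ⟩
        gauss (suc a) (suc b ℕ.+ D) + (gauss a b + y ^ (suc b ℕ.+ D) * gauss a (suc b))
          ≈⟨ +-congˡ (+-congˡ (*-congʳ (trans (^-homo-* y (suc b) D) (trans (*-congˡ y^d≈1) (*-identityʳ _))))) ⟩
        gauss (suc a) (suc b ℕ.+ D) + gauss (suc a) (suc b) ∎

      +-*-suc : ∀ r A → r ℕ.+ suc A ℕ.* D ≡ (r ℕ.+ A ℕ.* D) ℕ.+ D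
      +-*-suc r A = ≡.trans (≡.cong (r ℕ.+_) (ℕₚ.+-comm D (A ℕ.* D))) (≡.sym (ℕₚ.+-assoc r (A ℕ.* D) D))

      -- The shift rules act on the quotients `A`, `B` exactly as the ordinary Pascal rule and leave
      -- the remainders untouched, so an ordinary binomial splits off.
      q-Lucas : ∀ A B {r t} → r < D → t < D →
        gauss (r ℕ.+ A ℕ.* D) (t ℕ.+ B ℕ.* D) ≈ (A C B) · gauss r t
      q-Lucas zero zero {r} {t} _ _ rewrite ℕₚ.+-identityʳ r | ℕₚ.+-identityʳ t = sym (+-identityʳ _)
      q-Lucas zero (suc B) {r} {t} r<D _ rewrite ℕₚ.+-identityʳ r = begin
        gauss r (t ℕ.+ suc B ℕ.* D)    ≈⟨ gauss-> (ℕₚ.<-≤-trans r<D (ℕₚ.≤-trans (ℕₚ.m≤m+n D (B ℕ.* D)) (ℕₚ.m≤n+m _ t))) ⟩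
        0#                             ≈⟨ ×-congˡ {gauss r t} (k>n⇒nCk≡0 {0} {suc B} z<s) ⟨
        (0 C suc B) · gauss r t        ∎
      q-Lucas (suc A) zero {r} {t} r<D t<D = begin
        gauss (r ℕ.+ suc A ℕ.* D) (t ℕ.+ 0)       ≈⟨ reflexive (≡.cong₂ gauss (+-*-suc r A) (ℕₚ.+-identityʳ t)) ⟩
        gauss (r ℕ.+ A ℕ.* D ℕ.+ D) t             ≈⟨ gauss-shift-< (r ℕ.+ A ℕ.* D) t<D ⟩
        gauss (r ℕ.+ A ℕ.* D) t                   ≈⟨ reflexive (≡.cong (gauss (r ℕ.+ A ℕ.* D)) (ℕₚ.+-identityʳ t)) ⟨
        gauss (r ℕ.+ A ℕ.* D) (t ℕ.+ 0)           ≈⟨ q-Lucas A zero r<D t<D ⟩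
        (A C 0) · gauss r t                       ≈⟨ ×-congˡ (≡.trans (nC0≡1 A) (≡.sym (nC0≡1 (suc A)))) ⟩
        (suc A C 0) · gauss r t                   ∎
      q-Lucas (suc A) (suc B) {r} {t} r<D t<D = begin
        gauss (r ℕ.+ suc A ℕ.* D) (t ℕ.+ suc B ℕ.* D)
          ≈⟨ reflexive (≡.cong₂ gauss (+-*-suc r A) (+-*-suc t B)) ⟩
        gauss (r ℕ.+ A ℕ.* D ℕ.+ D) (t ℕ.+ B ℕ.* D ℕ.+ D)
          ≈⟨ gauss-shift (r ℕ.+ A ℕ.* D) (t ℕ.+ B ℕ.* D) ⟩
        gauss (r ℕ.+ A ℕ.* D) (t ℕ.+ B ℕ.* D ℕ.+ D) + gauss (r ℕ.+ A ℕ.* D) (t ℕ.+ B ℕ.* D)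
          ≈⟨ +-congʳ (reflexive (≡.cong (gauss (r ℕ.+ A ℕ.* D)) (+-*-suc t B))) ⟨
        gauss (r ℕ.+ A ℕ.* D) (t ℕ.+ suc B ℕ.* D) + gauss (r ℕ.+ A ℕ.* D) (t ℕ.+ B ℕ.* D)
          ≈⟨ +-cong (q-Lucas A (suc B) r<D t<D) (q-Lucas A B r<D t<D) ⟩
        (A C suc B) · gauss r t + (A C B) · gauss r t
          ≈⟨ +-comm _ _ ⟩
        (A C B) · gauss r t + (A C suc B) · gauss r t
          ≈⟨ ×-homo-+ (gauss r t) (A C B) (A C suc B) ⟨
        (A C B ℕ.+ A C suc B) · gauss r t
          ≈⟨ ×-congˡ (nCk+nC[k+1]≡[n+1]C[k+1] A B) ⟩
        (suc A C suc B) · gauss r t ∎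

      -- The difference form of C_n(q) at q = `y`, with the subtracted term moved to the left.
      CatalanValue : ℕ → Carrier → Set ℓ
      CatalanValue n z = z + y * gauss (2 ℕ.* n) (suc n) ≈ gauss (2 ℕ.* n) n

      catalanValue₁ : D ≡ 1 → ∀ n {z N} → N ℕ.+ (2 ℕ.* n) C suc n ≡ (2 ℕ.* n) C n →
        CatalanValue n z → z ≈ N · 1#
      catalanValue₁ ≡.refl n {z} {N} eq h = ∙-cancelʳ (((2 ℕ.* n) C suc n) · 1#) z (N · 1#) (begin
        z + ((2 ℕ.* n) C suc n) · 1#                   ≈⟨ +-congˡ (trans (*-congʳ y≈1) (*-identityˡ _)) ⟨
        z + y * (((2 ℕ.* n) C suc n) · 1#)             ≈⟨ +-congˡ (*-congˡ (binomial (suc n))) ⟨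
        z + y * gauss (2 ℕ.* n) (suc n)                ≈⟨ h ⟩
        gauss (2 ℕ.* n) n                              ≈⟨ binomial n ⟩
        ((2 ℕ.* n) C n) · 1#                           ≈⟨ ×-congˡ eq ⟨
        (N ℕ.+ (2 ℕ.* n) C suc n) · 1#                 ≈⟨ ×-homo-+ 1# N _ ⟩
        N · 1# + ((2 ℕ.* n) C suc n) · 1#              ∎)
        where
        y≈1 : y ≈ 1#
        y≈1 = trans (sym (*-identityʳ y)) y^d≈1
        binomial : ∀ k → gauss (2 ℕ.* n) k ≈ ((2 ℕ.* n) C k) · 1#
        binomial k = trans
          (reflexive (≡.sym (≡.cong₂ gauss (ℕₚ.*-identityʳ (2 ℕ.* n)) (ℕₚ.*-identityʳ k))))
          (q-Lucas (2 ℕ.* n) k {0} {0} z<s z<s)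

      -- Here n is odd and 2n is even, so q-Lucas leaves the factor `gauss 0 1` = 0 in the first
      -- binomial. Since y = -1, the subtracted second binomial enters with a positive sign.
      catalanValue₂ : D ≡ 2 → ∀ c {z} → CatalanValue (suc (c ℕ.* D)) z → z ≈ (suc (2 ℕ.* c) C suc c) · 1#
      catalanValue₂ ≡.refl c {z} h = begin
        z                                ≈⟨ +-identityʳ z ⟨
        z + 0#                           ≈⟨ +-congˡ (trans (*-congʳ y+1≈0) (zeroˡ κ)) ⟨
        z + (y + 1#) * κ                 ≈⟨ solve 3 (λ z y κ → z :+ (y :+ con 1) :* κ := (z :+ y :* κ) :+ κ) refl z y κ ⟩
        (z + y * κ) + κ                  ≈⟨ +-congʳ (+-congˡ (*-congˡ lucas₁)) ⟨
        (z + y * gauss 2n (suc n)) + κ   ≈⟨ +-congʳ (trans h lucas₀) ⟩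
        0# + κ                           ≈⟨ +-identityˡ κ ⟩
        κ                                ∎
        where
        n = suc (c ℕ.* 2)
        2n = 2 ℕ.* n
        κ = (suc (2 ℕ.* c) C suc c) · 1#
        2n≡ : 2n ≡ 0 ℕ.+ suc (2 ℕ.* c) ℕ.* 2
        2n≡ = ≡.trans (ℕₚ.*-comm 2 n) (≡.cong (λ k → suc k ℕ.* 2) (ℕₚ.*-comm c 2))
        y+1≈0 : y + 1# ≈ 0#
        y+1≈0 = nonZeroDivisor {1} z<s (s≤s (s≤s z≤n)) (begin
          y ^ 1 * (y + 1#)      ≈⟨ solve 1 (λ y → (y :* con 1) :* (y :+ con 1) := y :* (y :* con 1) :+ y) refl y ⟩
          y ^ 2 + y             ≈⟨ +-congʳ y^d≈1 ⟩
          1# + y                ≈⟨ +-comm 1# y ⟩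
          y + 1#                ∎)
        lucas₀ : gauss 2n n ≈ 0#
        lucas₀ = trans (reflexive (≡.cong (λ k → gauss k n) 2n≡))
          (trans (q-Lucas (suc (2 ℕ.* c)) c {0} {1} z<s (s≤s (s≤s z≤n))) (k×0 (suc (2 ℕ.* c) C c)))
          where
          k×0 : ∀ k → k · 0# ≈ 0#
          k×0 zero = refl
          k×0 (suc k) = trans (+-identityˡ _) (k×0 k)
        lucas₁ : gauss 2n (suc n) ≈ κ
        lucas₁ = trans (reflexive (≡.cong (λ k → gauss k (suc n)) 2n≡))
          (q-Lucas (suc (2 ℕ.* c)) (suc c) {0} {0} z<s z<s)

      -- Modulo `D` the numbers 2n, n, n + 1 leave the remainders 2, 1, 2, which is where 2 < `D`
      -- matters. q-Lucas yields κ(1 + y) and κ, and κ(1 + y) - yκ = κ.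
      catalanValue₃ : 2 < D → ∀ c {z} → CatalanValue (suc (c ℕ.* D)) z → z ≈ ((2 ℕ.* c) C c) · 1#
      catalanValue₃ 2<D c {z} h = ∙-cancelʳ (y * κ) z κ (begin
        z + y * κ                        ≈⟨ +-congˡ (*-congˡ lucas₂) ⟨
        z + y * gauss 2n (suc n)         ≈⟨ h ⟩
        gauss 2n n                       ≈⟨ lucas₁ ⟩
        κ * gauss 2 1                    ≈⟨ solve 2 (λ κ y → κ :* (con 1 :+ (y :* con 1) :* (con 1 :+ (y :* con 1) :* con 0)) := κ :+ y :* κ) refl κ y ⟩
        κ + y * κ                        ∎)
        where
        n = suc (c ℕ.* D)
        2n = 2 ℕ.* n
        K = (2 ℕ.* c) C c
        κ = K · 1#
        2n≡ : 2n ≡ 2 ℕ.+ (2 ℕ.* c) ℕ.* D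
        2n≡ = ≡.trans (ℕₚ.*-distribˡ-+ 2 1 (c ℕ.* D)) (≡.cong (2 ℕ.+_) (≡.sym (ℕₚ.*-assoc 2 c D)))
        scaled : ∀ x → K · x ≈ κ * x
        scaled x = sym (trans (×-assoc-* K 1# x) (×-congʳ K (*-identityˡ x)))
        lucas₁ : gauss 2n n ≈ κ * gauss 2 1
        lucas₁ = trans (reflexive (≡.cong (λ k → gauss k n) 2n≡))
          (trans (q-Lucas (2 ℕ.* c) c {2} {1} 2<D (ℕₚ.<-trans (ℕₚ.n<1+n 1) 2<D)) (scaled _))
        lucas₂ : gauss 2n (suc n) ≈ κ
        lucas₂ = trans (reflexive (≡.cong (λ k → gauss k (suc n)) 2n≡))
          (trans (q-Lucas (2 ℕ.* c) c {2} {2} 2<D 2<D)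
            (trans (scaled _) (trans (*-congˡ (gauss-≡ 2)) (*-identityʳ κ))))

open import Algebra.Bundles using (CommutativeRing)
open import Data.Empty using (⊥-elim; ⊥)
open import Data.Integer as ℤ using (ℤ; +_; -[1+_])
open import Data.Integer.DivMod using (_%ℕ_)
import Data.Integer.Properties as ℤₚ
open import Data.List using ([]; _∷_; [_]; _∷ʳ_; length; take; reverse; dropWhile; _++_; map; filter; upTo; replicate; List)
open import Data.List.Membership.Propositional.Properties using (∈-filter⁻; ∈-upTo⁻; ∈-map⁺; ∈-map⁻; ∈-++⁺ˡ; ∈-++⁺ʳ; ∈-++⁻)
import Data.List.Properties as Listₚ
open import Data.Nat as ℕ using (zero; suc; ℕ; _≤_; _<_; z≤n; s≤s; z<s; s<s; _∸_; _+_; _*_; NonZero)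
open import Data.Nat.Combinatorics using (_C_; nC1≡n; nCk≡nC[n∸k]; k>n⇒nCk≡0; nCk+nC[k+1]≡[n+1]C[k+1])
open import Data.Nat.DivMod using (_%_; m%n<n; m<n⇒m%n≡m; m≡m%n+[m/n]*n; _/_; _mod_; %-distribˡ-+; m%n%n≡m%n; [m+kn]%n≡m%n; [m+n]%n≡m%n)
open import Data.Nat.Divisibility as ∣ using (_∣_; _∣?_; divides)
open import Data.Nat.GCD using (gcd; gcd[m,n]∣m; gcd[m,n]∣n; gcd-GCD; module Bézout; c*gcd[m,n]≡gcd[cm,cn]; gcd-greatest)
import Data.Nat.Properties as ℕₚ
open import Data.Nat.Tactic.RingSolver using (solve-∀)
open import Data.Product using (_,_; ∃; _×_; proj₁; proj₂; Σ)
open import Data.Sum using (_⊎_; inj₁; inj₂)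
open import Relation.Binary.Definitions using (tri<; tri≈; tri>)
open import Relation.Binary.PropositionalEquality using (_≡_; refl; sym; trans; cong; cong₂; module ≡-Reasoning; _≢_; subst; subst₂)
open import Relation.Nullary using (yes; no; contradiction; ¬_; Dec)

-- Integer polynomials as a commutative ring.

module Polynomials where
  open import Level using (0ℓ)
  import Relation.Binary.Reasoning.Setoid as SetoidReasoning
  open import Relation.Binary.Structures using (IsEquivalence)
  open import Relation.Binary.Bundles using (Setoid)
  import Algebra.Properties.Group as GroupProperties
  open import Data.List.Relation.Unary.All using ([]; _∷_)

  infix 4 _≈ₚ_

  -- Coefficient lists are identified up to trailing zeros.
  record _≈ₚ_ (p q : Poly) : Set where
    constructor mk≈
    field at : ∀ i → coeff p i ≡ coeff q i
  open _≈ₚ_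

  ≈ₚ-isEquivalence : IsEquivalence _≈ₚ_
  ≈ₚ-isEquivalence = record
    { refl = mk≈ λ _ → refl
    ; sym = λ e → mk≈ λ i → sym (at e i)
    ; trans = λ e f → mk≈ λ i → trans (at e i) (at f i) }

  polySetoid : Setoid 0ℓ 0ℓ
  polySetoid = record { isEquivalence = ≈ₚ-isEquivalence }

  open Setoid polySetoid public using ()
    renaming (refl to ≈-refl; sym to ≈-sym; trans to ≈-trans; reflexive to ≈-reflexive)

  module P-Reasoning = SetoidReasoning polySetoid

  coeff-⊕ : ∀ p q i → coeff (p ⊕ q) i ≡ coeff p i ℤ.+ coeff q i
  coeff-⊕ [] q i = sym (ℤₚ.+-identityˡ _)
  coeff-⊕ (a ∷ p) [] i = sym (ℤₚ.+-identityʳ _)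
  coeff-⊕ (a ∷ p) (b ∷ q) zero = refl
  coeff-⊕ (a ∷ p) (b ∷ q) (suc i) = coeff-⊕ p q i

  coeff-scale : ∀ c p i → coeff (scale c p) i ≡ c ℤ.* coeff p i
  coeff-scale c [] i = sym (ℤₚ.*-zeroʳ c)
  coeff-scale c (a ∷ p) zero = refl
  coeff-scale c (a ∷ p) (suc i) = coeff-scale c p i

  ∷-cong : ∀ {a b p q} → a ≡ b → p ≈ₚ q → a ∷ p ≈ₚ b ∷ q
  ∷-cong e f = mk≈ λ { zero → e ; (suc i) → at f i }

  ⊕-cong : ∀ {p p′ q q′} → p ≈ₚ p′ → q ≈ₚ q′ → p ⊕ q ≈ₚ p′ ⊕ q′
  ⊕-cong {p} {p′} {q} {q′} e f = mk≈ λ i →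
    trans (coeff-⊕ p q i) (trans (cong₂ ℤ._+_ (at e i) (at f i)) (sym (coeff-⊕ p′ q′ i)))

  scale-cong : ∀ c {p q} → p ≈ₚ q → scale c p ≈ₚ scale c q
  scale-cong c {p} {q} e = mk≈ λ i →
    trans (coeff-scale c p i) (trans (cong (c ℤ.*_) (at e i)) (sym (coeff-scale c q i)))

  ⊕-assoc : ∀ p q r → (p ⊕ q) ⊕ r ≈ₚ p ⊕ (q ⊕ r)
  ⊕-assoc p q r = mk≈ λ i → begin
    coeff ((p ⊕ q) ⊕ r) i                      ≡⟨ coeff-⊕ (p ⊕ q) r i ⟩
    coeff (p ⊕ q) i ℤ.+ coeff r i              ≡⟨ cong (ℤ._+ coeff r i) (coeff-⊕ p q i) ⟩
    coeff p i ℤ.+ coeff q i ℤ.+ coeff r i      ≡⟨ ℤₚ.+-assoc (coeff p i) _ _ ⟩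
    coeff p i ℤ.+ (coeff q i ℤ.+ coeff r i)    ≡⟨ cong (ℤ._+_ (coeff p i)) (coeff-⊕ q r i) ⟨
    coeff p i ℤ.+ coeff (q ⊕ r) i              ≡⟨ coeff-⊕ p (q ⊕ r) i ⟨
    coeff (p ⊕ (q ⊕ r)) i                      ∎
    where open ≡-Reasoning

  ⊕-comm : ∀ p q → p ⊕ q ≈ₚ q ⊕ p
  ⊕-comm p q = mk≈ λ i →
    trans (coeff-⊕ p q i) (trans (ℤₚ.+-comm (coeff p i) _) (sym (coeff-⊕ q p i)))

  ⊕-identityʳ : ∀ p → p ⊕ [] ≈ₚ p
  ⊕-identityʳ p = ⊕-comm p []

  ⊕-inverseˡ : ∀ p → negP p ⊕ p ≈ₚ []
  ⊕-inverseˡ p = mk≈ λ i → begin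
    coeff (negP p ⊕ p) i                        ≡⟨ coeff-⊕ (negP p) p i ⟩
    coeff (negP p) i ℤ.+ coeff p i              ≡⟨ cong (ℤ._+ coeff p i) (coeff-scale (ℤ.- (+ 1)) p i) ⟩
    ℤ.- (+ 1) ℤ.* coeff p i ℤ.+ coeff p i       ≡⟨ cong (ℤ._+ coeff p i) (ℤₚ.-1*i≡-i (coeff p i)) ⟩
    ℤ.- coeff p i ℤ.+ coeff p i                 ≡⟨ ℤₚ.+-inverseˡ (coeff p i) ⟩
    + 0                                         ∎
    where open ≡-Reasoning

  scale-⊕ : ∀ c p q → scale c (p ⊕ q) ≈ₚ scale c p ⊕ scale c q
  scale-⊕ c p q = mk≈ λ i → begin
    coeff (scale c (p ⊕ q)) i                       ≡⟨ coeff-scale c (p ⊕ q) i ⟩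
    c ℤ.* coeff (p ⊕ q) i                           ≡⟨ cong (c ℤ.*_) (coeff-⊕ p q i) ⟩
    c ℤ.* (coeff p i ℤ.+ coeff q i)                 ≡⟨ ℤₚ.*-distribˡ-+ c (coeff p i) _ ⟩
    c ℤ.* coeff p i ℤ.+ c ℤ.* coeff q i             ≡⟨ cong₂ ℤ._+_ (coeff-scale c p i) (coeff-scale c q i) ⟨
    coeff (scale c p) i ℤ.+ coeff (scale c q) i     ≡⟨ coeff-⊕ (scale c p) (scale c q) i ⟨
    coeff (scale c p ⊕ scale c q) i                 ∎
    where open ≡-Reasoning

  scale-+ : ∀ a b p → scale (a ℤ.+ b) p ≈ₚ scale a p ⊕ scale b p
  scale-+ a b p = mk≈ λ i → begin
    coeff (scale (a ℤ.+ b) p) i                     ≡⟨ coeff-scale (a ℤ.+ b) p i ⟩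
    (a ℤ.+ b) ℤ.* coeff p i                         ≡⟨ ℤₚ.*-distribʳ-+ (coeff p i) a b ⟩
    a ℤ.* coeff p i ℤ.+ b ℤ.* coeff p i             ≡⟨ cong₂ ℤ._+_ (coeff-scale a p i) (coeff-scale b p i) ⟨
    coeff (scale a p) i ℤ.+ coeff (scale b p) i     ≡⟨ coeff-⊕ (scale a p) (scale b p) i ⟨
    coeff (scale a p ⊕ scale b p) i                 ∎
    where open ≡-Reasoning

  scale-* : ∀ a b p → scale (a ℤ.* b) p ≈ₚ scale a (scale b p)
  scale-* a b p = mk≈ λ i → begin
    coeff (scale (a ℤ.* b) p) i       ≡⟨ coeff-scale (a ℤ.* b) p i ⟩
    a ℤ.* b ℤ.* coeff p i             ≡⟨ ℤₚ.*-assoc a b _ ⟩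
    a ℤ.* (b ℤ.* coeff p i)           ≡⟨ cong (a ℤ.*_) (coeff-scale b p i) ⟨
    a ℤ.* coeff (scale b p) i         ≡⟨ coeff-scale a (scale b p) i ⟨
    coeff (scale a (scale b p)) i     ∎
    where open ≡-Reasoning

  scale-0 : ∀ p → scale (+ 0) p ≈ₚ []
  scale-0 p = mk≈ λ i → trans (coeff-scale (+ 0) p i) (ℤₚ.*-zeroˡ (coeff p i))

  scale-1 : ∀ p → scale (+ 1) p ≈ₚ p
  scale-1 p = mk≈ λ i → trans (coeff-scale (+ 1) p i) (ℤₚ.*-identityˡ (coeff p i))

  0∷[]≈[] : + 0 ∷ [] ≈ₚ []
  0∷[]≈[] = mk≈ λ { zero → refl ; (suc i) → refl }

  ⊕-interchange : ∀ p q r s → (p ⊕ q) ⊕ (r ⊕ s) ≈ₚ (p ⊕ r) ⊕ (q ⊕ s)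
  ⊕-interchange p q r s = begin
    (p ⊕ q) ⊕ (r ⊕ s)    ≈⟨ ⊕-assoc p q (r ⊕ s) ⟩
    p ⊕ (q ⊕ (r ⊕ s))    ≈⟨ ⊕-cong (≈-refl {p}) (⊕-assoc q r s) ⟨
    p ⊕ ((q ⊕ r) ⊕ s)    ≈⟨ ⊕-cong (≈-refl {p}) (⊕-cong (⊕-comm q r) (≈-refl {s})) ⟩
    p ⊕ ((r ⊕ q) ⊕ s)    ≈⟨ ⊕-cong (≈-refl {p}) (⊕-assoc r q s) ⟩
    p ⊕ (r ⊕ (q ⊕ s))    ≈⟨ ⊕-assoc p r (q ⊕ s) ⟨
    (p ⊕ r) ⊕ (q ⊕ s)    ∎
    where open P-Reasoning

  ⊗-distribʳ : ∀ r p q → (p ⊕ q) ⊗ r ≈ₚ p ⊗ r ⊕ q ⊗ r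
  ⊗-distribʳ r [] q = ≈-refl
  ⊗-distribʳ r (a ∷ p) [] = ≈-sym (⊕-identityʳ _)
  ⊗-distribʳ r (a ∷ p) (b ∷ q) = begin
    scale (a ℤ.+ b) r ⊕ (+ 0 ∷ ((p ⊕ q) ⊗ r))
      ≈⟨ ⊕-cong (scale-+ a b r) (∷-cong refl (⊗-distribʳ r p q)) ⟩
    (scale a r ⊕ scale b r) ⊕ ((+ 0 ∷ p ⊗ r) ⊕ (+ 0 ∷ q ⊗ r))
      ≈⟨ ⊕-interchange (scale a r) (scale b r) (+ 0 ∷ p ⊗ r) (+ 0 ∷ q ⊗ r) ⟩
    (a ∷ p) ⊗ r ⊕ (b ∷ q) ⊗ r ∎
    where open P-Reasoning

  ⊗-zeroʳ : ∀ p → p ⊗ [] ≈ₚ []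
  ⊗-zeroʳ [] = ≈-refl
  ⊗-zeroʳ (a ∷ p) = ≈-trans (∷-cong refl (⊗-zeroʳ p)) 0∷[]≈[]

  -- `_⊗_` recurses on its left factor. This is the matching recursion on the right factor, from
  -- which commutativity follows.
  ⊗-∷ʳ : ∀ p b q → p ⊗ (b ∷ q) ≈ₚ scale b p ⊕ (+ 0 ∷ (p ⊗ q))
  ⊗-∷ʳ [] b q = ≈-sym 0∷[]≈[]
  ⊗-∷ʳ (a ∷ p) b q = ∷-cong (cong (ℤ._+ + 0) (ℤₚ.*-comm a b)) (begin
    scale a q ⊕ p ⊗ (b ∷ q)                      ≈⟨ ⊕-cong ≈-refl (⊗-∷ʳ p b q) ⟩
    scale a q ⊕ (scale b p ⊕ (+ 0 ∷ p ⊗ q))      ≈⟨ ⊕-assoc (scale a q) _ _ ⟨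
    (scale a q ⊕ scale b p) ⊕ (+ 0 ∷ p ⊗ q)      ≈⟨ ⊕-cong (⊕-comm (scale a q) _) ≈-refl ⟩
    (scale b p ⊕ scale a q) ⊕ (+ 0 ∷ p ⊗ q)      ≈⟨ ⊕-assoc (scale b p) _ _ ⟩
    scale b p ⊕ (scale a q ⊕ (+ 0 ∷ p ⊗ q))      ∎)
    where open P-Reasoning

  ⊗-comm : ∀ p q → p ⊗ q ≈ₚ q ⊗ p
  ⊗-comm [] q = ≈-sym (⊗-zeroʳ q)
  ⊗-comm (a ∷ p) q = ≈-trans (⊕-cong ≈-refl (∷-cong refl (⊗-comm p q))) (≈-sym (⊗-∷ʳ q a p))

  ⊗-congˡ : ∀ p {q r} → q ≈ₚ r → p ⊗ q ≈ₚ p ⊗ r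
  ⊗-congˡ [] e = ≈-refl
  ⊗-congˡ (a ∷ p) e = ⊕-cong (scale-cong a e) (∷-cong refl (⊗-congˡ p e))

  ⊗-cong : ∀ {p p′ q q′} → p ≈ₚ p′ → q ≈ₚ q′ → p ⊗ q ≈ₚ p′ ⊗ q′
  ⊗-cong {p} {p′} {q} {q′} e f = begin
    p ⊗ q      ≈⟨ ⊗-congˡ p f ⟩
    p ⊗ q′     ≈⟨ ⊗-comm p q′ ⟩
    q′ ⊗ p     ≈⟨ ⊗-congˡ q′ e ⟩
    q′ ⊗ p′    ≈⟨ ⊗-comm q′ p′ ⟩
    p′ ⊗ q′    ∎
    where open P-Reasoning

  scale-⊗ : ∀ a q r → scale a q ⊗ r ≈ₚ scale a (q ⊗ r)
  scale-⊗ a [] r = ≈-refl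
  scale-⊗ a (b ∷ q) r = begin
    scale (a ℤ.* b) r ⊕ (+ 0 ∷ scale a q ⊗ r)
      ≈⟨ ⊕-cong (scale-* a b r) (∷-cong (sym (ℤₚ.*-zeroʳ a)) (scale-⊗ a q r)) ⟩
    scale a (scale b r) ⊕ scale a (+ 0 ∷ q ⊗ r)
      ≈⟨ scale-⊕ a (scale b r) (+ 0 ∷ q ⊗ r) ⟨
    scale a ((b ∷ q) ⊗ r) ∎
    where open P-Reasoning

  ⊗-assoc : ∀ p q r → (p ⊗ q) ⊗ r ≈ₚ p ⊗ (q ⊗ r)
  ⊗-assoc [] q r = ≈-refl
  ⊗-assoc (a ∷ p) q r = begin
    (scale a q ⊕ (+ 0 ∷ p ⊗ q)) ⊗ r
      ≈⟨ ⊗-distribʳ r (scale a q) (+ 0 ∷ p ⊗ q) ⟩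
    scale a q ⊗ r ⊕ (scale (+ 0) r ⊕ (+ 0 ∷ (p ⊗ q) ⊗ r))
      ≈⟨ ⊕-cong (scale-⊗ a q r) (⊕-cong (scale-0 r) (∷-cong refl (⊗-assoc p q r))) ⟩
    scale a (q ⊗ r) ⊕ (+ 0 ∷ p ⊗ (q ⊗ r)) ∎
    where open P-Reasoning

  ⊗-identityˡ : ∀ p → [ + 1 ] ⊗ p ≈ₚ p
  ⊗-identityˡ p = ≈-trans (⊕-cong (scale-1 p) 0∷[]≈[]) (⊕-identityʳ p)

  ⊗-distribˡ : ∀ r p q → r ⊗ (p ⊕ q) ≈ₚ r ⊗ p ⊕ r ⊗ q
  ⊗-distribˡ r p q = ≈-trans (⊗-comm r (p ⊕ q)) (≈-trans (⊗-distribʳ r p q) (⊕-cong (⊗-comm p r) (⊗-comm q r)))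

  polyRing : CommutativeRing 0ℓ 0ℓ
  polyRing = record
    { _≈_ = _≈ₚ_ ; _+_ = _⊕_ ; _*_ = _⊗_ ; -_ = negP ; 0# = [] ; 1# = [ + 1 ]
    ; isCommutativeRing = record
      { isRing = record
        { +-isAbelianGroup = record
          { isGroup = record
            { isMonoid = record
              { isSemigroup = record
                { isMagma = record { isEquivalence = ≈ₚ-isEquivalence ; ∙-cong = ⊕-cong }
                ; assoc = ⊕-assoc }
              ; identity = (λ _ → ≈-refl) , ⊕-identityʳ }
            ; inverse = ⊕-inverseˡ , (λ p → ≈-trans (⊕-comm p (negP p)) (⊕-inverseˡ p))
            ; ⁻¹-cong = scale-cong (ℤ.- (+ 1)) }
          ; comm = ⊕-comm }
        ; *-cong = ⊗-cong
        ; *-assoc = ⊗-assoc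
        ; *-identity = ⊗-identityˡ , (λ p → ≈-trans (⊗-comm p _) (⊗-identityˡ p))
        ; distrib = ⊗-distribˡ , ⊗-distribʳ }
      ; *-comm = ⊗-comm } }

  -- Degrees, trimming and division by monic polynomials.

  open _≈ₚ_

  module PolyRing = CommutativeRing polyRing
  module PolySolver where
    open import Algebra.Solver.Ring.NaturalCoefficients.Default PolyRing.commutativeSemiring public

  -- Zero is allowed for `a`: this is a degree bound together with the coefficient at the bound.
  -- Products then need no case distinction.
  record Leading (p : Poly) (d : ℕ) (a : ℤ) : Set where
    constructor leading
    field
      lead  : coeff p d ≡ a
      above : ∀ i → d < i → coeff p i ≡ + 0
  open Leading

  Monic : Poly → ℕ → Set
  Monic p d = Leading p d (+ 1)

  DegreeBelow : ℕ → Poly → Set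
  DegreeBelow d p = ∀ i → d ≤ i → coeff p i ≡ + 0

  Leading-cong : ∀ {p q d a} → p ≈ₚ q → Leading p d a → Leading q d a
  Leading-cong e (leading l u) = leading (trans (sym (at e _)) l) λ i d<i → trans (sym (at e i)) (u i d<i)

  tail-Leading : ∀ {x p d a} → Leading (x ∷ p) (suc d) a → Leading p d a
  tail-Leading (leading l u) = leading l λ i d<i → u (suc i) (s<s d<i)

  coeff-∷⊗ : ∀ x p q i → coeff ((x ∷ p) ⊗ q) (suc i) ≡ x ℤ.* coeff q (suc i) ℤ.+ coeff (p ⊗ q) i
  coeff-∷⊗ x p q i =
    trans (coeff-⊕ (scale x q) (+ 0 ∷ p ⊗ q) (suc i)) (cong (ℤ._+ coeff (p ⊗ q) i) (coeff-scale x q (suc i)))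

  ⊗-Leading : ∀ {p q d e a b} → Leading p d a → Leading q e b → Leading (p ⊗ q) (d ℕ.+ e) (a ℤ.* b)
  ⊗-Leading {[]} {b = b} (leading l _) _ =
    leading (trans (sym (ℤₚ.*-zeroˡ b)) (cong (ℤ._* b) l)) λ _ _ → refl
  ⊗-Leading {x ∷ p} {q} {zero} {e} (leading l u) (leading m v) =
    leading (trans (at xq e) (trans (coeff-scale x q e) (cong₂ ℤ._*_ l m)))
      λ i e<i → trans (at xq i) (trans (coeff-scale x q i) (trans (cong (x ℤ.*_) (v i e<i)) (ℤₚ.*-zeroʳ x)))
    where
    p≈[] : p ≈ₚ []
    p≈[] = mk≈ λ i → u (suc i) z<s
    xq : (x ∷ p) ⊗ q ≈ₚ scale x q
    xq = ≈-trans (⊕-cong (≈-refl {scale x q}) (≈-trans (∷-cong refl (⊗-cong p≈[] (≈-refl {q}))) 0∷[]≈[]))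
                 (⊕-identityʳ _)
  ⊗-Leading {x ∷ p} {q} {suc d} {e} P@(leading l u) Q@(leading m v) =
    leading (trans (reduce (d ℕ.+ e) (ℕₚ.m≤n+m e d)) (lead PQ)) λ where
      (suc i) (s<s h) → trans (reduce i (ℕₚ.≤-trans (ℕₚ.m≤n+m e d) (ℕₚ.<⇒≤ h))) (above PQ i h)
    where
    PQ : Leading (p ⊗ q) (d ℕ.+ e) _
    PQ = ⊗-Leading {p} (tail-Leading P) Q
    reduce : ∀ i → e ≤ i → coeff ((x ∷ p) ⊗ q) (suc i) ≡ coeff (p ⊗ q) i
    reduce i e≤i = begin
      coeff ((x ∷ p) ⊗ q) (suc i)                    ≡⟨ coeff-∷⊗ x p q i ⟩
      x ℤ.* coeff q (suc i) ℤ.+ coeff (p ⊗ q) i      ≡⟨ cong (λ z → x ℤ.* z ℤ.+ coeff (p ⊗ q) i) (v (suc i) (s≤s e≤i)) ⟩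
      x ℤ.* + 0 ℤ.+ coeff (p ⊗ q) i                  ≡⟨ cong (ℤ._+ _) (ℤₚ.*-zeroʳ x) ⟩
      + 0 ℤ.+ coeff (p ⊗ q) i                        ≡⟨ ℤₚ.+-identityˡ _ ⟩
      coeff (p ⊗ q) i                                ∎
      where open ≡-Reasoning

  ⊗-Monic : ∀ {p q d e} → Monic p d → Monic q e → Monic (p ⊗ q) (d ℕ.+ e)
  ⊗-Monic {p} {q} = ⊗-Leading {p} {q}

  1-Monic : Monic [ + 1 ] 0
  1-Monic = leading refl λ { (suc i) _ → refl }

  leading? : ∀ q → q ≈ₚ [] ⊎ ∃ λ d → ∃ λ b → b ≢ + 0 × Leading q d b
  leading? [] = inj₁ ≈-refl
  leading? (b ∷ q) with leading? q
  ... | inj₂ (d , c , c≢0 , leading l u) = inj₂ (suc d , c , c≢0 , leading l λ { (suc i) (s<s h) → u i h })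
  ... | inj₁ q≈[] with b ℤ.≟ + 0
  ...   | yes refl = inj₁ (≈-trans (∷-cong refl q≈[]) 0∷[]≈[])
  ...   | no b≢0 = inj₂ (0 , b , b≢0 , leading refl λ { (suc i) _ → at q≈[] i })

  dropWhile-∷ʳ : ∀ xs a →
    (dropWhile (ℤ._≟ + 0) xs ≡ [] × dropWhile (ℤ._≟ + 0) (xs ∷ʳ a) ≡ dropWhile (ℤ._≟ + 0) [ a ]) ⊎
    (dropWhile (ℤ._≟ + 0) xs ≢ [] × dropWhile (ℤ._≟ + 0) (xs ∷ʳ a) ≡ dropWhile (ℤ._≟ + 0) xs ∷ʳ a)
  dropWhile-∷ʳ [] a = inj₁ (refl , refl)
  dropWhile-∷ʳ (x ∷ xs) a with x ℤ.≟ + 0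
  ... | yes _ = dropWhile-∷ʳ xs a
  ... | no _ = inj₂ ((λ ()) , refl)

  -- `trim` works through two reversals. This recovers a recursion from the front: the head is kept
  -- unconditionally once something nonzero follows it.
  trim-∷ : ∀ a p →
    (trim p ≡ [] × trim (a ∷ p) ≡ trim [ a ]) ⊎ (trim p ≢ [] × trim (a ∷ p) ≡ a ∷ trim p)
  trim-∷ a p with dropWhile-∷ʳ (reverse p) a
  ... | inj₁ (e , f) =
    inj₁ (cong reverse e , cong reverse (trans (cong (dropWhile (ℤ._≟ + 0)) (Listₚ.unfold-reverse a p)) f))
  ... | inj₂ (e , f) = inj₂ ((λ r → e (Listₚ.reverse-injective r)) ,
    trans (cong reverse (trans (cong (dropWhile (ℤ._≟ + 0)) (Listₚ.unfold-reverse a p)) f))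
          (Listₚ.reverse-++ (dropWhile (ℤ._≟ + 0) (reverse p)) [ a ]))

  trim-[a]≈ : ∀ a → trim [ a ] ≈ₚ [ a ]
  trim-[a]≈ a with a ℤ.≟ + 0
  ... | yes refl = ≈-sym 0∷[]≈[]
  ... | no _ = ≈-refl

  trim-≈ : ∀ p → trim p ≈ₚ p
  trim-≈ [] = ≈-refl
  trim-≈ (a ∷ p) with trim-∷ a p
  ... | inj₂ (_ , e) = ≈-trans (≈-reflexive e) (∷-cong refl (trim-≈ p))
  ... | inj₁ (e , f) = ≈-trans (≈-reflexive f) (≈-trans (trim-[a]≈ a)
                         (∷-cong refl (≈-trans (≈-reflexive (sym e)) (trim-≈ p))))

  trim-≈[] : ∀ p → p ≈ₚ [] → trim p ≡ []
  trim-≈[] [] _ = refl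
  trim-≈[] (a ∷ p) z with trim-∷ a p
  ... | inj₂ (e , _) = ⊥-elim (e (trim-≈[] p (mk≈ λ i → at z (suc i))))
  ... | inj₁ (_ , f) with at z 0
  ...   | refl = f

  length-trim : ∀ {g d} → Monic g d → length (trim g) ≡ suc d
  length-trim {[]} (leading () _)
  length-trim {a ∷ g} {zero} (leading refl u) with trim-∷ (+ 1) g
  ... | inj₁ (_ , f) = cong length f
  ... | inj₂ (e , _) = ⊥-elim (e (trim-≈[] g (mk≈ λ i → u (suc i) z<s)))
  length-trim {a ∷ g} {suc d} M with length-trim {g} (tail-Leading M) | trim-∷ a g
  ... | l | inj₂ (_ , f) = trans (cong length f) (cong suc l)
  ... | l | inj₁ (e , _) with trans (sym (cong length e)) l
  ...   | ()

  divStep : Poly → ℤ → Poly × Poly → Poly × Poly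
  divStep g a (q , r) = (c ∷ q) , take d ((a ∷ r) ⊕ negP (scale c (trim g)))
    where
    d = length (trim g) ∸ 1
    c = coeff (a ∷ r) d

  -- The recursion inside divModMonic is local to it; the following pair lets
  -- unification give it the name divLoop.
  mutual
    divLoop : Poly → Poly → Poly → Poly × Poly
    divLoop = _

    divMod-∷ : ∀ g a p → divModMonic g (a ∷ p) ≡ divStep g a (divLoop g (a ∷ p) p)
    divMod-∷ g a p with a ∷ p
    ... | P = refl

  coeff-take : ∀ d p → DegreeBelow d p → take d p ≈ₚ p
  coeff-take zero p z = mk≈ λ i → sym (z i z≤n)
  coeff-take (suc d) [] z = ≈-refl
  coeff-take (suc d) (a ∷ p) z = ∷-cong refl (coeff-take d p (λ i d≤i → z (suc i) (s≤s d≤i)))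

  cancelTop : ∀ {g d} → Monic g d → ∀ s → DegreeBelow (suc d) s →
    DegreeBelow d (s ⊕ negP (scale (coeff s d) g))
  cancelTop {g} {d} M s z i d≤i = trans (coeff-⊕ s _ i) (trans (cong (λ x → coeff s i ℤ.+ x)
      (trans (coeff-scale (ℤ.- (+ 1)) (scale (coeff s d) g) i)
        (trans (ℤₚ.-1*i≡-i _) (cong ℤ.-_ (coeff-scale (coeff s d) g i))))) (go (ℕₚ.m≤n⇒m<n∨m≡n d≤i)))
    where
    go : d < i ⊎ d ≡ i → coeff s i ℤ.- coeff s d ℤ.* coeff g i ≡ + 0
    go (inj₁ d<i) = cong₂ ℤ._-_ (z i d<i) (trans (cong (coeff s d ℤ.*_) (above M i d<i)) (ℤₚ.*-zeroʳ (coeff s d)))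
    go (inj₂ refl) = trans (cong (λ x → coeff s d ℤ.- coeff s d ℤ.* x) (lead M))
                       (trans (cong (λ x → coeff s d ℤ.- x) (ℤₚ.*-identityʳ (coeff s d))) (ℤₚ.+-inverseʳ (coeff s d)))

  divLoop-correct : ∀ {g d} → Monic g d → ∀ P p →
    let q , r = divLoop g P p in p ≈ₚ g ⊗ q ⊕ r × DegreeBelow d r
  divLoop-correct {g} M P [] = ≈-sym (≈-trans (⊕-identityʳ _) (⊗-zeroʳ g)) , λ _ _ → refl
  divLoop-correct {g} {d} M P (a ∷ p) with divLoop g P p | divLoop-correct M P p
  ... | q , r | p≈ , r< rewrite length-trim M =
    eq , λ i d≤i → trans (at r′≈ i) (cancelTop (Leading-cong (≈-sym (trim-≈ g)) M) s s< i d≤i)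
    where
    s = a ∷ r
    c = coeff s d
    s< : DegreeBelow (suc d) s
    s< (suc i) (s≤s h) = r< i h
    r′ = s ⊕ negP (scale c (trim g))
    r′≈ : take d r′ ≈ₚ r′
    r′≈ = coeff-take d r′ (cancelTop (Leading-cong (≈-sym (trim-≈ g)) M) s s<)
    open P-Reasoning
    eq : a ∷ p ≈ₚ g ⊗ (c ∷ q) ⊕ take d r′
    eq = begin
      a ∷ p                                   ≈⟨ ∷-cong (sym (ℤₚ.+-identityˡ a)) p≈ ⟩
      (+ 0 ∷ g ⊗ q) ⊕ s                       ≈⟨ PolySolver.solve 3 (λ x y z → x PolySolver.:+ y PolySolver.:+ z PolySolver.:= y PolySolver.:+ (x PolySolver.:+ z)) ≈-refl [] (+ 0 ∷ g ⊗ q) s ⟩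
      (+ 0 ∷ g ⊗ q) ⊕ ([] ⊕ s)                ≈⟨ ⊕-cong (≈-refl {+ 0 ∷ g ⊗ q}) (⊕-cong (≈-sym (PolyRing.-‿inverseʳ (scale c g))) (≈-refl {s})) ⟩
      (+ 0 ∷ g ⊗ q) ⊕ ((scale c g ⊕ negP (scale c g)) ⊕ s)
        ≈⟨ PolySolver.solve 4 (λ x y z w → x PolySolver.:+ ((y PolySolver.:+ z) PolySolver.:+ w) PolySolver.:= (y PolySolver.:+ x) PolySolver.:+ (w PolySolver.:+ z)) ≈-refl (+ 0 ∷ g ⊗ q) (scale c g) (negP (scale c g)) s ⟩
      (scale c g ⊕ (+ 0 ∷ g ⊗ q)) ⊕ (s ⊕ negP (scale c g))
        ≈⟨ ⊕-cong (⊗-∷ʳ g c q) (⊕-cong (≈-refl {s}) (scale-cong (ℤ.- (+ 1)) (scale-cong c (trim-≈ g)))) ⟨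
      g ⊗ (c ∷ q) ⊕ r′                        ≈⟨ ⊕-cong (≈-refl {g ⊗ (c ∷ q)}) r′≈ ⟨
      g ⊗ (c ∷ q) ⊕ take d r′                 ∎

  divMod-correct : ∀ {g d} → Monic g d → ∀ p → p ≈ₚ g ⊗ quotP p g ⊕ remP p g × DegreeBelow d (remP p g)
  divMod-correct M p = divLoop-correct M p p

  -- The product of `g` with the tail of the second factor inherits the degree bound, so the tail
  -- vanishes by induction. The coefficient at `d` is then the head times the leading coefficient 1.
  ⊗-DegreeBelow⇒≈[] : ∀ {g d} → Monic g d → ∀ q → DegreeBelow d (g ⊗ q) → q ≈ₚ []
  ⊗-DegreeBelow⇒≈[] M [] z = ≈-refl
  ⊗-DegreeBelow⇒≈[] {g} {d} M (b ∷ q) z =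
    mk≈ λ { zero → b≡0 ; (suc i) → at q≈[] i }
    where
    coeffs : ∀ i → coeff (g ⊗ (b ∷ q)) i ≡ b ℤ.* coeff g i ℤ.+ coeff (+ 0 ∷ g ⊗ q) i
    coeffs i = trans (at (⊗-∷ʳ g b q) i) (trans (coeff-⊕ (scale b g) _ i)
                 (cong (ℤ._+ coeff (+ 0 ∷ g ⊗ q) i) (coeff-scale b g i)))
    q≈[] : q ≈ₚ []
    q≈[] = ⊗-DegreeBelow⇒≈[] M q λ i d≤i → begin
      coeff (g ⊗ q) i                                      ≡⟨ ℤₚ.+-identityˡ _ ⟨
      + 0 ℤ.+ coeff (g ⊗ q) i                              ≡⟨ cong (ℤ._+ coeff (g ⊗ q) i) (ℤₚ.*-zeroʳ b) ⟨
      b ℤ.* + 0 ℤ.+ coeff (g ⊗ q) i                        ≡⟨ cong (λ x → b ℤ.* x ℤ.+ coeff (g ⊗ q) i) (above M (suc i) (s≤s d≤i)) ⟨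
      b ℤ.* coeff g (suc i) ℤ.+ coeff (g ⊗ q) i            ≡⟨ coeffs (suc i) ⟨
      coeff (g ⊗ (b ∷ q)) (suc i)                          ≡⟨ z (suc i) (ℕₚ.m≤n⇒m≤1+n d≤i) ⟩
      + 0                                                  ∎
      where open ≡-Reasoning
    b≡0 : b ≡ + 0
    b≡0 = begin
      b                                                    ≡⟨ ℤₚ.*-identityʳ b ⟨
      b ℤ.* + 1                                            ≡⟨ cong (b ℤ.*_) (lead M) ⟨
      b ℤ.* coeff g d                                      ≡⟨ ℤₚ.+-identityʳ _ ⟨
      b ℤ.* coeff g d ℤ.+ + 0                              ≡⟨ cong (λ x → b ℤ.* coeff g d ℤ.+ x) (at (≈-trans (∷-cong refl (≈-trans (⊗-congˡ g q≈[]) (⊗-zeroʳ g))) 0∷[]≈[]) d) ⟨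
      b ℤ.* coeff g d ℤ.+ coeff (+ 0 ∷ g ⊗ q) d            ≡⟨ coeffs d ⟨
      coeff (g ⊗ (b ∷ q)) d                                ≡⟨ z d ℕₚ.≤-refl ⟩
      + 0                                                  ∎
      where open ≡-Reasoning

  open GroupProperties PolyRing.+-group using () renaming (x≈y⇒x∙y⁻¹≈ε to x≈y⇒x-y≈0; x∙y⁻¹≈ε⇒x≈y to x-y≈0⇒x≈y)

  ⊕-cancelʳ : ∀ r p q → p ⊕ r ≈ₚ q ⊕ r → p ≈ₚ q
  ⊕-cancelʳ = GroupProperties.∙-cancelʳ PolyRing.+-group

  negP-⊗ʳ : ∀ p q → p ⊗ negP q ≈ₚ negP (p ⊗ q)
  negP-⊗ʳ p q = ≈-sym (-‿distribʳ-* p q)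
    where open import Algebra.Properties.Ring PolyRing.ring

  division-unique : ∀ {g d} → Monic g d → ∀ {q q′ r r′} → DegreeBelow d r → DegreeBelow d r′ →
    g ⊗ q ⊕ r ≈ₚ g ⊗ q′ ⊕ r′ → q ≈ₚ q′ × r ≈ₚ r′
  division-unique {g} {d} M {q} {q′} {r} {r′} r< r′< e = q≈q′ , r≈r′
    where
    open P-Reasoning
    open PolySolver
    eq : g ⊗ (q ⊕ negP q′) ⊕ r ≈ₚ r′
    eq = begin
      g ⊗ (q ⊕ negP q′) ⊕ r                  ≈⟨ solve 4 (λ g q n r → g :* (q :+ n) :+ r := (g :* q :+ r) :+ g :* n) ≈-refl g q (negP q′) r ⟩
      (g ⊗ q ⊕ r) ⊕ g ⊗ negP q′              ≈⟨ ⊕-cong e (negP-⊗ʳ g q′) ⟩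
      (g ⊗ q′ ⊕ r′) ⊕ negP (g ⊗ q′)          ≈⟨ solve 3 (λ x y z → (x :+ y) :+ z := (x :+ z) :+ y) ≈-refl (g ⊗ q′) r′ (negP (g ⊗ q′)) ⟩
      (g ⊗ q′ ⊕ negP (g ⊗ q′)) ⊕ r′          ≈⟨ ⊕-cong (PolyRing.-‿inverseʳ (g ⊗ q′)) (≈-refl {r′}) ⟩
      r′                                     ∎
    q≈q′ : q ≈ₚ q′
    q≈q′ = x-y≈0⇒x≈y q q′ (⊗-DegreeBelow⇒≈[] M (q ⊕ negP q′) λ i d≤i →
      trans (sym (ℤₚ.+-identityʳ _)) (trans (cong (λ x → coeff (g ⊗ (q ⊕ negP q′)) i ℤ.+ x) (sym (r< i d≤i)))
        (trans (sym (coeff-⊕ (g ⊗ (q ⊕ negP q′)) r i)) (trans (at eq i) (r′< i d≤i)))))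
    r≈r′ : r ≈ₚ r′
    r≈r′ = ≈-trans (≈-sym (⊕-cong {p = g ⊗ (q ⊕ negP q′)} {p′ = []}
             (≈-trans (⊗-congˡ g (x≈y⇒x-y≈0 q≈q′)) (⊗-zeroʳ g)) (≈-refl {r}))) eq

  exact-division : ∀ {g d} → Monic g d → ∀ {p q} → p ≈ₚ g ⊗ q → quotP p g ≈ₚ q × remP p g ≈ₚ []
  exact-division {g} M {p} {q} e with divMod-correct M p
  ... | eq , r< = division-unique M r< (λ _ _ → refl)
                    (≈-trans (≈-sym eq) (≈-trans e (≈-sym (⊕-identityʳ (g ⊗ q)))))

  ⊗-cancelˡ : ∀ {g d} → Monic g d → ∀ {q q′} → g ⊗ q ≈ₚ g ⊗ q′ → q ≈ₚ q′
  ⊗-cancelˡ M e = proj₁ (division-unique M {r = []} {r′ = []} (λ _ _ → refl) (λ _ _ → refl) (⊕-cong e (≈-refl {[]})))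

  cofactor-Monic : ∀ {p g q d e} → Monic g d → Monic p e → p ≈ₚ g ⊗ q → ∃ (Monic q)
  cofactor-Monic {p} {g} {q} {d} {e} G P p≈gq with leading? q
  ... | inj₁ q≈[] = contradiction
          (trans (sym (at (≈-trans p≈gq (≈-trans (⊗-congˡ g q≈[]) (⊗-zeroʳ g))) e)) (lead P)) λ ()
  ... | inj₂ (f , b , b≢0 , Q) = f , subst (Leading q f) b≡1 Q
    where
    GQ : Leading p (d ℕ.+ f) b
    GQ = Leading-cong (≈-sym p≈gq) (subst (Leading (g ⊗ q) (d ℕ.+ f)) (ℤₚ.*-identityˡ b) (⊗-Leading {g} {q} G Q))
    b≡1 : b ≡ + 1
    b≡1 with ℕₚ.<-cmp e (d ℕ.+ f)
    ... | tri< e< _ _ = ⊥-elim (b≢0 (trans (sym (lead GQ)) (above P _ e<)))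
    ... | tri> _ _ e> = contradiction (trans (sym (lead P)) (above GQ _ e>)) λ ()
    ... | tri≈ _ refl _ = trans (sym (lead GQ)) (lead P)

  -- Modulo a monic polynomial, remainders are unique: n times the remainder of `p` is the remainder
  -- of `scale n p`, hence zero, and ℤ has no torsion. This is what makes irreducibility of Φ_m
  -- dispensable.
  scale-torsionFree : ∀ {g d} → Monic g d → ∀ {n} p q → n ≢ + 0 → scale n p ≈ₚ g ⊗ q → ∃ λ q′ → p ≈ₚ g ⊗ q′
  scale-torsionFree {g} {d} M {n} p q n≢0 e with divMod-correct M p
  ... | eq , r< = quotP p g , ≈-trans eq (≈-trans (⊕-cong (≈-refl {g ⊗ quotP p g}) r≈[]) (⊕-identityʳ _))
    where
    open P-Reasoning
    r = remP p g
    nr≈[] : scale n r ≈ₚ []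
    nr≈[] = proj₂ (division-unique M {scale n (quotP p g)} {q} {scale n r} {[]}
      (λ i d≤i → trans (coeff-scale n r i) (trans (cong (n ℤ.*_) (r< i d≤i)) (ℤₚ.*-zeroʳ n))) (λ _ _ → refl)
      (begin
        g ⊗ scale n (quotP p g) ⊕ scale n r
          ≈⟨ ⊕-cong (≈-trans (⊗-comm g _) (≈-trans (scale-⊗ n (quotP p g) g) (scale-cong n (⊗-comm (quotP p g) g)))) (≈-refl {scale n r}) ⟩
        scale n (g ⊗ quotP p g) ⊕ scale n r          ≈⟨ scale-⊕ n (g ⊗ quotP p g) r ⟨
        scale n (g ⊗ quotP p g ⊕ r)                  ≈⟨ scale-cong n eq ⟨
        scale n p                                    ≈⟨ e ⟩
        g ⊗ q                                        ≈⟨ ⊕-identityʳ _ ⟨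
        g ⊗ q ⊕ []                                   ∎))
    r≈[] : r ≈ₚ []
    r≈[] = mk≈ λ i → ℤₚ.*-cancelˡ-≡ n (coeff r i) (+ 0) {{ℤ.≢-nonZero n≢0}}
      (trans (sym (coeff-scale n r i)) (trans (at nr≈[] i) (sym (ℤₚ.*-zeroʳ n))))

  ≈[]⇒IsZeroP : ∀ {p} → p ≈ₚ [] → IsZeroP p
  ≈[]⇒IsZeroP {[]} e = []
  ≈[]⇒IsZeroP {a ∷ p} e = at e 0 ∷ ≈[]⇒IsZeroP (mk≈ λ i → at e (suc i))

-- Cyclotomic polynomials: exactness of their definition and non-zero-divisors modulo them.

module CyclotomicPolynomials where
  open QAnalogues
  open Polynomials
  open import Data.Nat.Induction using (<-rec)
  import Data.List.Relation.Unary.All as All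

  open _≈ₚ_
  open import Algebra.Properties.Semiring.Exp PolyRing.semiring using (_^_; ^-homo-*; ^-assocʳ)
  open import Algebra.Properties.Semiring.Mult PolyRing.semiring using () renaming (_×_ to _×ₚ_)

  X : Poly
  X = + 0 ∷ [ + 1 ]

  module Mod (g : Poly) where
    open QuotientRing polyRing g public
    module Q = CommutativeRing quotient
    open import Algebra.Properties.Semiring.Exp Q.semiring using () renaming (_^_ to _^/_)
    open import Algebra.Properties.Semiring.Mult Q.semiring using () renaming (_×_ to _×/_)

    -- The quotient ring has the same multiplication, but its power function is another instance of
    -- the generic recursion, so the two agree only by induction.
    ^/≡^ : ∀ p k → p ^/ k ≡ p ^ k
    ^/≡^ p zero = refl
    ^/≡^ p (suc k) = cong (p ⊗_) (^/≡^ p k)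

    ×/≡× : ∀ p k → k ×/ p ≡ k ×ₚ p
    ×/≡× p zero = refl
    ×/≡× p (suc k) = cong (p ⊕_) (×/≡× p k)

    module Series (y : Poly) where
      private
        module M = QSeries quotient y
        module P = QSeries polyRing y

      geom/≡geom : ∀ k → M.geom k ≡ P.geom k
      geom/≡geom zero = refl
      geom/≡geom (suc k) = cong (λ z → [ + 1 ] ⊕ y ⊗ z) (geom/≡geom k)

      gauss/≡gauss : ∀ a b → M.gauss a b ≡ P.gauss a b
      gauss/≡gauss a zero = refl
      gauss/≡gauss zero (suc b) = refl
      gauss/≡gauss (suc a) (suc b) = cong₂ _⊕_ (gauss/≡gauss a b) (cong₂ _⊗_ (^/≡^ y (suc b)) (gauss/≡gauss a (suc b)))

    fixed⇒power-fixed : ∀ {y p} → (y ⊗ p) ≈/ p → ∀ k → (y ^ k ⊗ p) ≈/ p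
    fixed⇒power-fixed {y} {p} e k =
      subst (λ z → (z ⊗ p) ≈/ p) (^/≡^ y k) (QSeries.^-fixed quotient y e k)

    X^-fixed-multiple : ∀ {j p} → (X ^ j ⊗ p) ≈/ p → ∀ x → (X ^ (x ℕ.* j) ⊗ p) ≈/ p
    X^-fixed-multiple {j} f x = ≈/-trans (≈⇒≈/ (⊗-cong (≈-trans (≈-reflexive (cong (X ^_) (ℕₚ.*-comm x j)))
      (≈-sym (^-assocʳ X j x))) ≈-refl)) (fixed⇒power-fixed f x)

  X⊗ : ∀ p → X ⊗ p ≈ₚ + 0 ∷ p
  X⊗ p = ≈-trans (⊕-cong (scale-0 p) ≈-refl) (∷-cong refl (⊗-identityˡ p))

  ∷≈⊕X : ∀ a p → a ∷ p ≈ₚ [ a ] ⊕ X ⊗ p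
  ∷≈⊕X a p = ≈-trans (∷-cong (sym (ℤₚ.+-identityʳ a)) ≈-refl) (⊕-cong (≈-refl {[ a ]}) (≈-sym (X⊗ p)))

  monomial≈X^ : ∀ e → monomial e ≈ₚ X ^ e
  monomial≈X^ zero = ≈-refl
  monomial≈X^ (suc e) = ≈-trans (∷-cong refl (monomial≈X^ e)) (≈-sym (X⊗ (X ^ e)))

  ×ₚ≈scale : ∀ n p → n ×ₚ p ≈ₚ scale (+ n) p
  ×ₚ≈scale zero p = ≈-sym (scale-0 p)
  ×ₚ≈scale (suc n) p = ≈-trans (⊕-cong (≈-sym (scale-1 p)) (×ₚ≈scale n p)) (≈-sym (scale-+ (+ 1) (+ n) p))

  monomial-Monic : ∀ e → Monic (monomial e) e
  monomial-Monic zero = 1-Monic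
  monomial-Monic (suc e) with monomial-Monic e
  ... | leading l u = leading l λ { (suc i) (s<s h) → u i h }

  xPowMinus1-Monic : ∀ m → Monic (xPowMinus1 (suc m)) (suc m)
  xPowMinus1-Monic m with monomial-Monic m
  ... | leading l u = Leading-cong (∷-cong refl (≈-sym (⊕-identityʳ (monomial m)))) (leading l λ { (suc i) (s<s h) → u i h })

  xPowMinus1⊕1 : ∀ m → xPowMinus1 m ⊕ [ + 1 ] ≈ₚ X ^ m
  xPowMinus1⊕1 m = begin
    (monomial m ⊕ negP [ + 1 ]) ⊕ [ + 1 ]    ≈⟨ ⊕-assoc (monomial m) (negP [ + 1 ]) [ + 1 ] ⟩
    monomial m ⊕ (negP [ + 1 ] ⊕ [ + 1 ])    ≈⟨ ⊕-cong (monomial≈X^ m) (⊕-inverseˡ [ + 1 ]) ⟩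
    X ^ m ⊕ []                               ≈⟨ ⊕-identityʳ (X ^ m) ⟩
    X ^ m                                    ∎
    where open P-Reasoning

  -- The first argument of `cycloF` is fuel. Recursive calls go to proper divisors, which are
  -- positive since 0 divides no positive `m`, so any fuel of at least `m` suffices.
  cycloF-fuel : ∀ f f′ {m} → 0 < m → m ≤ f → m ≤ f′ → cycloF f m ≡ cycloF f′ m
  cycloF-fuel (suc f) (suc f′) {m} 0<m m≤f m≤f′ =
    cong (λ l → quotP (xPowMinus1 m) (prodP l)) (Listₚ.map-cong-local (All.tabulate λ {d} d∈ →
      let d∈upTo , d∣m = ∈-filter⁻ (_∣? m) d∈
          d<m = ∈-upTo⁻ d∈upTo
      in cycloF-fuel f f′ (ℕₚ.n≢0⇒n>0 λ { refl → ℕₚ.<⇒≢ 0<m (sym (∣.0∣⇒≡0 d∣m)) })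
           (ℕₚ.≤-pred (ℕₚ.≤-trans d<m m≤f)) (ℕₚ.≤-pred (ℕₚ.≤-trans d<m m≤f′))))
  cycloF-fuel zero _ 0<m m≤0 _ = ⊥-elim (ℕₚ.n≮0 (ℕₚ.≤-trans 0<m m≤0))
  cycloF-fuel (suc f) zero 0<m _ m≤0 = ⊥-elim (ℕₚ.n≮0 (ℕₚ.≤-trans 0<m m≤0))

  -- The bound `k` is separate from `a` so that factors can be added one at a time and partial
  -- products for different numbers can be compared.
  divisorProd : ℕ → ℕ → Poly
  divisorProd a k = prodP (map cyclotomic (filter (_∣? a) (upTo k)))

  prodP-++ : ∀ ps qs → prodP (ps ++ qs) ≈ₚ prodP ps ⊗ prodP qs
  prodP-++ [] qs = ≈-sym (⊗-identityˡ (prodP qs))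
  prodP-++ (p ∷ ps) qs = ≈-trans (⊗-congˡ p (prodP-++ ps qs)) (≈-sym (⊗-assoc p (prodP ps) (prodP qs)))

  divisorProd-suc : ∀ a k → divisorProd a (suc k) ≈ₚ divisorProd a k ⊗ prodP (map cyclotomic (filter (_∣? a) [ k ]))
  divisorProd-suc a k = ≈-trans (≈-reflexive (cong prodP (trans
      (cong (λ l → map cyclotomic (filter (_∣? a) l)) (sym (Listₚ.upTo-∷ʳ k)))
      (trans (cong (map cyclotomic) (Listₚ.filter-++ (_∣? a) (upTo k) [ k ]))
             (Listₚ.map-++ cyclotomic (filter (_∣? a) (upTo k)) _)))))
    (prodP-++ (map cyclotomic (filter (_∣? a) (upTo k))) _)

  divisorProd-yes : ∀ {a k} → k ∣ a → divisorProd a (suc k) ≈ₚ divisorProd a k ⊗ cyclotomic k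
  divisorProd-yes {a} {k} k∣a = ≈-trans (divisorProd-suc a k) (⊗-congˡ (divisorProd a k)
    (≈-trans (≈-reflexive (cong (λ l → prodP (map cyclotomic l)) (Listₚ.filter-accept (_∣? a) {k} {[]} k∣a)))
             (≈-trans (⊗-comm (cyclotomic k) [ + 1 ]) (⊗-identityˡ (cyclotomic k)))))

  divisorProd-no : ∀ {a k} → ¬ k ∣ a → divisorProd a (suc k) ≈ₚ divisorProd a k
  divisorProd-no {a} {k} k∤a = ≈-trans (divisorProd-suc a k) (≈-trans (⊗-congˡ (divisorProd a k)
    (≈-reflexive (cong (λ l → prodP (map cyclotomic l)) (Listₚ.filter-reject (_∣? a) {k} {[]} k∤a))))
    (≈-trans (⊗-comm (divisorProd a k) [ + 1 ]) (⊗-identityˡ (divisorProd a k))))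

  cyclotomic≡quotP : ∀ n → 0 < n → cyclotomic n ≡ quotP (xPowMinus1 n) (divisorProd n n)
  cyclotomic≡quotP (suc n) _ = cong (λ l → quotP (xPowMinus1 (suc n)) (prodP l)) (Listₚ.map-cong-local (All.tabulate λ {d} d∈ →
      let d∈upTo , d∣m = ∈-filter⁻ (_∣? suc n) d∈
          d<m = ∈-upTo⁻ d∈upTo
      in cycloF-fuel n d (ℕₚ.n≢0⇒n>0 λ { refl → contradiction (∣.0∣⇒≡0 d∣m) λ () }) (ℕₚ.≤-pred d<m) ℕₚ.≤-refl))

  _∣ₚ_ : Poly → Poly → Set
  p ∣ₚ q = ∃ λ r → q ≈ₚ p ⊗ r

  divisorProd-∣ : ∀ {a b} → a ∣ b → ∀ k → divisorProd a k ∣ₚ divisorProd b k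
  divisorProd-∣ a∣b zero = [ + 1 ] , ≈-sym (⊗-identityˡ [ + 1 ])
  divisorProd-∣ {a} {b} a∣b (suc k) with divisorProd-∣ a∣b k | k ∣? a | k ∣? b
  ... | z , e | yes k∣a | no k∤b = contradiction (∣.∣-trans k∣a a∣b) k∤b
  ... | z , e | no k∤a | no k∤b =
    z , ≈-trans (divisorProd-no k∤b) (≈-trans e (⊗-cong (≈-sym (divisorProd-no k∤a)) ≈-refl))
  ... | z , e | no k∤a | yes k∣b = z ⊗ cyclotomic k , (begin
    divisorProd b (suc k)                           ≈⟨ divisorProd-yes k∣b ⟩
    divisorProd b k ⊗ cyclotomic k                  ≈⟨ ⊗-cong e ≈-refl ⟩
    (divisorProd a k ⊗ z) ⊗ cyclotomic k            ≈⟨ ⊗-assoc (divisorProd a k) z _ ⟩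
    divisorProd a k ⊗ (z ⊗ cyclotomic k)            ≈⟨ ⊗-cong (divisorProd-no k∤a) ≈-refl ⟨
    divisorProd a (suc k) ⊗ (z ⊗ cyclotomic k)      ∎)
    where open P-Reasoning
  ... | z , e | yes k∣a | yes k∣b = z , (begin
    divisorProd b (suc k)                           ≈⟨ divisorProd-yes k∣b ⟩
    divisorProd b k ⊗ cyclotomic k                  ≈⟨ ⊗-cong e ≈-refl ⟩
    (divisorProd a k ⊗ z) ⊗ cyclotomic k            ≈⟨ solve 3 (λ u v w → (u :* v) :* w := (u :* w) :* v) ≈-refl (divisorProd a k) z (cyclotomic k) ⟩
    (divisorProd a k ⊗ cyclotomic k) ⊗ z            ≈⟨ ⊗-cong (divisorProd-yes k∣a) ≈-refl ⟨
    divisorProd a (suc k) ⊗ z                       ∎)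
    where open P-Reasoning
          open PolySolver

  divisorProd-≤ : ∀ a {j k} → j ≤ k → divisorProd a j ∣ₚ divisorProd a k
  divisorProd-≤ a {j} {k} j≤k with ℕₚ.m≤n⇒m<n∨m≡n j≤k
  ... | inj₂ refl = [ + 1 ] , ≈-sym (≈-trans (⊗-comm _ [ + 1 ]) (⊗-identityˡ _))
  ... | inj₁ (s≤s {n = k′} j≤k′) with divisorProd-≤ a j≤k′ | k′ ∣? a
  ...   | z , e | no k∤a = z , ≈-trans (divisorProd-no k∤a) e
  ...   | z , e | yes k∣a = z ⊗ cyclotomic k′ ,
    ≈-trans (divisorProd-yes k∣a) (≈-trans (⊗-cong e ≈-refl) (⊗-assoc (divisorProd a j) z _))

  factorisation⇒X^n-fixed : ∀ n → divisorProd n n ⊗ cyclotomic n ≈ₚ xPowMinus1 n →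
    let open Mod (cyclotomic n) in ∀ {p} → (X ^ n ⊗ p) ≈/ p
  factorisation⇒X^n-fixed n e {p} = ≈/-trans (≈/-*-cong X^n≈1 (≈⇒≈/ (≈-refl {p}))) (≈⇒≈/ (⊗-identityˡ p))
    where
    open Mod (cyclotomic n)
    X^n≈1 : (X ^ n) ≈/ [ + 1 ]
    X^n≈1 = ≈/-trans (≈⇒≈/ (≈-sym (xPowMinus1⊕1 n))) (≈/-+-cong {q = []} {[ + 1 ]} (multiple⇒≈/0
      (≈-trans (≈-sym e) (⊗-comm (divisorProd n n) (cyclotomic n)))) (≈⇒≈/ ≈-refl))

  -- The fields travel together through one strong induction: `factorisation` at n uses
  -- `nonZeroDivisor` at smaller indices, and `nonZeroDivisor` at n uses `factorisation` at n and at
  -- its proper divisors.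
  record Cyclotomic (n : ℕ) : Set where
    open Mod (cyclotomic n)
    field
      monic : ∃ (Monic (cyclotomic n))
      factorisation : divisorProd n n ⊗ cyclotomic n ≈ₚ xPowMinus1 n
      nonZeroDivisor : ∀ {i p} → ¬ n ∣ i → (X ^ i ⊗ p) ≈/ p → p ≈/ []

    factorisation′ : divisorProd n (suc n) ≈ₚ xPowMinus1 n
    factorisation′ = ≈-trans (divisorProd-yes {n} {n} ∣.∣-refl) factorisation

    X^n-fixed : ∀ {p} → (X ^ n ⊗ p) ≈/ p
    X^n-fixed = factorisation⇒X^n-fixed n factorisation

    multiple-fixed : ∀ {k p} → n ∣ k → (X ^ k ⊗ p) ≈/ p
    multiple-fixed (divides q refl) = X^-fixed-multiple {n} X^n-fixed q

  module CyclotomicStep (n : ℕ) (0<n : 0 < n) (IH : ∀ {k} → k < n → 0 < k → Cyclotomic k) where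

    divisor>0 : ∀ {k} → k ∣ n → 0 < k
    divisor>0 k∣n = ℕₚ.n≢0⇒n>0 λ { refl → ℕₚ.<⇒≢ 0<n (sym (∣.0∣⇒≡0 k∣n)) }

    divisorProd-Monic : ∀ {k} → k ≤ n → ∃ (Monic (divisorProd n k))
    divisorProd-Monic {zero} _ = 0 , 1-Monic
    divisorProd-Monic {suc k} k<n with divisorProd-Monic (ℕₚ.<⇒≤ k<n) | k ∣? n
    ... | d , M | no k∤n = d , Leading-cong (≈-sym (divisorProd-no k∤n)) M
    ... | d , M | yes k∣n with Cyclotomic.monic (IH k<n (divisor>0 k∣n))
    ...   | e , N = d ℕ.+ e , Leading-cong (≈-sym (divisorProd-yes k∣n)) (⊗-Monic {divisorProd n k} M N)

    -- Φ_j divides x^j - 1, which is a non-zero-divisor modulo Φ_k for j < k.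
    divisorProd-nonZeroDivisor : ∀ {k} → k < n → 0 < k → ∀ {j} → j ≤ k → let open Mod (cyclotomic k) in
      ∀ {p} → (divisorProd n j ⊗ p) ≈/ [] → p ≈/ []
    divisorProd-nonZeroDivisor {k} k<n 0<k {zero} _ {p} e =
      ≈/-trans (≈⇒≈/ (≈-sym (⊗-identityˡ p))) e
      where open Mod (cyclotomic k)
    divisorProd-nonZeroDivisor {k} k<n 0<k {suc j} j<k {p} e with j ∣? n
    ... | no j∤n = divisorProd-nonZeroDivisor k<n 0<k (ℕₚ.<⇒≤ j<k)
                     (≈/-trans (≈⇒≈/ (⊗-cong (≈-sym (divisorProd-no j∤n)) ≈-refl)) e)
      where open Mod (cyclotomic k)
    ... | yes j∣n = Cyclotomic.nonZeroDivisor (IH k<n 0<k) {j} (λ k∣j → ℕₚ.<⇒≱ j<k (∣.∣⇒≤ {{ℕ.>-nonZero (divisor>0 j∣n)}} k∣j)) X^jp≈p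
      where
      open Mod (cyclotomic k)
      open PolySolver
      cyclotomic-p≈0 : (cyclotomic j ⊗ p) ≈/ []
      cyclotomic-p≈0 = divisorProd-nonZeroDivisor k<n 0<k (ℕₚ.<⇒≤ j<k)
        (≈/-trans (≈⇒≈/ (≈-trans (≈-sym (⊗-assoc (divisorProd n j) (cyclotomic j) p))
          (⊗-cong (≈-sym (divisorProd-yes j∣n)) ≈-refl))) e)
      xPowMinus1-p≈0 : (xPowMinus1 j ⊗ p) ≈/ []
      xPowMinus1-p≈0 = ≈/-trans (≈⇒≈/ (≈-trans
          (⊗-cong (≈-sym (Cyclotomic.factorisation (IH (ℕₚ.<-trans j<k k<n) (divisor>0 j∣n)))) ≈-refl)
          (⊗-assoc (divisorProd j j) (cyclotomic j) p)))
        (≈/-trans (≈/-*-congˡ (divisorProd j j) cyclotomic-p≈0) (≈⇒≈/ (⊗-zeroʳ (divisorProd j j))))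
      X^jp≈p : (X ^ j ⊗ p) ≈/ p
      X^jp≈p = ≈/-trans (≈⇒≈/ (≈-trans (⊗-cong (≈-sym (xPowMinus1⊕1 j)) ≈-refl)
          (≈-trans (⊗-distribʳ p (xPowMinus1 j) [ + 1 ]) (⊕-cong (≈-refl {xPowMinus1 j ⊗ p}) (⊗-identityˡ p)))))
        (≈/-+-cong {q = []} {p} xPowMinus1-p≈0 (≈⇒≈/ ≈-refl))

    -- When `k` divides n, Φ_k divides x^k - 1 and so x^n - 1, which is the product so far times the
    -- cofactor `w`. That product is a non-zero-divisor modulo Φ_k, hence Φ_k divides `w`.
    divisorProd-∣xPowMinus1 : ∀ {k} → k ≤ n → divisorProd n k ∣ₚ xPowMinus1 n
    divisorProd-∣xPowMinus1 {zero} _ = xPowMinus1 n , ≈-sym (⊗-identityˡ _)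
    divisorProd-∣xPowMinus1 {suc k} k<n with divisorProd-∣xPowMinus1 (ℕₚ.<⇒≤ k<n) | k ∣? n
    ... | w , e | no k∤n = w , ≈-trans e (⊗-cong (≈-sym (divisorProd-no k∤n)) ≈-refl)
    ... | w , e | yes k∣n = w′ , (begin
      xPowMinus1 n                                 ≈⟨ e ⟩
      divisorProd n k ⊗ w                          ≈⟨ ⊗-congˡ (divisorProd n k) w≈ ⟩
      divisorProd n k ⊗ (cyclotomic k ⊗ w′)        ≈⟨ ⊗-assoc (divisorProd n k) (cyclotomic k) w′ ⟨
      (divisorProd n k ⊗ cyclotomic k) ⊗ w′        ≈⟨ ⊗-cong (divisorProd-yes k∣n) ≈-refl ⟨
      divisorProd n (suc k) ⊗ w′                   ∎)
      where
      open P-Reasoning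
      open Mod (cyclotomic k)
      Φk = IH k<n (divisor>0 k∣n)
      xPowMinus1≈0 : xPowMinus1 n ≈/ []
      xPowMinus1≈0 = ≈/-trans (≈⇒≈/ (⊕-cong (≈-trans (monomial≈X^ n)
          (≈-trans (≈-sym (⊗-identityˡ (X ^ n))) (⊗-comm [ + 1 ] (X ^ n)))) (≈-refl {[ ℤ.- (+ 1) ]})))
        (≈/-trans (≈/-+-cong (Cyclotomic.multiple-fixed Φk k∣n) (≈⇒≈/ (≈-refl {[ ℤ.- (+ 1) ]})))
          (≈⇒≈/ 0∷[]≈[]))
      w-multiple = ≈/0⇒multiple (divisorProd-nonZeroDivisor k<n (divisor>0 k∣n) ℕₚ.≤-refl
                     (≈/-trans (≈⇒≈/ (≈-sym e)) xPowMinus1≈0))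
      w′ = proj₁ w-multiple
      w≈ : w ≈ₚ cyclotomic k ⊗ w′
      w≈ = proj₂ w-multiple

    factorisation : divisorProd n n ⊗ cyclotomic n ≈ₚ xPowMinus1 n
    factorisation with divisorProd-∣xPowMinus1 {n} ℕₚ.≤-refl | divisorProd-Monic {n} ℕₚ.≤-refl
    ... | w , e | d , M = ≈-trans (⊗-congˡ (divisorProd n n)
      (≈-trans (≈-reflexive (cyclotomic≡quotP n 0<n)) (proj₁ (exact-division M e)))) (≈-sym e)

    xPowMinus1-Monic′ : ∀ {m} → 0 < m → Monic (xPowMinus1 m) m
    xPowMinus1-Monic′ {suc m} _ = xPowMinus1-Monic m

    monic : ∃ (Monic (cyclotomic n))
    monic = cofactor-Monic (proj₂ (divisorProd-Monic {n} ℕₚ.≤-refl)) (xPowMinus1-Monic′ 0<n) (≈-sym factorisation)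

    open Mod (cyclotomic n)

    -- 1 + x^g + ... + x^(g(q-1)) = (x^n - 1)/(x^g - 1) is a multiple of Φ_n.
    geom≈0 : ∀ {g q} → g < n → n ≡ q ℕ.* g → QSeries.geom polyRing (X ^ g) q ≈/ []
    geom≈0 {g} {q} g<n n≡qg = multiple⇒≈/0 {q = z}
      (⊗-cancelˡ (xPowMinus1-Monic′ 0<g) (begin
        xPowMinus1 g ⊗ G                                 ≈⟨ ⊕-cancelʳ (G ⊕ [ + 1 ]) _ _ telescope ⟩
        xPowMinus1 n                                     ≈⟨ factorisation ⟨
        divisorProd n n ⊗ cyclotomic n                   ≈⟨ ⊗-cong z≈ ≈-refl ⟩
        (xPowMinus1 g ⊗ z) ⊗ cyclotomic n                ≈⟨ solve 3 (λ u v w → (u :* v) :* w := u :* (w :* v)) ≈-refl (xPowMinus1 g) z (cyclotomic n) ⟩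
        xPowMinus1 g ⊗ (cyclotomic n ⊗ z)                ∎))
      where
      open P-Reasoning
      open PolySolver
      G = QSeries.geom polyRing (X ^ g) q
      g∣n : g ∣ n
      g∣n = divides q n≡qg
      0<g : 0 < g
      0<g = divisor>0 g∣n
      -- Every Φ_j with j dividing g also occurs among the proper divisors of n, so x^g - 1 divides
      -- the product over these. The cofactor is `z`.
      Z₁ = divisorProd-∣ g∣n (suc g)
      Z₂ = divisorProd-≤ n g<n
      z = proj₁ Z₁ ⊗ proj₁ Z₂
      z≈ : divisorProd n n ≈ₚ xPowMinus1 g ⊗ z
      z≈ = begin
        divisorProd n n                                        ≈⟨ proj₂ Z₂ ⟩
        divisorProd n (suc g) ⊗ proj₁ Z₂                       ≈⟨ ⊗-cong (proj₂ Z₁) ≈-refl ⟩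
        (divisorProd g (suc g) ⊗ proj₁ Z₁) ⊗ proj₁ Z₂          ≈⟨ ⊗-assoc (divisorProd g (suc g)) (proj₁ Z₁) (proj₁ Z₂) ⟩
        divisorProd g (suc g) ⊗ z                              ≈⟨ ⊗-cong (Cyclotomic.factorisation′ (IH g<n 0<g)) ≈-refl ⟩
        xPowMinus1 g ⊗ z                                       ∎
      telescope : xPowMinus1 g ⊗ G ⊕ (G ⊕ [ + 1 ]) ≈ₚ xPowMinus1 n ⊕ (G ⊕ [ + 1 ])
      telescope = begin
        xPowMinus1 g ⊗ G ⊕ (G ⊕ [ + 1 ])           ≈⟨ solve 2 (λ u G → u :* G :+ (G :+ con 1) := con 1 :+ (u :+ con 1) :* G) ≈-refl (xPowMinus1 g) G ⟩
        [ + 1 ] ⊕ (xPowMinus1 g ⊕ [ + 1 ]) ⊗ G     ≈⟨ ⊕-cong (≈-refl {[ + 1 ]}) (⊗-cong (xPowMinus1⊕1 g) (≈-refl {G})) ⟩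
        [ + 1 ] ⊕ X ^ g ⊗ G                        ≈⟨ QSeries.geom-telescope polyRing (X ^ g) q ⟨
        (X ^ g) ^ q ⊕ G                            ≈⟨ ⊕-cong (≈-trans (^-assocʳ X g q) (≈-reflexive (cong (X ^_) (trans (ℕₚ.*-comm g q) (sym n≡qg))))) (≈-refl {G}) ⟩
        X ^ n ⊕ G                                  ≈⟨ ⊕-cong (xPowMinus1⊕1 n) (≈-refl {G}) ⟨
        (xPowMinus1 n ⊕ [ + 1 ]) ⊕ G               ≈⟨ solve 2 (λ u G → (u :+ con 1) :+ G := u :+ (G :+ con 1)) ≈-refl (xPowMinus1 n) G ⟩
        xPowMinus1 n ⊕ (G ⊕ [ + 1 ])               ∎

    -- Exponents whose power of x fixes `p` are closed under multiples and differences, and n is one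
    -- of them. Bézout's identity over ℕ comes with either sign, hence two cases.
    gcd-fixed : ∀ {i p} → (X ^ i ⊗ p) ≈/ p → (X ^ gcd i n ⊗ p) ≈/ p
    gcd-fixed {i} {p} e = go (Bézout.identity (gcd-GCD i n))
      where
      X^n-fixed : (X ^ n ⊗ p) ≈/ p
      X^n-fixed = factorisation⇒X^n-fixed n factorisation
      difference : ∀ {a b c} → a ℕ.+ b ≡ c → (X ^ b ⊗ p) ≈/ p → (X ^ c ⊗ p) ≈/ p → (X ^ a ⊗ p) ≈/ p
      difference {a} {b} refl f h = ≈/-trans (≈/-*-congˡ (X ^ a) (≈/-sym f))
        (≈/-trans (≈⇒≈/ (≈-trans (≈-sym (⊗-assoc (X ^ a) (X ^ b) p)) (⊗-cong (≈-sym (^-homo-* X a b)) ≈-refl))) h)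
      go : Bézout.Identity (gcd i n) i n → (X ^ gcd i n ⊗ p) ≈/ p
      go (Bézout.+- x y eq) = difference {gcd i n} {y ℕ.* n} {x ℕ.* i} eq (X^-fixed-multiple {n} X^n-fixed y) (X^-fixed-multiple {i} e x)
      go (Bézout.-+ x y eq) = difference {gcd i n} {x ℕ.* i} {y ℕ.* n} eq (X^-fixed-multiple {i} e x) (X^-fixed-multiple {n} X^n-fixed y)

    -- With g = gcd(i, n), a proper divisor of n, `p` is fixed by x^g, so the geometric sum with n /
    -- g terms in x^g acts on `p` as the integer n / g. That sum vanishes modulo Φ_n, and
    -- torsion-freeness gives the claim.
    nonZeroDivisor : ∀ {i p} → ¬ n ∣ i → (X ^ i ⊗ p) ≈/ p → p ≈/ []
    nonZeroDivisor {i} {p} n∤i e with gcd[m,n]∣n i n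
    ... | divides q n≡qg = multiple⇒≈/0 (proj₂ (scale-torsionFree (proj₂ monic) {+ q} p (proj₁ qp) q≢0 (proj₂ qp)))
      where
      g = gcd i n
      g<n : g < n
      g<n = ℕₚ.≤∧≢⇒< (∣.∣⇒≤ {{ℕ.>-nonZero 0<n}} (gcd[m,n]∣n i n))
              (λ g≡n → n∤i (subst (_∣ i) g≡n (gcd[m,n]∣m i n)))
      q≢0 : + q ≢ + 0
      q≢0 refl = ℕₚ.<⇒≢ 0<n (sym n≡qg)
      q×p≈0 : (q ×ₚ p) ≈/ []
      q×p≈0 = ≈/-trans (≈/-sym (subst (λ z → z) (cong₂ (λ u v → (u ⊗ p) ≈/ v) (Series.geom/≡geom (X ^ g) q) (×/≡× p q))
          (QSeries.geom-fixed quotient (X ^ g) (gcd-fixed {i} e) q)))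
        (≈/-*-cong (geom≈0 {g} {q} g<n n≡qg) (≈⇒≈/ (≈-refl {p})))
      qp : ∃ λ r → scale (+ q) p ≈ₚ cyclotomic n ⊗ r
      qp = ≈/0⇒multiple (≈/-trans (≈⇒≈/ (≈-sym (×ₚ≈scale q p))) q×p≈0)

  cyclotomic-properties : ∀ n → 0 < n → Cyclotomic n
  cyclotomic-properties = <-rec (λ n → 0 < n → Cyclotomic n) λ n IH 0<n →
    let open CyclotomicStep n 0<n IH in
    record { monic = monic ; factorisation = factorisation ; nonZeroDivisor = nonZeroDivisor }

-- The q-Catalan polynomial and its values at roots of unity.

module CatalanValues where
  open QAnalogues
  open Polynomials
  open CyclotomicPolynomials

  open _≈ₚ_
  open import Algebra.Properties.Semiring.Exp PolyRing.semiring using (_^_; ^-assocʳ)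

  private module P = QSeries polyRing X

  qInt≈geom : ∀ k → qInt k ≈ₚ P.geom k
  qInt≈geom zero = ≈-refl
  qInt≈geom (suc k) = ≈-trans (∷≈⊕X (+ 1) (qInt k)) (⊕-cong (≈-refl {[ + 1 ]}) (⊗-congˡ X (qInt≈geom k)))

  qFact≈qfact : ∀ k → qFact k ≈ₚ P.qfact k
  qFact≈qfact zero = ≈-refl
  qFact≈qfact (suc k) = ⊗-cong (qFact≈qfact k) (qInt≈geom (suc k))

  qInt-Monic : ∀ k → Monic (qInt (suc k)) k
  qInt-Monic zero = 1-Monic
  qInt-Monic (suc k) with qInt-Monic k
  ... | leading l u = leading l λ { (suc i) (s<s h) → u i h }

  qFact-Monic : ∀ k → ∃ (Monic (qFact k))
  qFact-Monic zero = 0 , 1-Monic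
  qFact-Monic (suc k) with qFact-Monic k
  ... | d , M = d ℕ.+ k , ⊗-Monic {qFact k} M (qInt-Monic k)

  qfact-Monic : ∀ k → ∃ (Monic (P.qfact k))
  qfact-Monic k = _ , Leading-cong (qFact≈qfact k) (proj₂ (qFact-Monic k))

  module _ (k : ℕ) where
    private
      n = suc k
      2n = 2 ℕ.* n
      G G′ : Poly
      G = P.gauss 2n n
      G′ = P.gauss 2n (suc n)

      2n≡n+n : 2n ≡ n ℕ.+ n
      2n≡n+n = cong (n ℕ.+_) (ℕₚ.+-identityʳ n)

      2n≡1+n+k : 2n ≡ suc n ℕ.+ k
      2n≡1+n+k = trans 2n≡n+n (ℕₚ.+-suc n k)

      gauss-qfact-at : ∀ {N} a b → N ≡ a ℕ.+ b → P.gauss N a ⊗ (P.qfact a ⊗ P.qfact b) ≈ₚ P.qfact N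
      gauss-qfact-at a b refl = P.gauss-qfact a b

    qBinom≈gauss : qBinom 2n n ≈ₚ G
    qBinom≈gauss = proj₁ (exact-division
      (⊗-Monic {qFact (2n ∸ n)} {qFact n} (proj₂ (qFact-Monic (2n ∸ n))) (proj₂ (qFact-Monic n))) (begin
        qFact 2n                                  ≈⟨ qFact≈qfact 2n ⟩
        P.qfact 2n                                ≈⟨ gauss-qfact-at n n 2n≡n+n ⟨
        G ⊗ (P.qfact n ⊗ P.qfact n)               ≈⟨ ⊗-comm G _ ⟩
        (P.qfact n ⊗ P.qfact n) ⊗ G               ≈⟨ ⊗-cong (⊗-cong (≈-trans (≈-reflexive (cong qFact 2n∸n≡n)) (qFact≈qfact n)) (qFact≈qfact n)) ≈-refl ⟨
        (qFact (2n ∸ n) ⊗ qFact n) ⊗ G            ∎))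
      where
      open P-Reasoning
      2n∸n≡n : 2n ∸ n ≡ n
      2n∸n≡n = trans (cong (_∸ n) 2n≡n+n) (ℕₚ.m+n∸n≡m n n)

    -- After multiplication by the q-factorials of n and n - 1, both sides become the q-factorial of
    -- 2n. The multiplier is monic and can be cancelled.
    geom-gauss : P.geom (suc n) ⊗ G′ ≈ₚ P.geom n ⊗ G
    geom-gauss = ⊗-cancelˡ (⊗-Monic {P.qfact n} (proj₂ (qfact-Monic n)) (proj₂ (qfact-Monic k))) (begin
      (P.qfact n ⊗ P.qfact k) ⊗ (P.geom (suc n) ⊗ G′)
        ≈⟨ solve 4 (λ f h g G → (f :* h) :* (g :* G) := G :* ((f :* g) :* h)) ≈-refl (P.qfact n) (P.qfact k) (P.geom (suc n)) G′ ⟩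
      G′ ⊗ (P.qfact (suc n) ⊗ P.qfact k)    ≈⟨ gauss-qfact-at (suc n) k 2n≡1+n+k ⟩
      P.qfact 2n                            ≈⟨ gauss-qfact-at n n 2n≡n+n ⟨
      G ⊗ (P.qfact n ⊗ (P.qfact k ⊗ P.geom n))
        ≈⟨ solve 4 (λ f h g G → G :* (f :* (h :* g)) := (f :* h) :* (g :* G)) ≈-refl (P.qfact n) (P.qfact k) (P.geom n) G ⟩
      (P.qfact n ⊗ P.qfact k) ⊗ (P.geom n ⊗ G)    ∎)
      where
      open P-Reasoning
      open PolySolver

    -- Since `[n+1]` = 1 + x`[n]` and `[n+1]`G′ = `[n]`G, the product of `[n+1]` with G - xG′ is G.
    -- The defining division is therefore exact with this quotient.
    qCatalan≈ : qCatalan n ≈ₚ G ⊕ negP (X ⊗ G′)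
    qCatalan≈ = proj₁ (exact-division (qInt-Monic n) (≈-trans qBinom≈gauss
      (⊕-cancelʳ (g ⊗ (X ⊗ G′)) _ _ (begin
        G ⊕ g ⊗ (X ⊗ G′)                                    ≈⟨ ⊕-cong (≈-refl {G}) (⊗-cong (qInt≈geom (suc n)) (≈-refl {X ⊗ G′})) ⟩
        G ⊕ P.geom (suc n) ⊗ (X ⊗ G′)                       ≈⟨ ⊕-cong (≈-refl {G}) (solve 3 (λ g x G → g :* (x :* G) := x :* (g :* G)) ≈-refl (P.geom (suc n)) X G′) ⟩
        G ⊕ X ⊗ (P.geom (suc n) ⊗ G′)                       ≈⟨ ⊕-cong (≈-refl {G}) (⊗-congˡ X geom-gauss) ⟩
        G ⊕ X ⊗ (P.geom n ⊗ G)                              ≈⟨ solve 3 (λ g x G → G :+ x :* (g :* G) := (con 1 :+ x :* g) :* G) ≈-refl (P.geom n) X G ⟩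
        P.geom (suc n) ⊗ G                                  ≈⟨ ⊗-cong (qInt≈geom (suc n)) (≈-refl {G}) ⟨
        g ⊗ G                                               ≈⟨ ⊗-congˡ g G≈ ⟩
        g ⊗ ((G ⊕ negP (X ⊗ G′)) ⊕ X ⊗ G′)                  ≈⟨ ⊗-distribˡ g (G ⊕ negP (X ⊗ G′)) (X ⊗ G′) ⟩
        g ⊗ (G ⊕ negP (X ⊗ G′)) ⊕ g ⊗ (X ⊗ G′)              ∎))))
      where
      open P-Reasoning
      open PolySolver
      g = qInt (suc n)
      G≈ : G ≈ₚ (G ⊕ negP (X ⊗ G′)) ⊕ X ⊗ G′
      G≈ = ≈-sym (≈-trans (⊕-assoc G (negP (X ⊗ G′)) (X ⊗ G′))
             (≈-trans (⊕-cong (≈-refl {G}) (⊕-inverseˡ (X ⊗ G′))) (⊕-identityʳ G)))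

    qCatalan⊕ : qCatalan n ⊕ X ⊗ G′ ≈ₚ G
    qCatalan⊕ = ≈-trans (⊕-cong qCatalan≈ (≈-refl {X ⊗ G′}))
      (≈-trans (⊕-assoc G (negP (X ⊗ G′)) (X ⊗ G′))
        (≈-trans (⊕-cong (≈-refl {G}) (⊕-inverseˡ (X ⊗ G′))) (⊕-identityʳ G)))

  module _ (y : Poly) where

    eval : Poly → Poly
    eval [] = []
    eval (a ∷ p) = [ a ] ⊕ y ⊗ eval p

    eval-cong[] : ∀ p → p ≈ₚ [] → eval p ≈ₚ []
    eval-cong[] [] _ = ≈-refl
    eval-cong[] (a ∷ p) e = ≈-trans (⊕-cong {q = y ⊗ eval p} {q′ = []} (≈-trans (∷-cong (at e 0) ≈-refl) 0∷[]≈[])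
      (≈-trans (⊗-congˡ y (eval-cong[] p (mk≈ λ i → at e (suc i)))) (⊗-zeroʳ y))) ≈-refl

    eval-cong : ∀ {p q} → p ≈ₚ q → eval p ≈ₚ eval q
    eval-cong {[]} {q} e = ≈-sym (eval-cong[] q (≈-sym e))
    eval-cong {a ∷ p} {[]} e = eval-cong[] (a ∷ p) e
    eval-cong {a ∷ p} {b ∷ q} e = ⊕-cong (∷-cong (at e 0) ≈-refl) (⊗-congˡ y (eval-cong {p} {q} (mk≈ λ i → at e (suc i))))

    eval-⊕ : ∀ p q → eval (p ⊕ q) ≈ₚ eval p ⊕ eval q
    eval-⊕ [] q = ≈-refl
    eval-⊕ (a ∷ p) [] = ≈-sym (⊕-identityʳ _)
    eval-⊕ (a ∷ p) (b ∷ q) = ≈-trans (⊕-cong (≈-refl {[ a ℤ.+ b ]}) (≈-trans (⊗-congˡ y (eval-⊕ p q)) (⊗-distribˡ y (eval p) (eval q))))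
      (⊕-interchange [ a ] [ b ] (y ⊗ eval p) (y ⊗ eval q))

    eval-scale : ∀ c p → eval (scale c p) ≈ₚ scale c (eval p)
    eval-scale c [] = ≈-refl
    eval-scale c (a ∷ p) = ≈-trans (⊕-cong (≈-refl {[ c ℤ.* a ]}) (≈-trans (⊗-congˡ y (eval-scale c p))
        (≈-trans (⊗-comm y _) (≈-trans (scale-⊗ c (eval p) y) (scale-cong c (⊗-comm (eval p) y))))))
      (≈-sym (scale-⊕ c [ a ] (y ⊗ eval p)))

    eval-⊗ : ∀ p q → eval (p ⊗ q) ≈ₚ eval p ⊗ eval q
    eval-⊗ [] q = ≈-refl
    eval-⊗ (a ∷ p) q = begin
      eval (scale a q ⊕ (+ 0 ∷ p ⊗ q))
        ≈⟨ eval-⊕ (scale a q) (+ 0 ∷ p ⊗ q) ⟩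
      eval (scale a q) ⊕ ([ + 0 ] ⊕ y ⊗ eval (p ⊗ q))
        ≈⟨ ⊕-cong (eval-scale a q) (⊕-cong 0∷[]≈[] (⊗-congˡ y (eval-⊗ p q))) ⟩
      scale a (eval q) ⊕ y ⊗ (eval p ⊗ eval q)
        ≈⟨ ⊕-cong (≈-trans (⊕-cong (≈-refl {scale a (eval q)}) 0∷[]≈[]) (⊕-identityʳ _)) (⊗-assoc y (eval p) (eval q)) ⟨
      [ a ] ⊗ eval q ⊕ (y ⊗ eval p) ⊗ eval q
        ≈⟨ ⊗-distribʳ (eval q) [ a ] (y ⊗ eval p) ⟨
      ([ a ] ⊕ y ⊗ eval p) ⊗ eval q ∎
      where open P-Reasoning

    eval-1 : eval [ + 1 ] ≈ₚ [ + 1 ]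
    eval-1 = ≈-trans (⊕-cong (≈-refl {[ + 1 ]}) (⊗-zeroʳ y)) (⊕-identityʳ [ + 1 ])

    eval-X : eval X ≈ₚ y
    eval-X = ≈-trans (⊕-cong 0∷[]≈[] (⊗-congˡ y eval-1)) (≈-trans (⊗-comm y [ + 1 ]) (⊗-identityˡ y))

    eval-^ : ∀ k → eval (X ^ k) ≈ₚ y ^ k
    eval-^ zero = eval-1
    eval-^ (suc k) = ≈-trans (eval-⊗ X (X ^ k)) (⊗-cong eval-X (eval-^ k))

    eval-gauss : ∀ a b → eval (P.gauss a b) ≈ₚ QSeries.gauss polyRing y a b
    eval-gauss a zero = eval-1
    eval-gauss zero (suc b) = ≈-refl
    eval-gauss (suc a) (suc b) = ≈-trans (eval-⊕ (P.gauss a b) (X ^ suc b ⊗ P.gauss a (suc b)))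
      (⊕-cong (eval-gauss a b) (≈-trans (eval-⊗ (X ^ suc b) (P.gauss a (suc b)))
        (⊗-cong (eval-^ (suc b)) (eval-gauss a (suc b)))))

  replicate++ : ∀ e p → replicate e (+ 0) ++ p ≈ₚ X ^ e ⊗ p
  replicate++ zero p = ≈-sym (⊗-identityˡ p)
  replicate++ (suc e) p = ≈-trans (∷-cong refl (replicate++ e p)) (≈-trans (≈-sym (X⊗ (X ^ e ⊗ p))) (≈-sym (⊗-assoc X (X ^ e) p)))

  substPow≈eval : ∀ e p → substPow e p ≈ₚ eval (X ^ e) p
  substPow≈eval zero [] = 0∷[]≈[]
  substPow≈eval zero (a ∷ p) = ⊕-cong (≈-refl {[ a ]}) (≈-trans (substPow≈eval zero p) (≈-sym (⊗-identityˡ _)))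
  substPow≈eval (suc e) [] = ≈-refl
  substPow≈eval (suc e) (a ∷ p) = ≈-trans (∷-cong refl (≈-trans (replicate++ e _) (⊗-congˡ (X ^ e) (substPow≈eval (suc e) p))))
    (≈-trans (∷≈⊕X a _) (⊕-cong (≈-refl {[ a ]}) (≈-sym (⊗-assoc X (X ^ e) _))))

  module RootOfUnity (m : ℕ) (0<m : 0 < m) (e : ℕ) (d : ℕ) (m≡ : m ≡ suc d ℕ.* gcd e m) where
    private
      c D : ℕ
      c = gcd e m
      D = suc d
      Φ : Poly
      Φ = cyclotomic m
      y : Poly
      y = X ^ e
    open Cyclotomic (cyclotomic-properties m 0<m)
    open Mod Φ
    private module M = QSeries quotient y
    open import Algebra.Properties.Semiring.Exp Q.semiring using () renaming (_^_ to _^/_)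
    open import Algebra.Properties.Semiring.Mult Q.semiring using () renaming (_×_ to _×/_)

    y^i≡ : ∀ i → y ^/ i ≡ y ^ i
    y^i≡ = ^/≡^ y

    y^D≈1 : (y ^/ D) ≈/ [ + 1 ]
    y^D≈1 = ≈/-trans (≈⇒≈/ (≈-trans (≈-reflexive (y^i≡ D)) (≈-trans (^-assocʳ X e D)
        (≈-trans (≈-sym (⊗-identityˡ _)) (⊗-comm [ + 1 ] (X ^ (e ℕ.* D)))))))
      (multiple-fixed {e ℕ.* D} m∣eD)
      where
      m∣eD : m ∣ e ℕ.* D
      m∣eD with gcd[m,n]∣m e m
      ... | divides q e≡qc = divides q (begin
        e ℕ.* D            ≡⟨ cong (ℕ._* D) e≡qc ⟩
        q ℕ.* c ℕ.* D      ≡⟨ ℕₚ.*-assoc q c D ⟩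
        q ℕ.* (c ℕ.* D)    ≡⟨ cong (q ℕ.*_) (trans (ℕₚ.*-comm c D) (sym m≡)) ⟩
        q ℕ.* m            ∎)
        where open ≡-Reasoning

    -- If m divided e i, it would divide gcd(i e, i m) = i c. Cancelling `c` from m = D c would give
    -- that `D` divides `i`, impossible for 0 < i < D.
    y^i-nonZeroDivisor : ∀ {i p} → 0 < i → i < D → ((y ^/ i) ⊗ p) ≈/ p → p ≈/ []
    y^i-nonZeroDivisor {i} {p} 0<i i<D h = nonZeroDivisor {e ℕ.* i} m∤ei
        (≈/-trans (≈⇒≈/ (⊗-cong (≈-trans (≈-sym (^-assocʳ X e i)) (≈-reflexive (sym (y^i≡ i)))) (≈-refl {p}))) h)
      where
      c≢0 : c ≢ 0
      c≢0 c≡0 = ℕₚ.<⇒≢ 0<m (sym (trans m≡ (trans (cong (D ℕ.*_) c≡0) (ℕₚ.*-zeroʳ D))))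
      m∤ei : ¬ m ∣ e ℕ.* i
      m∤ei m∣ei = ℕₚ.<⇒≱ i<D (∣.∣⇒≤ {{ℕ.>-nonZero 0<i}} (∣.*-cancelʳ-∣ c {{ℕ.≢-nonZero c≢0}}
        (subst (_∣ i ℕ.* c) m≡ (subst (m ∣_) (sym (c*gcd[m,n]≡gcd[cm,cn] i e m))
          (gcd-greatest (subst (m ∣_) (ℕₚ.*-comm e i) m∣ei) (∣.n∣m*n i))))))

    open M.Lucas d y^D≈1 y^i-nonZeroDivisor public

    catalanValue : ∀ k → CatalanValue (suc k) (eval y (qCatalan (suc k)))
    catalanValue k = ≈⇒≈/ (begin
      eval y (qCatalan n) ⊕ y ⊗ M.gauss 2n (suc n)               ≈⟨ ⊕-cong (≈-refl {eval y (qCatalan n)}) (⊗-cong (eval-X y) (≈-trans (eval-gauss y 2n (suc n)) (≈-reflexive (sym (Series.gauss/≡gauss y 2n (suc n)))))) ⟨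
      eval y (qCatalan n) ⊕ eval y X ⊗ eval y (P.gauss 2n (suc n))  ≈⟨ ⊕-cong (≈-refl {eval y (qCatalan n)}) (eval-⊗ y X (P.gauss 2n (suc n))) ⟨
      eval y (qCatalan n) ⊕ eval y (X ⊗ P.gauss 2n (suc n))      ≈⟨ eval-⊕ y (qCatalan n) _ ⟨
      eval y (qCatalan n ⊕ X ⊗ P.gauss 2n (suc n))               ≈⟨ eval-cong y (qCatalan⊕ k) ⟩
      eval y (P.gauss 2n n)                                      ≈⟨ eval-gauss y 2n n ⟩
      QSeries.gauss polyRing y 2n n                              ≈⟨ ≈-reflexive (Series.gauss/≡gauss y 2n n) ⟨
      M.gauss 2n n                                               ∎)
      where
      open P-Reasoning
      n = suc k
      2n = 2 ℕ.* n

    ≈/⇒IsZeroP : ∀ P N → eval y P ≈/ (N ×/ [ + 1 ]) → IsZeroP (remP (substPow e P ⊕ negP [ + N ]) Φ)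
    ≈/⇒IsZeroP P N h = ≈[]⇒IsZeroP (proj₂ (exact-division (proj₂ monic) (proj₂ (≈/0⇒multiple
      (≈/-trans (≈/-+-cong (≈/-trans (≈⇒≈/ (substPow≈eval e P)) (≈/-trans h (≈⇒≈/ N×1≈))) (≈⇒≈/ (≈-refl {negP [ + N ]})))
        (≈⇒≈/ (≈-trans (⊕-comm [ + N ] (negP [ + N ])) (⊕-inverseˡ [ + N ]))))))))
      where
      N×1≈ : N ×/ [ + 1 ] ≈ₚ [ + N ]
      N×1≈ = ≈-trans (≈-reflexive (×/≡× [ + 1 ] N)) (≈-trans (×ₚ≈scale N [ + 1 ]) (∷-cong (ℤₚ.*-identityʳ (+ N)) ≈-refl))

  -- `suc d` is the order of the rotation. In the first case `N` is pinned down by an equation,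
  -- because a difference of binomials would involve truncated subtraction.
  qCatalan-value : ∀ r k d N → let m = suc r ; c = gcd (k %ℕ m) m in m ≡ suc d ℕ.* c →
    (d ≡ 0 → N ℕ.+ (2 ℕ.* suc m) C suc (suc m) ≡ (2 ℕ.* suc m) C suc m) →
    (d ≡ 1 → N ≡ suc (2 ℕ.* c) C suc c) →
    (2 ≤ d → N ≡ (2 ℕ.* c) C c) →
    EvalAtRootOfUnity≡ (qCatalan (suc m)) m k (+ N)
  qCatalan-value r k d N m≡ case₁ case₂ case₃ = ≈/⇒IsZeroP (qCatalan (suc m)) N (value d refl)
    where
    m = suc r
    c = gcd (k %ℕ m) m
    open RootOfUnity m z<s (k %ℕ m) d m≡
    open Mod (cyclotomic m)
    open import Algebra.Properties.Semiring.Mult Q.semiring using () renaming (_×_ to _×/_)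
    z = eval (X ^ (k %ℕ m)) (qCatalan (suc m))
    catalanValue′ : CatalanValue (suc (c ℕ.* suc d)) z
    catalanValue′ = subst (λ j → CatalanValue (suc j) z) (trans m≡ (ℕₚ.*-comm (suc d) c)) (catalanValue m)
    value : ∀ d′ → d′ ≡ d → z ≈/ (N ×/ [ + 1 ])
    value zero refl = catalanValue₁ refl (suc m) (case₁ refl) (catalanValue m)
    value (suc zero) refl = subst (λ j → z ≈/ (j ×/ [ + 1 ])) (sym (case₂ refl)) (catalanValue₂ refl c catalanValue′)
    value (suc (suc d′)) refl = subst (λ j → z ≈/ (j ×/ [ + 1 ])) (sym (case₃ (s≤s (s≤s z≤n))))
      (catalanValue₃ (s≤s (s≤s (s≤s z≤n))) c catalanValue′)

-- Heights and parenthesis matching in periodic words.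

module PeriodicMatching where
  import Algebra.Properties.AbelianGroup ℤₚ.+-0-abelianGroup as ℤ+

  data Letter : Set where
    none single opening closing : Letter

  next : Letter → ℤ → ℤ
  next none h = h
  next single h = h
  next opening h = ℤ.suc h
  next closing h = ℤ.pred h

  -- The height before letter i, so that `w i` is the step from i to `suc i`. Values are integers
  -- because a periodic word may drift downwards.
  ht : (ℕ → Letter) → ℕ → ℤ
  ht w zero = ℤ.+ 0
  ht w (suc i) = next (w i) (ht w i)

  i<suc[i] : ∀ i → i ℤ.< ℤ.suc i
  i<suc[i] i = ℤₚ.suc[i]≤j⇒i<j ℤₚ.≤-refl

  pred[i]<i : ∀ i → ℤ.pred i ℤ.< i
  pred[i]<i i = ℤₚ.i≤pred[j]⇒i<j ℤₚ.≤-refl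

  next-+ : ∀ x h b → next x (h ℤ.+ b) ≡ next x h ℤ.+ b
  next-+ none h b = refl
  next-+ single h b = refl
  next-+ opening h b = sym (ℤₚ.+-assoc (ℤ.+ 1) h b)
  next-+ closing h b = sym (ℤₚ.+-assoc (ℤ.- (ℤ.+ 1)) h b)

  -- What a point sees on a circle: the forward distance to its partner, if any.
  data Offset : Set where
    free point : Offset
    reach : ℕ → Offset

  reach-injective : ∀ {s t} → reach s ≡ reach t → s ≡ t
  reach-injective refl = refl

  -- A noncrossing (1,2)-configuration on ℤ/m, as an m-periodic function.
  record Circular (m : ℕ) (f : ℕ → Offset) : Set where
    field
      periodic : ∀ i → f (i + m) ≡ f i
      partner : ∀ {i δ} → f i ≡ reach δ →
        ∃ λ δ′ → 0 < δ × 0 < δ′ × δ + δ′ ≡ m × f (i + δ) ≡ reach δ′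
      noncrossing : ∀ {i j δ ε} → f i ≡ reach δ → f j ≡ reach ε →
        i < j → j < i + δ → i + δ < j + ε → j + ε < i + m → ⊥

  module _ (w : ℕ → Letter) where

    -- The first-return description of matching parentheses, in terms of heights alone. That `i`
    -- carries an opening and `j` a closing letter are consequences.
    record Match (i j : ℕ) : Set where
      constructor match
      field
        lt     : i < j
        closes : ht w (suc j) ≡ ht w i
        above  : ∀ k → i < k → k ≤ j → ht w i ℤ.< ht w k
    open Match

    rising⇒opening : ∀ {i} → ht w i ℤ.< ht w (suc i) → w i ≡ opening
    rising⇒opening {i} h with w i
    ... | none = ⊥-elim (ℤₚ.<-irrefl refl h)
    ... | single = ⊥-elim (ℤₚ.<-irrefl refl h)
    ... | opening = refl
    ... | closing = ⊥-elim (ℤₚ.<-asym h (pred[i]<i _))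

    falling⇒closing : ∀ {i} → ht w (suc i) ℤ.< ht w i → w i ≡ closing
    falling⇒closing {i} h with w i
    ... | none = ⊥-elim (ℤₚ.<-irrefl refl h)
    ... | single = ⊥-elim (ℤₚ.<-irrefl refl h)
    ... | opening = ⊥-elim (ℤₚ.<-asym h (i<suc[i] _))
    ... | closing = refl

    opening⇒rising : ∀ {i} → w i ≡ opening → ht w (suc i) ≡ ℤ.suc (ht w i)
    opening⇒rising e rewrite e = refl

    closing⇒falling : ∀ {i} → w i ≡ closing → ht w (suc i) ≡ ℤ.pred (ht w i)
    closing⇒falling e rewrite e = refl

    match-opening : ∀ {i j} → Match i j → w i ≡ opening
    match-opening M = rising⇒opening (above M _ (ℕₚ.n<1+n _) (lt M))

    match-closing : ∀ {i j} → Match i j → w j ≡ closing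
    match-closing {i} {j} M = falling⇒closing (subst (ℤ._< ht w j) (sym (closes M)) (above M j (lt M) ℕₚ.≤-refl))

    match-functional : ∀ {i j j′} → Match i j → Match i j′ → j ≡ j′
    match-functional {i} {j} {j′} M N with ℕₚ.<-cmp j j′
    ... | tri≈ _ e _ = e
    ... | tri< j<j′ _ _ = ⊥-elim (ℤₚ.<-irrefl (sym (closes M)) (above N (suc j) (ℕₚ.m<n⇒m<1+n (lt M)) j<j′))
    ... | tri> _ _ j′<j = ⊥-elim (ℤₚ.<-irrefl (sym (closes N)) (above M (suc j′) (ℕₚ.m<n⇒m<1+n (lt N)) j′<j))

    match-injective : ∀ {i i′ j} → Match i j → Match i′ j → i ≡ i′
    match-injective {i} {i′} M N with ℕₚ.<-cmp i i′
    ... | tri≈ _ e _ = e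
    ... | tri< i<i′ _ _ = ⊥-elim (ℤₚ.<-irrefl (trans (sym (closes M)) (closes N)) (above M i′ i<i′ (ℕₚ.<⇒≤ (lt N))))
    ... | tri> _ _ i′<i = ⊥-elim (ℤₚ.<-irrefl (trans (sym (closes N)) (closes M)) (above N i i′<i (ℕₚ.<⇒≤ (lt M))))

    -- `k` lies inside the first arc, so its height exceeds that of `i`. If the arcs crossed,
    -- `suc j` would lie inside the second, so the same height of `i`, reached again at `suc j`,
    -- would exceed that of `k`.
    match-noncrossing : ∀ {i j k l} → Match i j → Match k l → i < k → k < j → j < l → ⊥
    match-noncrossing {i} {j} {k} M N i<k k<j j<l =
      ℤₚ.<-asym (above M k i<k (ℕₚ.<⇒≤ k<j))
        (subst (ht w k ℤ.<_) (closes M) (above N (suc j) (ℕₚ.m<n⇒m<1+n k<j) j<l))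

    next-≥pred : ∀ x h → ℤ.pred h ℤ.≤ next x h
    next-≥pred none h = ℤₚ.<⇒≤ (pred[i]<i h)
    next-≥pred single h = ℤₚ.<⇒≤ (pred[i]<i h)
    next-≥pred opening h = ℤₚ.<⇒≤ (ℤₚ.<-trans (pred[i]<i h) (i<suc[i] h))
    next-≥pred closing h = ℤₚ.≤-refl

    next-≤suc : ∀ x h → next x h ℤ.≤ ℤ.suc h
    next-≤suc none h = ℤₚ.<⇒≤ (i<suc[i] h)
    next-≤suc single h = ℤₚ.<⇒≤ (i<suc[i] h)
    next-≤suc opening h = ℤₚ.≤-refl
    next-≤suc closing h = ℤₚ.<⇒≤ (ℤₚ.<-trans (pred[i]<i h) (i<suc[i] h))

    -- A discrete intermediate value argument: heights drop by at most one per letter, so a path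
    -- that must come down to the level of `i` first meets it exactly. `n` is the distance left to
    -- search.
    searchForward : ∀ n {i} j → i < j → (∀ k → i < k → k ≤ j → ht w i ℤ.< ht w k) →
      ht w (n + j) ℤ.≤ ht w i → ∃ λ j′ → Match i j′ × j′ < n + j
    searchForward zero j i<j up low = ⊥-elim (ℤₚ.<⇒≱ (up j i<j ℕₚ.≤-refl) low)
    searchForward (suc n) {i} j i<j up low with ht w i ℤₚ.<? ht w (suc j)
    ... | no ¬h = j , match i<j
            (ℤₚ.≤-antisym (ℤₚ.≮⇒≥ ¬h) (ℤₚ.≤-trans (ℤₚ.i<j⇒i≤pred[j] (up j i<j ℕₚ.≤-refl)) (next-≥pred (w j) (ht w j)))) up
          , s≤s (ℕₚ.m≤n+m j n)
    ... | yes h with searchForward n (suc j) (ℕₚ.m<n⇒m<1+n i<j)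
                       (λ k i<k k≤1+j → extend (ℕₚ.m≤n⇒m<n∨m≡n k≤1+j) i<k)
                       (subst (λ z → ht w z ℤ.≤ ht w i) (sym (ℕₚ.+-suc n j)) low)
      where
      extend : ∀ {k} → k < suc j ⊎ k ≡ suc j → i < k → ht w i ℤ.< ht w k
      extend (inj₁ (s≤s k≤j)) i<k = up _ i<k k≤j
      extend (inj₂ refl) _ = h
    ...   | j′ , M , j′< = j′ , M , subst (j′ <_) (ℕₚ.+-suc n j) j′<

    -- The mirror image, using that heights rise by at most one per letter. In the second outcome
    -- the closing letter at `j` has no partner in the window. Over a whole period this becomes a
    -- diameter.
    searchBackward : ∀ n {i j} → suc (n + i) ≤ j → (∀ k → n + i < k → k ≤ j → ht w (suc j) ℤ.< ht w k) →
      (∃ λ k → i < k × Match k j) ⊎ (∀ k → i < k → k ≤ j → ht w (suc j) ℤ.< ht w k)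
    searchBackward zero _ up = inj₂ up
    searchBackward (suc n) {i} {j} n<j up with ht w (suc j) ℤₚ.<? ht w (suc n + i)
    ... | yes h = searchBackward n (ℕₚ.<⇒≤ n<j) λ k n<k k≤j → extend (ℕₚ.m≤n⇒m<n∨m≡n n<k) k≤j
      where
      extend : ∀ {k} → suc n + i < k ⊎ suc n + i ≡ k → k ≤ j → ht w (suc j) ℤ.< ht w k
      extend (inj₁ l) k≤j = up _ l k≤j
      extend (inj₂ refl) _ = h
    ... | no ¬h = inj₁ (suc n + i , s≤s (ℕₚ.m≤n+m i n) , match n<j e
                    (λ k n<k k≤j → subst (ℤ._< ht w k) e (up k n<k k≤j)))
      where
      e : ht w (suc j) ≡ ht w (suc n + i)
      e = ℤₚ.≤-antisym
        (subst (ht w (suc j) ℤ.≤_) (ℤₚ.pred-suc _)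
          (ℤₚ.i<j⇒i≤pred[j] (ℤₚ.<-≤-trans (up (suc (suc n + i)) ℕₚ.≤-refl n<j) (next-≤suc (w (suc n + i)) _))))
        (ℤₚ.≮⇒≥ ¬h)

    -- From noncrossing arcs in an interval to balanced words.

    module Interval {m : ℕ} {f : ℕ → Offset} (circ : Circular m f)
      (free⇒none : ∀ {i} → f i ≡ free → w i ≡ none) (point⇒single : ∀ {i} → f i ≡ point → w i ≡ single) where
      open Circular circ

      -- No arc of f leaves [a , b), and w records the direction of each arc in it.
      Closed : ℕ → ℕ → Set
      Closed a b = ∀ {k δ} → a ≤ k → k < b → f k ≡ reach δ →
        (w k ≡ opening × k + δ < b) ⊎ (w k ≡ closing × a + m ≤ k + δ)

      partner-unique : ∀ {i j δ ε} → f i ≡ reach δ → f j ≡ reach ε → i + δ ≡ j + ε → i ≡ j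
      partner-unique {i} {j} {δ} {ε} fi fj e with partner fi | partner fj
      ... | δ′ , _ , _ , eδ , f₁ | ε′ , _ , _ , eε , f₂ =
        ℕₚ.+-cancelʳ-≡ δ i j (trans e (cong (λ z → j + z) (sym δ≡ε)))
        where
        δ′≡ε′ : δ′ ≡ ε′
        δ′≡ε′ = reach-injective (trans (sym f₁) (trans (cong f e) f₂))
        δ≡ε : δ ≡ ε
        δ≡ε = ℕₚ.+-cancelʳ-≡ δ′ δ ε (trans eδ (trans (sym eε) (cong (λ z → ε + z) (sym δ′≡ε′))))

      reach<m : ∀ {i δ} → f i ≡ reach δ → δ < m
      reach<m {δ = δ} fi with partner fi
      ... | δ′ , _ , 0<δ′ , refl , _ = ℕₚ.m<m+n δ 0<δ′

      -- If k + δ = a + m, then a is the partner of k.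
      wrapped-partner : ∀ {a k δ} → f k ≡ reach δ → k + δ ≡ a + m → f a ≡ reach (m ∸ δ) × a + (m ∸ δ) ≡ k
      wrapped-partner {a} {k} {δ} fk e with partner fk
      ... | δ′ , _ , _ , refl , f′ rewrite ℕₚ.m+n∸m≡n δ δ′ =
        trans (sym (periodic a)) (trans (cong f (sym e)) f′) ,
        sym (ℕₚ.+-cancelʳ-≡ δ k (a + δ′) (trans e (trans (cong (λ z → a + z) (ℕₚ.+-comm δ δ′)) (sym (ℕₚ.+-assoc a δ′ δ)))))

      -- Anything strictly between the two alternatives is a crossing, and at either boundary the
      -- two arcs would share an endpoint.
      nested : ∀ {i k δ ε} → f i ≡ reach δ → f k ≡ reach ε → i < k → k < i + δ →
        k + ε < i + δ ⊎ i + m < k + ε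
      nested {i} {k} {δ} {ε} fi fk i<k k<j with ℕₚ.<-cmp (k + ε) (i + δ)
      ... | tri< l _ _ = inj₁ l
      ... | tri≈ _ e _ = ⊥-elim (ℕₚ.<⇒≢ i<k (sym (partner-unique fk fi e)))
      ... | tri> _ _ g with ℕₚ.<-cmp (k + ε) (i + m)
      ...   | tri< l _ _ = ⊥-elim (noncrossing fi fk i<k k<j g l)
      ...   | tri> _ _ h = inj₂ h
      ...   | tri≈ _ e _ with wrapped-partner fk e
      ...     | fi′ , e′ = ⊥-elim (ℕₚ.<⇒≢ k<j (sym (trans (cong (λ z → i + z) (reach-injective (trans (sym fi) fi′))) e′)))

      -- First-return decomposition: an arc from `a` to `j` splits the interval into the part under
      -- the arc and the part after `j`, and both are again `Closed`. `n` bounds the length and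
      -- drives the recursion.
      closed⇒balanced : ∀ n {a b} → b ≤ n + a → a ≤ b → b ≤ a + m → Closed a b →
        ht w b ≡ ht w a × (∀ k → a ≤ k → k ≤ b → ht w a ℤ.≤ ht w k)
      skip : ∀ n {a b} → b ≤ suc n + a → a < b → b ≤ a + m → Closed a b →
        (∀ δ → f a ≢ reach δ) → ht w (suc a) ≡ ht w a →
        ht w b ≡ ht w a × (∀ k → a ≤ k → k ≤ b → ht w a ℤ.≤ ht w k)

      skip n {a} {b} b≤ a<b b≤a+m cl unreached e = trans (proj₁ rest) e , heights
        where
        cl′ : Closed (suc a) b
        cl′ {k} a<k k<b fk with cl (ℕₚ.<⇒≤ a<k) k<b fk
        ... | inj₁ r = inj₁ r
        ... | inj₂ (wk , le) with ℕₚ.m≤n⇒m<n∨m≡n le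
        ...   | inj₁ l = inj₂ (wk , l)
        -- Equality would make `a` the partner of `k`, but `a` lies on no arc.
        ...   | inj₂ eq = ⊥-elim (unreached _ (proj₁ (wrapped-partner fk (sym eq))))
        rest = closed⇒balanced n {suc a} {b} (subst (b ≤_) (sym (ℕₚ.+-suc n a)) b≤) a<b (ℕₚ.m≤n⇒m≤1+n b≤a+m) cl′
        heights : ∀ k → a ≤ k → k ≤ b → ht w a ℤ.≤ ht w k
        heights k a≤k k≤b with ℕₚ.m≤n⇒m<n∨m≡n a≤k
        ... | inj₂ refl = ℤₚ.≤-refl
        ... | inj₁ a<k = subst (ℤ._≤ ht w k) e (proj₂ rest k a<k k≤b)

      closed⇒balanced n {a} {b} b≤ a≤b b≤a+m cl with ℕₚ.m≤n⇒m<n∨m≡n a≤b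
      ... | inj₂ refl = refl , λ k a≤k k≤a → ℤₚ.≤-reflexive (cong (ht w) (ℕₚ.≤-antisym a≤k k≤a))
      closed⇒balanced zero {a} {b} b≤ a≤b b≤a+m cl | inj₁ a<b = ⊥-elim (ℕₚ.<⇒≱ a<b b≤)
      closed⇒balanced (suc n) {a} {b} b≤ a≤b b≤a+m cl | inj₁ a<b with f a in fa
      ... | reach δ = enclosing (cl ℕₚ.≤-refl a<b fa)
        where
        j = a + δ
        enclosing : (w a ≡ opening × a + δ < b) ⊎ (w a ≡ closing × a + m ≤ a + δ) →
          ht w b ≡ ht w a × (∀ k → a ≤ k → k ≤ b → ht w a ℤ.≤ ht w k)
        enclosing (inj₂ (_ , le)) = ⊥-elim (ℕₚ.<⇒≱ (reach<m fa) (ℕₚ.+-cancelˡ-≤ a _ _ le))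
        enclosing (inj₁ (wa , j<b)) = trans (proj₁ right) j-closes , heights
          where
          a<j : a < j
          a<j = ℕₚ.m<m+n a (proj₁ (proj₂ (partner fa)))
          inner : Closed (suc a) j
          inner {k} {ε} a<k k<j fk with nested fa fk a<k k<j | cl (ℕₚ.<⇒≤ a<k) (ℕₚ.<-trans k<j j<b) fk
          ... | inj₁ l | inj₁ (wk , _) = inj₁ (wk , l)
          ... | inj₂ l | inj₂ (wk , _) = inj₂ (wk , l)
          ... | inj₁ l | inj₂ (_ , le) = ⊥-elim (ℕₚ.<⇒≱ (ℕₚ.<-≤-trans (ℕₚ.<-trans l j<b) b≤a+m) le)
          ... | inj₂ l | inj₁ (_ , l′) = ⊥-elim (ℕₚ.<⇒≱ (ℕₚ.<-≤-trans l′ b≤a+m) (ℕₚ.<⇒≤ l))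
          δ′ = proj₁ (partner fa)
          fj : f j ≡ reach δ′
          fj = proj₂ (proj₂ (proj₂ (proj₂ (partner fa))))
          j+δ′≡a+m : j + δ′ ≡ a + m
          j+δ′≡a+m = trans (ℕₚ.+-assoc a δ δ′) (cong (λ z → a + z) (proj₁ (proj₂ (proj₂ (proj₂ (partner fa))))))
          outer : Closed (suc j) b
          outer {k} {ε} j<k k<b fk with cl (ℕₚ.≤-trans (ℕₚ.<⇒≤ a<j) (ℕₚ.<⇒≤ j<k)) k<b fk
          ... | inj₁ r = inj₁ r
          ... | inj₂ (wk , le) = inj₂ (wk , beyond (ℕₚ.<-cmp (j + m) (k + ε)))
            where
            beyond : _ → j + m < k + ε
            beyond (tri< l _ _) = l
            beyond (tri≈ _ e _) with wrapped-partner fk (sym e)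
            ... | fj′ , e′ = ⊥-elim (ℕₚ.<⇒≢ (ℕₚ.<-≤-trans k<b b≤a+m)
                   (trans (sym e′) (trans (cong (λ z → j + z) (reach-injective (trans (sym fj′) fj))) j+δ′≡a+m)))
            -- Otherwise the partner of `k`, taken back by one turn, is a position `l` strictly
            -- between `a` and `j`, and the arc from `l` to `k` crosses the arc from `a` to `j`.
            beyond (tri> _ _ g) = ⊥-elim (noncrossing fa fl a<l l<j
                (subst (j <_) (sym l+≡k) j<k) (subst (_< a + m) (sym l+≡k) (ℕₚ.<-≤-trans k<b b≤a+m)))
              where
              l = a + (k + ε ∸ (a + m))
              k+ε≡l+m : k + ε ≡ l + m
              k+ε≡l+m = trans (sym (ℕₚ.m+[n∸m]≡n le)) (rearrange a m (k + ε ∸ (a + m)))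
                where
                rearrange : ∀ a m x → a + m + x ≡ a + x + m
                rearrange = solve-∀
              fl = proj₁ (wrapped-partner fk k+ε≡l+m)
              l+≡k = proj₂ (wrapped-partner fk k+ε≡l+m)
              l<j : l < j
              l<j = ℕₚ.+-cancelʳ-< m l j (subst (_< j + m) k+ε≡l+m g)
              a<l : a < l
              a<l with ℕₚ.m≤n⇒m<n∨m≡n (ℕₚ.m≤m+n a (k + ε ∸ (a + m)))
              ... | inj₁ h = h
              ... | inj₂ e with wrapped-partner fk (trans k+ε≡l+m (cong (_+ m) (sym e)))
              ...   | fa′ , a+≡k = ⊥-elim (ℕₚ.<⇒≢ j<k (trans (cong (λ z → a + z) (reach-injective (trans (sym fa) fa′))) a+≡k))
          lower : ht w (suc a) ≡ ℤ.suc (ht w a)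
          lower = opening⇒rising wa
          left = closed⇒balanced n {suc a} {j} (ℕₚ.≤-trans (ℕₚ.<⇒≤ j<b) (subst (b ≤_) (sym (ℕₚ.+-suc n a)) b≤)) a<j
                   (ℕₚ.≤-trans (ℕₚ.<⇒≤ j<b) (ℕₚ.m≤n⇒m≤1+n b≤a+m)) inner
          wj : w j ≡ closing
          wj with cl (ℕₚ.<⇒≤ a<j) j<b fj
          ... | inj₂ (wj , _) = wj
          ... | inj₁ (_ , l) = ⊥-elim (ℕₚ.<⇒≱ l (subst (b ≤_) (sym j+δ′≡a+m) b≤a+m))
          j-closes : ht w (suc j) ≡ ht w a
          j-closes = trans (closing⇒falling wj) (trans (cong ℤ.pred (trans (proj₁ left) lower)) (ℤₚ.pred-suc _))
          right = closed⇒balanced n {suc j} {b}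
                    (ℕₚ.≤-trans b≤ (subst (_≤ n + suc j) (ℕₚ.+-suc n a) (ℕₚ.+-monoʳ-≤ n (s≤s (ℕₚ.<⇒≤ a<j))))) j<b
                    (ℕₚ.≤-trans b≤a+m (ℕₚ.+-monoˡ-≤ m (ℕₚ.m≤n⇒m≤1+n (ℕₚ.<⇒≤ a<j)))) outer
          heights : ∀ k → a ≤ k → k ≤ b → ht w a ℤ.≤ ht w k
          heights k a≤k k≤b with ℕₚ.m≤n⇒m<n∨m≡n a≤k | ℕₚ.≤-<-connex k j
          ... | inj₂ refl | _ = ℤₚ.≤-refl
          ... | inj₁ a<k | inj₁ k≤j = ℤₚ.≤-trans (ℤₚ.<⇒≤ (subst (ht w a ℤ.<_) (sym lower) (i<suc[i] _))) (proj₂ left k a<k k≤j)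
          ... | inj₁ a<k | inj₂ j<k = subst (ℤ._≤ ht w k) j-closes (proj₂ right k j<k k≤b)
      ... | free = skip n b≤ a<b b≤a+m cl (λ _ e → contradiction (trans (sym fa) e) λ ()) (cong (λ x → next x (ht w a)) (free⇒none fa))
      ... | point = skip n b≤ a<b b≤a+m cl (λ _ e → contradiction (trans (sym fa) e) λ ()) (cong (λ x → next x (ht w a)) (point⇒single fa))

  -- Decoding a periodic word into a circular configuration.

  module Periodic (w : ℕ → Letter) (c : ℕ) (w-periodic : ∀ i → w (i + c) ≡ w i) where

    ht-periodic : ∀ i → ht w (i + c) ≡ ht w i ℤ.+ ht w c
    ht-periodic zero = sym (ℤₚ.+-identityˡ _)
    ht-periodic (suc i) rewrite w-periodic i | ht-periodic i = next-+ (w i) (ht w i) (ht w c)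

    match-shift : ∀ {i j} → Match w i j → Match w (i + c) (j + c)
    match-shift {i} {j} (match i<j closes above) = match (ℕₚ.+-monoˡ-< c i<j)
      (trans (ht-periodic (suc j)) (trans (cong (ℤ._+ ht w c) closes) (sym (ht-periodic i))))
      (λ k i+c<k k≤j+c → shifted k i+c<k k≤j+c (ℕₚ.m∸n+n≡m (ℕₚ.≤-trans (ℕₚ.m≤n+m c i) (ℕₚ.<⇒≤ i+c<k))))
      where
      shifted : ∀ k → i + c < k → k ≤ j + c → k ∸ c + c ≡ k → ht w (i + c) ℤ.< ht w k
      shifted k i+c<k k≤j+c e = subst₂ ℤ._<_ (sym (ht-periodic i)) (trans (sym (ht-periodic (k ∸ c))) (cong (ht w) e))
        (ℤₚ.+-monoˡ-< (ht w c) (above (k ∸ c)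
          (ℕₚ.+-cancelʳ-< c i _ (subst (i + c <_) (sym e) i+c<k))
          (ℕₚ.+-cancelʳ-≤ c _ j (subst (_≤ j + c) (sym e) k≤j+c))))

    -- An unmatched closing letter: the height it reaches one period later is below every height in
    -- that period, so no opening letter there can be its partner.
    Diameter : ℕ → Set
    Diameter i = w i ≡ closing × (∀ k → i < k → k ≤ i + c → ht w (suc (i + c)) ℤ.< ht w k)

    -- e = m ∸ c, so that an arc which closes at i + c is seen from i at distance s + e.
    module _ (e : ℕ) where

      -- A relation instead of a function: `decode` supplies existence and `decodes-unique`
      -- uniqueness, so two configurations agree once both satisfy it.
      data Decodes (i : ℕ) : Offset → Set where
        isFree   : w i ≡ none → Decodes i free
        isPoint  : w i ≡ single → Decodes i point
        opens    : ∀ {t} → t < c → Match w i (i + t) → Decodes i (reach t)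
        closes   : ∀ {s} → 0 < s → Match w (i + s) (i + c) → Decodes i (reach (s + e))
        diameter : e ≡ c → Diameter i → Decodes i (reach c)

      -- Either every letter is matched, or the unmatched letters are closing and pair up as diameters.
      data Balance : Set where
        balanced  : ht w c ≡ ℤ.+ 0 → Balance
        deficient : e ≡ c → ht w c ≡ ℤ.- (ℤ.+ 1) → Balance

    match-closingˡ : ∀ {i s} → Match w (i + s) (i + c) → w i ≡ closing
    match-closingˡ {i} M = trans (sym (w-periodic i)) (match-closing w M)

    -- The letter at i separates all pairs of different constructors except `closes` and `diameter`.
    -- There the opening partner has exactly the height that a diameter requires to be exceeded.
    decodes-unique : ∀ {e i x y} → Decodes e i x → Decodes e i y → x ≡ y
    decodes-unique (isFree _) (isFree _) = refl
    decodes-unique (isPoint _) (isPoint _) = refl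
    decodes-unique (diameter _ _) (diameter _ _) = refl
    decodes-unique {i = i} (opens _ M) (opens _ N) = cong reach (ℕₚ.+-cancelˡ-≡ i _ _ (match-functional w M N))
    decodes-unique {e} {i} (closes _ M) (closes _ N) = cong (λ s → reach (s + e)) (ℕₚ.+-cancelˡ-≡ i _ _ (match-injective w M N))
    decodes-unique {i = i} (closes 0<s M) (diameter _ (_ , D)) =
      ⊥-elim (ℤₚ.<-irrefl (Match.closes M) (D _ (ℕₚ.m<m+n i 0<s) (ℕₚ.<⇒≤ (Match.lt M))))
    decodes-unique {i = i} (diameter _ (_ , D)) (closes 0<s M) =
      ⊥-elim (ℤₚ.<-irrefl (Match.closes M) (D _ (ℕₚ.m<m+n i 0<s) (ℕₚ.<⇒≤ (Match.lt M))))
    decodes-unique (isFree a) (isPoint b) = contradiction (trans (sym a) b) λ ()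
    decodes-unique (isFree a) (opens _ M) = contradiction (trans (sym a) (match-opening w M)) λ ()
    decodes-unique (isFree a) (closes _ M) = contradiction (trans (sym a) (match-closingˡ M)) λ ()
    decodes-unique (isFree a) (diameter _ (b , _)) = contradiction (trans (sym a) b) λ ()
    decodes-unique (isPoint a) (isFree b) = contradiction (trans (sym a) b) λ ()
    decodes-unique (isPoint a) (opens _ M) = contradiction (trans (sym a) (match-opening w M)) λ ()
    decodes-unique (isPoint a) (closes _ M) = contradiction (trans (sym a) (match-closingˡ M)) λ ()
    decodes-unique (isPoint a) (diameter _ (b , _)) = contradiction (trans (sym a) b) λ ()
    decodes-unique (opens _ M) (isFree b) = contradiction (trans (sym (match-opening w M)) b) λ ()
    decodes-unique (opens _ M) (isPoint b) = contradiction (trans (sym (match-opening w M)) b) λ ()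
    decodes-unique (opens _ M) (closes _ N) = contradiction (trans (sym (match-opening w M)) (match-closingˡ N)) λ ()
    decodes-unique (opens _ M) (diameter _ (b , _)) = contradiction (trans (sym (match-opening w M)) b) λ ()
    decodes-unique (closes _ N) (isFree b) = contradiction (trans (sym (match-closingˡ N)) b) λ ()
    decodes-unique (closes _ N) (isPoint b) = contradiction (trans (sym (match-closingˡ N)) b) λ ()
    decodes-unique (closes _ N) (opens _ M) = contradiction (trans (sym (match-closingˡ N)) (match-opening w M)) λ ()
    decodes-unique (diameter _ (b , _)) (isFree a) = contradiction (trans (sym b) a) λ ()
    decodes-unique (diameter _ (b , _)) (isPoint a) = contradiction (trans (sym b) a) λ ()
    decodes-unique (diameter _ (b , _)) (opens _ M) = contradiction (trans (sym b) (match-opening w M)) λ ()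

    +-swap : ∀ a b d → a + b + d ≡ a + d + b
    +-swap = solve-∀

    match-at : ∀ {i j k l} → Match w i j → i ≡ k → j ≡ l → Match w k l
    match-at M refl refl = M

    diameter-shift : ∀ {i} → Diameter i → Diameter (i + c)
    diameter-shift {i} (wi , D) = trans (w-periodic i) wi , λ k i<k k≤ →
      shifted k i<k k≤ (ℕₚ.m∸n+n≡m (ℕₚ.≤-trans (ℕₚ.m≤n+m c i) (ℕₚ.<⇒≤ i<k)))
      where
      shifted : ∀ k → i + c < k → k ≤ i + c + c → k ∸ c + c ≡ k → ht w (suc (i + c + c)) ℤ.< ht w k
      shifted k i<k k≤ eq = subst₂ ℤ._<_ (sym (ht-periodic (suc (i + c)))) (trans (sym (ht-periodic (k ∸ c))) (cong (ht w) eq))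
        (ℤₚ.+-monoˡ-< (ht w c) (D (k ∸ c) (ℕₚ.+-cancelʳ-< c i _ (subst (i + c <_) (sym eq) i<k))
          (ℕₚ.+-cancelʳ-≤ c _ (i + c) (subst (_≤ i + c + c) (sym eq) k≤))))

    decodes-shift : ∀ {e i x} → Decodes e i x → Decodes e (i + c) x
    decodes-shift {i = i} (isFree a) = isFree (trans (w-periodic i) a)
    decodes-shift {i = i} (isPoint a) = isPoint (trans (w-periodic i) a)
    decodes-shift {i = i} (opens {t} t<c M) = opens t<c (match-at (match-shift M) refl (+-swap i t c))
    decodes-shift {i = i} (closes {s} 0<s M) = closes 0<s (match-at (match-shift M) (+-swap i s c) refl)
    decodes-shift (diameter eq D) = diameter eq (diameter-shift D)

    module _ (0<c : 0 < c) {e : ℕ} where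

      -- The height gained over a period is never positive, so an opening letter is matched within
      -- one period. A closing letter may stay unmatched, but not in the balanced case, where the
      -- heights at `suc i` and `suc (i + c)` coincide.
      decode : Balance e → ∀ i → ∃ (Decodes e i)
      decode bal i with w i in wi
      ... | none = free , isFree wi
      ... | single = point , isPoint wi
      ... | opening with searchForward w (ℕ.pred c) (suc i) (ℕₚ.n<1+n i) up low
        where
        instance _ = ℕ.>-nonZero 0<c
        up : ∀ k → i < k → k ≤ suc i → ht w i ℤ.< ht w k
        up k i<k k≤1+i = subst (λ z → ht w i ℤ.< ht w z) (ℕₚ.≤-antisym i<k k≤1+i)
          (subst (ht w i ℤ.<_) (sym (opening⇒rising w wi)) (i<suc[i] _))
        end : ℕ.pred c + suc i ≡ i + c
        end = trans (ℕₚ.+-suc (ℕ.pred c) i) (trans (cong (_+ i) (ℕₚ.suc-pred c)) (ℕₚ.+-comm c i))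
        b≤0 : Balance e → ht w c ℤ.≤ ℤ.+ 0
        b≤0 (balanced b) = ℤₚ.≤-reflexive b
        b≤0 (deficient _ b) rewrite b = ℤ.-≤+
        low : ht w (ℕ.pred c + suc i) ℤ.≤ ht w i
        low rewrite end = subst₂ ℤ._≤_ (sym (ht-periodic i)) (ℤₚ.+-identityʳ (ht w i)) (ℤₚ.+-monoʳ-≤ (ht w i) (b≤0 bal))
      ...   | j , M , j< = reach (j ∸ i) , opens
                (ℕₚ.+-cancelˡ-< i _ _ (subst₂ _<_ (sym i+) (trans (ℕₚ.+-suc (ℕ.pred c) i) (trans (cong (_+ i) (ℕₚ.suc-pred c)) (ℕₚ.+-comm c i))) j<))
                (match-at M refl (sym i+))
        where
        instance _ = ℕ.>-nonZero 0<c
        i+ : i + (j ∸ i) ≡ j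
        i+ = ℕₚ.m+[n∸m]≡n (ℕₚ.<⇒≤ (Match.lt M))
      decode bal i | closing with searchBackward w (ℕ.pred c) {i} {i + c} start up
        where
        instance _ = ℕ.>-nonZero 0<c
        end : suc (ℕ.pred c + i) ≡ i + c
        end = trans (cong (_+ i) (ℕₚ.suc-pred c)) (ℕₚ.+-comm c i)
        start : suc (ℕ.pred c + i) ≤ i + c
        start = ℕₚ.≤-reflexive end
        up : ∀ k → ℕ.pred c + i < k → k ≤ i + c → ht w (suc (i + c)) ℤ.< ht w k
        up k l u rewrite ℕₚ.≤-antisym u (subst (_≤ k) end l) =
          subst (ℤ._< ht w (i + c)) (sym (closing⇒falling w (trans (w-periodic i) wi))) (pred[i]<i _)
      ... | inj₁ (k , i<k , M) = reach (k ∸ i + e) , closes (ℕₚ.m<n⇒0<n∸m i<k) (match-at M (sym (ℕₚ.m+[n∸m]≡n (ℕₚ.<⇒≤ i<k))) refl)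
      ... | inj₂ D = unmatched bal
        where
        unmatched : Balance e → ∃ (Decodes e i)
        unmatched (deficient eq _) = reach c , diameter eq (wi , D)
        unmatched (balanced b) = ⊥-elim (ℤₚ.<-irrefl
          (trans (ht-periodic (suc i)) (trans (cong (λ x → ht w (suc i) ℤ.+ x) b) (ℤₚ.+-identityʳ _)))
          (D (suc i) (ℕₚ.n<1+n i) (ℕₚ.m<m+n i 0<c)))

      module Decoded (bal : Balance e) (q : ℕ) (e≡qc : e ≡ q * c) where
        m = c + e

        offset : ℕ → Offset
        offset i = proj₁ (decode bal i)

        offset-decodes : ∀ i → Decodes e i (offset i)
        offset-decodes i = proj₂ (decode bal i)

        offset-periodic : ∀ i → offset (i + c) ≡ offset i
        offset-periodic i = decodes-unique (offset-decodes (i + c)) (decodes-shift (offset-decodes i))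

        decodes⇒≡ : ∀ {i x} → Decodes e i x → offset i ≡ x
        decodes⇒≡ D = decodes-unique (offset-decodes _) D

        match-shift-* : ∀ r {i j} → Match w i j → Match w (i + r * c) (j + r * c)
        match-shift-* zero {i} {j} M = match-at M (sym (ℕₚ.+-identityʳ i)) (sym (ℕₚ.+-identityʳ j))
        match-shift-* (suc r) {i} {j} M = match-at (match-shift-* r (match-shift M)) (ℕₚ.+-assoc i c _) (ℕₚ.+-assoc j c _)

        match-shift-e : ∀ {i j} → Match w i j → Match w (i + e) (j + e)
        match-shift-e M rewrite e≡qc = match-shift-* q M

        offset-periodic-* : ∀ r i → offset (i + r * c) ≡ offset i
        offset-periodic-* zero i = cong offset (ℕₚ.+-identityʳ i)
        offset-periodic-* (suc r) i = trans (cong offset (sym (ℕₚ.+-assoc i c (r * c))))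
          (trans (offset-periodic-* r (i + c)) (offset-periodic i))

        match-shift-m : ∀ {i j} → Match w i j → Match w (i + m) (j + m)
        match-shift-m {i} {j} M = match-at (match-shift-e (match-shift M)) (ℕₚ.+-assoc i c e) (ℕₚ.+-assoc j c e)

        -- The other end sees the arc at the complementary distance in m. The match is shifted by
        -- `c` or by `e` to the place where `Decodes` looks for it from that end.
        partner′ : ∀ {i δ} → Decodes e i (reach δ) →
          ∃ λ δ′ → 0 < δ × 0 < δ′ × δ + δ′ ≡ m × offset (i + δ) ≡ reach δ′
        partner′ {i} (opens {t} t<c M) =
          c ∸ t + e , ℕₚ.+-cancelˡ-< i 0 t (subst (_< i + t) (sym (ℕₚ.+-identityʳ i)) (Match.lt M)) ,
          ℕₚ.<-≤-trans 0<s (ℕₚ.m≤m+n _ e) , trans (sym (ℕₚ.+-assoc t (c ∸ t) e)) (cong (_+ e) t+) ,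
          decodes⇒≡ (closes 0<s (match-at (match-shift M) (trans (cong (λ z → i + z) (sym t+)) (sym (ℕₚ.+-assoc i t _))) refl))
          where
          0<s : 0 < c ∸ t
          0<s = ℕₚ.m<n⇒0<n∸m t<c
          t+ : t + (c ∸ t) ≡ c
          t+ = ℕₚ.m+[n∸m]≡n (ℕₚ.<⇒≤ t<c)
        partner′ {i} (closes {s} 0<s M) =
          c ∸ s , ℕₚ.<-≤-trans 0<s (ℕₚ.m≤m+n s e) , ℕₚ.m<n⇒0<n∸m s<c ,
          trans (+-swap s e (c ∸ s)) (cong (_+ e) s+) ,
          decodes⇒≡ (opens (ℕₚ.∸-monoʳ-< 0<s (ℕₚ.<⇒≤ s<c))
            (match-at (match-shift-e M) (ℕₚ.+-assoc i s e)
              (trans (cong (λ z → i + z + e) (sym s+)) (rearrange i s e (c ∸ s)))))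
          where
          s<c : s < c
          s<c = ℕₚ.+-cancelˡ-< i s c (Match.lt M)
          s+ : s + (c ∸ s) ≡ c
          s+ = ℕₚ.m+[n∸m]≡n (ℕₚ.<⇒≤ s<c)
          rearrange : ∀ i s e r → i + (s + r) + e ≡ i + (s + e) + r
          rearrange = solve-∀
        partner′ {i} (diameter refl D) = c , 0<c , 0<c , refl , decodes⇒≡ (decodes-shift (diameter refl D))

        -- Crossings compare positions over a full turn, so a backward arc is recorded as closing at
        -- i + m, whereas `Decodes` records it at i + c.
        data Direction (i δ : ℕ) : Set where
          forward  : δ < c → Match w i (i + δ) → Direction i δ
          backward : Match w (i + δ) (i + m) → Direction i δ
          diametral : e ≡ c → δ ≡ c → Diameter i → Direction i δ

        direction : ∀ {i δ} → Decodes e i (reach δ) → Direction i δ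
        direction (opens t<c M) = forward t<c M
        direction {i} (closes {s} 0<s M) = backward (match-at (match-shift-e M) (ℕₚ.+-assoc i s e) (ℕₚ.+-assoc i c e))
        direction (diameter eq D) = diametral eq refl D

        deficient′ : e ≡ c → ∀ {i} → Diameter i → ht w c ≡ ℤ.- (ℤ.+ 1)
        deficient′ eq {i} (_ , D) = go bal
          where
          go : Balance e → ht w c ≡ ℤ.- (ℤ.+ 1)
          go (deficient _ b) = b
          go (balanced b) = ⊥-elim (ℤₚ.<-irrefl
            (trans (ht-periodic (suc i)) (trans (cong (λ x → ht w (suc i) ℤ.+ x) b) (ℤₚ.+-identityʳ _)))
            (D (suc i) (ℕₚ.n<1+n i) (ℕₚ.m<m+n i 0<c)))

        -- Two matches would cross, possibly after moving one by a full turn. A diameter against a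
        -- match makes two heights strictly smaller than each other.
        direction-noncrossing : ∀ {i j δ ε} → Direction i δ → Direction j ε →
          i < j → j < i + δ → i + δ < j + ε → j + ε < i + m → ⊥
        direction-noncrossing (forward _ M) (forward _ N) l₁ l₂ l₃ l₄ = match-noncrossing w M N l₁ l₂ l₃
        direction-noncrossing (forward _ M) (backward N) l₁ l₂ l₃ l₄ =
          match-noncrossing w N (match-shift-m M) l₄ (ℕₚ.+-monoˡ-< m l₁) (ℕₚ.+-monoˡ-< m l₂)
        direction-noncrossing (backward M) (forward _ N) l₁ l₂ l₃ l₄ = match-noncrossing w N M l₂ l₃ l₄
        direction-noncrossing (backward M) (backward N) l₁ l₂ l₃ l₄ =
          match-noncrossing w M N l₃ l₄ (ℕₚ.+-monoˡ-< m l₁)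
        direction-noncrossing (diametral refl refl (_ , D)) (forward _ N) l₁ l₂ l₃ l₄ =
          ℤₚ.<-asym (D _ l₁ (ℕₚ.<⇒≤ l₂)) (Match.above N _ (ℕₚ.m<n⇒m<1+n l₂) l₃)
        direction-noncrossing {i} {j} {δ} {ε} (diametral refl refl D) (backward N) l₁ l₂ l₃ l₄ =
          ℤₚ.<-asym (proj₂ (diameter-shift D) (j + ε) l₃ (subst (j + ε ≤_) i+m (ℕₚ.<⇒≤ l₄)))
            (Match.above N (suc (i + c + c)) (subst (λ z → j + ε < suc z) i+m (ℕₚ.m<n⇒m<1+n l₄))
              (subst (_< j + m) i+m (ℕₚ.+-monoˡ-< m l₁)))
          where
          i+m : i + m ≡ i + c + c
          i+m = sym (ℕₚ.+-assoc i c c)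
        direction-noncrossing {i} {j} {δ} (forward δ<c M) (diametral refl refl (_ , D)) l₁ l₂ l₃ l₄ =
          ℤₚ.<-asym (D (i + c) (ℕₚ.<-trans l₂ (ℕₚ.+-monoʳ-< i δ<c)) (ℕₚ.<⇒≤ (ℕₚ.+-monoˡ-< c l₁)))
            (Match.above (match-shift M) (suc (j + c)) (ℕₚ.m<n⇒m<1+n (ℕₚ.+-monoˡ-< c l₁)) (ℕₚ.+-monoˡ-< c l₂))
        direction-noncrossing (backward M) (diametral refl refl (_ , D)) l₁ l₂ l₃ l₄ =
          ℤₚ.<-asym (D _ l₂ (ℕₚ.<⇒≤ l₃)) (Match.above M _ (ℕₚ.m<n⇒m<1+n l₃) l₄)
        -- The first diameter puts the height at `suc (i + c)` below that at `suc j`. The second,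
        -- with the slope -1 per period, gives the reverse weak inequality.
        direction-noncrossing {i} {j} (diametral refl refl (wi , D)) (diametral _ refl (wj , D′)) l₁ l₂ l₃ l₄ =
          ℤₚ.<⇒≱ (D (suc j) (ℕₚ.m<n⇒m<1+n l₁) l₂)
            (subst (ℤ._≤ ht w (suc (i + c))) suc-below
              (ℤₚ.i<j⇒suc[i]≤j (D′ (suc (i + c)) (ℕₚ.m<n⇒m<1+n l₂) l₃)))
          where
          suc-below : ℤ.suc (ht w (suc (j + c))) ≡ ht w (suc j)
          suc-below = trans (cong ℤ.suc (trans (ht-periodic (suc j))
            (trans (cong (λ x → ht w (suc j) ℤ.+ x) (deficient′ refl (wi , D))) (ℤₚ.+-comm (ht w (suc j)) (ℤ.- (ℤ.+ 1))))))
            (ℤₚ.suc-pred (ht w (suc j)))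

        circular : Circular m offset
        circular = record
          { periodic = λ i → trans (cong (λ z → offset (i + (c + z))) e≡qc) (offset-periodic-* (suc q) i)
          ; partner = λ {i} e → partner′ (subst (Decodes _ i) e (offset-decodes i))
          ; noncrossing = λ {i} {j} p q → direction-noncrossing
              (direction (subst (Decodes _ i) p (offset-decodes i)))
              (direction (subst (Decodes _ j) q (offset-decodes j))) }

  -- Encoding circular configurations as periodic words.

  encode : ℕ → Offset → Letter
  encode t free = none
  encode t point = single
  -- The threshold `t` will be the period for orders at least 2, and the distance to the end of the
  -- line for order 1.
  encode t (reach δ) with δ ℕₚ.<? t
  ... | yes _ = opening
  ... | no _ = closing

  encode-< : ∀ {t δ} → δ < t → encode t (reach δ) ≡ opening
  encode-< {t} {δ} δ<t with δ ℕₚ.<? t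
  ... | yes _ = refl
  ... | no ¬p = contradiction δ<t ¬p

  encode-≥ : ∀ {t δ} → t ≤ δ → encode t (reach δ) ≡ closing
  encode-≥ {t} {δ} t≤δ with δ ℕₚ.<? t
  ... | yes p = contradiction t≤δ (ℕₚ.<⇒≱ p)
  ... | no _ = refl

  encode-opening : ∀ {t} x → encode t x ≡ opening → ∃ λ δ → x ≡ reach δ × δ < t
  encode-opening {t} (reach δ) e with δ ℕₚ.<? t
  ... | yes p = δ , refl , p
  encode-opening (reach δ) () | no _

  encode-closing : ∀ {t} x → encode t x ≡ closing → ∃ λ δ → x ≡ reach δ × t ≤ δ
  encode-closing {t} (reach δ) e with δ ℕₚ.<? t
  encode-closing (reach δ) () | yes _
  ... | no ¬p = δ , refl , ℕₚ.≮⇒≥ ¬p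

  module _ (h : ℕ → ℤ) where

    lastMin : ∀ n → ∃ λ i → i ≤ n × (∀ k → k ≤ n → h i ℤ.≤ h k) × (∀ k → i < k → k ≤ n → h i ℤ.< h k)
    lastMin zero = 0 , z≤n , (λ { zero z≤n → ℤₚ.≤-refl }) , λ k 0<k k≤0 → ⊥-elim (ℕₚ.<⇒≱ 0<k k≤0)
    lastMin (suc n) with lastMin n
    ... | i , i≤n , min , last with h (suc n) ℤₚ.≤? h i
    ...   | yes p = suc n , ℕₚ.≤-refl , (λ k k≤ → go k (ℕₚ.m≤n⇒m<n∨m≡n k≤)) , λ k n<k k≤n → ⊥-elim (ℕₚ.<⇒≱ n<k k≤n)
      where
      go : ∀ k → k < suc n ⊎ k ≡ suc n → h (suc n) ℤ.≤ h k
      go k (inj₁ (s≤s k≤n)) = ℤₚ.≤-trans p (min k k≤n)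
      go k (inj₂ refl) = ℤₚ.≤-refl
    ...   | no ¬p = i , ℕₚ.m≤n⇒m≤1+n i≤n , (λ k k≤ → go k (ℕₚ.m≤n⇒m<n∨m≡n k≤)) , λ k i<k k≤ → go′ k i<k (ℕₚ.m≤n⇒m<n∨m≡n k≤)
      where
      go : ∀ k → k < suc n ⊎ k ≡ suc n → h i ℤ.≤ h k
      go k (inj₁ (s≤s k≤n)) = min k k≤n
      go k (inj₂ refl) = ℤₚ.<⇒≤ (ℤₚ.≰⇒> ¬p)
      go′ : ∀ k → i < k → k < suc n ⊎ k ≡ suc n → h i ℤ.< h k
      go′ k i<k (inj₁ (s≤s k≤n)) = last k i<k k≤n
      go′ k i<k (inj₂ refl) = ℤₚ.≰⇒> ¬p

    firstMin : ∀ n → ∃ λ i → i ≤ n × (∀ k → k ≤ n → h i ℤ.≤ h k) × (∀ k → k < i → h i ℤ.< h k)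
    firstMin zero = 0 , z≤n , (λ { zero z≤n → ℤₚ.≤-refl }) , λ _ ()
    firstMin (suc n) with firstMin n
    ... | i , i≤n , min , first with h (suc n) ℤₚ.<? h i
    ...   | yes p = suc n , ℕₚ.≤-refl , (λ k k≤ → go k (ℕₚ.m≤n⇒m<n∨m≡n k≤)) , λ { k (s≤s k≤n) → ℤₚ.<-≤-trans p (min k k≤n) }
      where
      go : ∀ k → k < suc n ⊎ k ≡ suc n → h (suc n) ℤ.≤ h k
      go k (inj₁ (s≤s k≤n)) = ℤₚ.<⇒≤ (ℤₚ.<-≤-trans p (min k k≤n))
      go k (inj₂ refl) = ℤₚ.≤-refl
    ...   | no ¬p = i , ℕₚ.m≤n⇒m≤1+n i≤n , (λ k k≤ → go k (ℕₚ.m≤n⇒m<n∨m≡n k≤)) , first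
      where
      go : ∀ k → k < suc n ⊎ k ≡ suc n → h i ℤ.≤ h k
      go k (inj₁ (s≤s k≤n)) = min k k≤n
      go k (inj₂ refl) = ℤₚ.≮⇒≥ ¬p

  -- Orders at least 2: an arc opens at the endpoint from which it is seen at distance < c.
  module Rotational (c e q : ℕ) (0<c : 0 < c) (c≤e : c ≤ e) (e≡qc : e ≡ q * c)
    (w : ℕ → Letter) (w-periodic : ∀ i → w (i + c) ≡ w i) where
    open Periodic w c w-periodic

    encode-decodes : ∀ {i x} → Decodes e i x → encode c x ≡ w i
    encode-decodes (isFree a) = sym a
    encode-decodes (isPoint a) = sym a
    encode-decodes (opens t<c M) = trans (encode-< t<c) (sym (match-opening w M))
    encode-decodes (closes {s} 0<s M) = trans (encode-≥ (ℕₚ.≤-trans c≤e (ℕₚ.m≤n+m e s))) (sym (match-closingˡ M))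
    encode-decodes (diameter _ (wi , _)) = trans (encode-≥ {c} ℕₚ.≤-refl) (sym wi)

    module Encoded {f : ℕ → Offset} (circ : Circular (c + e) f) (f-periodic : ∀ i → f (i + c) ≡ f i)
      (w≡ : ∀ i → w i ≡ encode c (f i)) where
      m = c + e
      open Circular circ using (partner; noncrossing)
      open Interval w circ (λ {i} fi → trans (w≡ i) (cong (encode c) fi)) (λ {i} fi → trans (w≡ i) (cong (encode c) fi))

      f-periodic-* : ∀ r i → f (i + r * c) ≡ f i
      f-periodic-* zero i = cong f (ℕₚ.+-identityʳ i)
      f-periodic-* (suc r) i = trans (cong f (sym (ℕₚ.+-assoc i c (r * c)))) (trans (f-periodic-* r (i + c)) (f-periodic i))

      f-periodic-e : ∀ i → f (i + e) ≡ f i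
      f-periodic-e i = trans (cong (λ z → f (i + z)) e≡qc) (f-periodic-* q i)

      w-opening : ∀ {i δ} → f i ≡ reach δ → δ < c → w i ≡ opening
      w-opening {i} fi δ<c = trans (w≡ i) (trans (cong (encode c) fi) (encode-< δ<c))

      w-closing : ∀ {i δ} → f i ≡ reach δ → c ≤ δ → w i ≡ closing
      w-closing {i} fi c≤δ = trans (w≡ i) (trans (cong (encode c) fi) (encode-≥ c≤δ))

      data Arc (i δ : ℕ) : Set where
        short  : δ < c → Arc i δ
        long   : ∀ s → 0 < s → δ ≡ s + e → f (i + s) ≡ reach (c ∸ s) → s < c → Arc i δ
        middle : e ≡ c → δ ≡ c → Arc i δ

      -- An arc of length strictly between `c` and `e` crosses its own rotation by `c`. At length
      -- `c` or `e` its far end is a rotated copy of i, so both ends see the same distance and `c` =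
      -- `e`.
      arcCases : ∀ {i δ} → f i ≡ reach δ → Arc i δ
      arcCases {i} {δ} fi with ℕₚ.<-cmp δ c | ℕₚ.<-cmp δ e | partner fi
      ... | tri< δ<c _ _ | _ | _ = short δ<c
      ... | tri≈ _ refl _ | _ | δ′ , _ , _ , eq , f′ =
        middle (trans (sym (ℕₚ.+-cancelˡ-≡ c δ′ e eq)) (reach-injective (trans (sym f′) (trans (f-periodic i) fi)))) refl
      ... | tri> _ _ c<δ | tri< δ<e _ _ | _ =
        ⊥-elim (noncrossing fi (trans (f-periodic i) fi) (ℕₚ.m<m+n i 0<c) (ℕₚ.+-monoʳ-< i c<δ)
          (ℕₚ.+-monoˡ-< δ (ℕₚ.m<m+n i 0<c)) (subst (_< i + m) (sym (ℕₚ.+-assoc i c δ)) (ℕₚ.+-monoʳ-< i (ℕₚ.+-monoʳ-< c δ<e))))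
      ... | tri> _ _ c<δ | tri≈ _ refl _ | δ′ , _ , _ , eq , f′ =
        ⊥-elim (ℕₚ.<⇒≢ c<δ (ℕₚ.+-cancelˡ-≡ e c e (trans (ℕₚ.+-comm e c)
          (trans (sym eq) (cong (λ z → e + z) (reach-injective (trans (sym f′) (trans (f-periodic-e i) fi))))))))
      ... | tri> _ _ c<δ | tri> _ _ e<δ | δ′ , _ , 0<δ′ , eq , f′ =
        long s (ℕₚ.m<n⇒0<n∸m e<δ) (sym s+e) (trans (sym (f-periodic-e (i + s)))
          (trans (cong f (trans (ℕₚ.+-assoc i s e) (cong (λ z → i + z) s+e))) (trans f′ (cong reach δ′≡)))) s<c
        where
        s = δ ∸ e
        s+e : s + e ≡ δ
        s+e = ℕₚ.m∸n+n≡m (ℕₚ.<⇒≤ e<δ)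
        s+δ′ : s + δ′ ≡ c
        s+δ′ = ℕₚ.+-cancelʳ-≡ e (s + δ′) c (trans (+-swap s δ′ e) (trans (cong (_+ δ′) s+e) eq))
        s<c : s < c
        s<c = subst (s <_) s+δ′ (ℕₚ.m<m+n s 0<δ′)
        δ′≡ : δ′ ≡ c ∸ s
        δ′≡ = trans (sym (ℕₚ.m+n∸m≡n s δ′)) (cong (_∸ s) s+δ′)

      inside : ∀ {i δ} → f i ≡ reach δ → δ ≤ c →
        ht w (i + δ) ≡ ht w (suc i) × (∀ k → suc i ≤ k → k ≤ i + δ → ht w (suc i) ℤ.≤ ht w k)
      inside {i} {δ} fi δ≤c = closed⇒balanced (i + δ) (ℕₚ.m≤m+n (i + δ) (suc i)) (ℕₚ.m<m+n i (proj₁ (proj₂ (partner fi))))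
        (ℕₚ.≤-trans (ℕₚ.+-monoʳ-≤ i (ℕₚ.≤-trans δ≤c (ℕₚ.m≤m+n c e))) (ℕₚ.n≤1+n (i + m))) closed
        where
        closed : Closed (suc i) (i + δ)
        closed {k} {ε} i<k k<j fk with nested fi fk i<k k<j
        ... | inj₁ l = inj₁ (w-opening fk (ℕₚ.<-≤-trans (ℕₚ.+-cancelˡ-< i ε δ (ℕₚ.<-trans (ℕₚ.+-monoˡ-< ε i<k) l)) δ≤c) , l)
        ... | inj₂ l = inj₂ (w-closing fk (ℕₚ.≤-trans c≤e (ℕₚ.<⇒≤ e<ε)) , l)
          where
          rearrange : ∀ i c e → i + (c + e) ≡ i + c + e
          rearrange = solve-∀
          e<ε : e < ε
          e<ε = ℕₚ.+-cancelˡ-< (i + c) e ε (ℕₚ.<-trans (subst (_< k + ε) (rearrange i c e) l)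
                  (ℕₚ.+-monoˡ-< ε (ℕₚ.<-≤-trans k<j (ℕₚ.+-monoʳ-≤ i δ≤c))))

      short-match : ∀ {i δ} → f i ≡ reach δ → δ < c → Match w i (i + δ)
      short-match {i} {δ} fi δ<c with partner fi | inside fi (ℕₚ.<⇒≤ δ<c)
      ... | δ′ , 0<δ , _ , eq , f′ | e₁ , up = match (ℕₚ.m<m+n i 0<δ)
        (trans (closing⇒falling w (w-closing f′ (ℕₚ.≤-trans c≤e (ℕₚ.<⇒≤ e<δ′))))
          (trans (cong ℤ.pred (trans e₁ rise)) (ℤₚ.pred-suc (ht w i))))
        (λ k i<k k≤ → ℤₚ.<-≤-trans (subst (ht w i ℤ.<_) (sym rise) (i<suc[i] (ht w i))) (up k i<k k≤))
        where
        rise : ht w (suc i) ≡ ℤ.suc (ht w i)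
        rise = opening⇒rising w (w-opening fi δ<c)
        e<δ′ : e < δ′
        e<δ′ = ℕₚ.+-cancelˡ-< c e δ′ (subst (_< c + δ′) eq (ℕₚ.+-monoˡ-< δ′ δ<c))

      -- All arcs on one side of the diameter are nested in that side, so the height at i + c equals
      -- that at `suc i`. The closing letter at i + c then accounts for the slope -1.
      middle-diameter : e ≡ c → ∀ {i} → f i ≡ reach c → Diameter i × ht w c ≡ ℤ.- (ℤ.+ 1)
      middle-diameter refl {i} fi with inside fi ℕₚ.≤-refl
      ... | e₁ , up = (wi , λ k i<k k≤ → ℤₚ.<-≤-trans (subst (ℤ._< ht w (suc i)) (sym fall) (pred[i]<i (ht w (suc i)))) (up k i<k k≤))
          , ℤ+.∙-cancelˡ (ht w (suc i)) _ _ (trans (sym (ht-periodic (suc i))) (trans fall (ℤₚ.+-comm (ℤ.- (ℤ.+ 1)) (ht w (suc i)))))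
        where
        wi : w i ≡ closing
        wi = w-closing fi ℕₚ.≤-refl
        fall : ht w (suc (i + c)) ≡ ℤ.pred (ht w (suc i))
        fall = trans (closing⇒falling w (trans (w-periodic i) wi)) (cong ℤ.pred e₁)

      decodes : ∀ i → Decodes e i (f i)
      decodes i = go refl
        where
        go : ∀ {x} → f i ≡ x → Decodes e i x
        go {free} fi = isFree (trans (w≡ i) (cong (encode c) fi))
        go {point} fi = isPoint (trans (w≡ i) (cong (encode c) fi))
        go {reach δ} fi with arcCases fi
        ... | short δ<c = opens δ<c (short-match fi δ<c)
        ... | middle refl refl = diameter refl (proj₁ (middle-diameter refl fi))
        ... | long s 0<s refl f′ s<c = closes 0<s (match-at (short-match f′ (ℕₚ.∸-monoʳ-< 0<s (ℕₚ.<⇒≤ s<c))) refl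
                (trans (ℕₚ.+-assoc i s (c ∸ s)) (cong (λ z → i + z) (ℕₚ.m+[n∸m]≡n (ℕₚ.<⇒≤ s<c)))))

      module NoDiameter (noDiameter : ∀ i → e ≡ c → f i ≢ reach c) where

        opening-match : ∀ {i} → w i ≡ opening → ∃ λ δ → δ < c × Match w i (i + δ)
        opening-match {i} wi with encode-opening (f i) (trans (sym (w≡ i)) wi)
        ... | δ , fi , δ<c = δ , δ<c , short-match fi δ<c

        closing-match : ∀ {i} → w i ≡ closing → ∃ λ s → 0 < s × Match w (i + s) (i + c)
        closing-match {i} wi with encode-closing (f i) (trans (sym (w≡ i)) wi)
        ... | δ , fi , c≤δ with arcCases fi
        ...   | short δ<c = ⊥-elim (ℕₚ.<⇒≱ δ<c c≤δ)
        ...   | middle e≡c refl = ⊥-elim (noDiameter i e≡c fi)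
        ...   | long s 0<s refl f′ s<c = s , 0<s , match-at (short-match f′ (ℕₚ.∸-monoʳ-< 0<s (ℕₚ.<⇒≤ s<c))) refl
                (trans (ℕₚ.+-assoc i s (c ∸ s)) (cong (λ z → i + z) (ℕₚ.m+[n∸m]≡n (ℕₚ.<⇒≤ s<c))))

        1+pred-c : suc (ℕ.pred c) ≡ c
        1+pred-c = ℕₚ.suc-pred c {{ℕ.>-nonZero 0<c}}

        <c⇒≤pred : ∀ {k} → k < c → k ≤ ℕ.pred c
        <c⇒≤pred k<c = ℕₚ.≤-pred (subst (_ <_) (sym 1+pred-c) k<c)

        ≤pred⇒<c : ∀ {k} → k ≤ ℕ.pred c → k < c
        ≤pred⇒<c k≤ = subst (_ <_) 1+pred-c (s≤s k≤)

        -- After the last minimum of a period of positive slope the height never returns.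
        slope≯0 : ¬ ht w c ℤ.> ℤ.+ 0
        slope≯0 b>0 with lastMin (ht w) (ℕ.pred c)
        ... | i , i≤ , min , last = contra (opening-match (rising⇒opening w (later (suc i) (ℕₚ.n<1+n i) (ℕₚ.m<m+n i 0<c))))
          where
          later : ∀ k → i < k → k ≤ i + c → ht w i ℤ.< ht w k
          later k i<k k≤ with ℕₚ.<-≤-connex k c
          ... | inj₁ k<c = last k i<k (<c⇒≤pred k<c)
          ... | inj₂ c≤k = ℤₚ.≤-<-trans (min (k ∸ c) (<c⇒≤pred (ℕₚ.≤-<-trans k∸c≤i (≤pred⇒<c i≤))))
                  (subst₂ ℤ._<_ (ℤₚ.+-identityʳ _) (trans (sym (ht-periodic (k ∸ c))) (cong (ht w) k≡)) (ℤₚ.+-monoʳ-< (ht w (k ∸ c)) b>0))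
            where
            k≡ : k ∸ c + c ≡ k
            k≡ = ℕₚ.m∸n+n≡m c≤k
            k∸c≤i : k ∸ c ≤ i
            k∸c≤i = ℕₚ.+-cancelʳ-≤ c (k ∸ c) i (subst (_≤ i + c) (sym k≡) k≤)
          contra : (∃ λ δ → δ < c × Match w i (i + δ)) → ⊥
          contra (δ , δ<c , M) = ℤₚ.<-irrefl (sym (Match.closes M))
            (later (suc (i + δ)) (ℕₚ.m<n⇒m<1+n (Match.lt M)) (ℕₚ.+-monoʳ-< i δ<c))

        -- Dually, the first minimum of a period of negative slope is reached by an unmatched letter.
        slope≮0 : ¬ ht w c ℤ.< ℤ.+ 0
        slope≮0 b<0 with firstMin (ht w) (ℕ.pred c)
        ... | i , i≤ , min , first = contra (closing-match {p} (trans (sym (w-periodic p)) (falling⇒closing w falls)))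
          where
          earlier : ∀ k → i ≤ k → k < i + c → ht w (i + c) ℤ.< ht w k
          earlier k i≤k k< with ℕₚ.<-≤-connex k c
          ... | inj₁ k<c = ℤₚ.<-≤-trans (subst₂ ℤ._<_ (sym (ht-periodic i)) (ℤₚ.+-identityʳ _) (ℤₚ.+-monoʳ-< (ht w i) b<0)) (min k (<c⇒≤pred k<c))
          ... | inj₂ c≤k = subst₂ ℤ._<_ (sym (ht-periodic i)) (trans (sym (ht-periodic (k ∸ c))) (cong (ht w) k≡))
                  (ℤₚ.+-monoˡ-< (ht w c) (first (k ∸ c) (ℕₚ.+-cancelʳ-< c (k ∸ c) i (subst (_< i + c) (sym k≡) k<))))
            where
            k≡ : k ∸ c + c ≡ k
            k≡ = ℕₚ.m∸n+n≡m c≤k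
          earlier-shift : ∀ k → i + c ≤ k → k < i + c + c → ht w (i + c + c) ℤ.< ht w k
          earlier-shift k i≤k k< = subst₂ ℤ._<_ (sym (ht-periodic (i + c))) (trans (sym (ht-periodic (k ∸ c))) (cong (ht w) k≡))
            (ℤₚ.+-monoˡ-< (ht w c) (earlier (k ∸ c)
              (ℕₚ.+-cancelʳ-≤ c i (k ∸ c) (subst (i + c ≤_) (sym k≡) i≤k))
              (ℕₚ.+-cancelʳ-< c (k ∸ c) (i + c) (subst (_< i + c + c) (sym k≡) k<))))
            where
            k≡ : k ∸ c + c ≡ k
            k≡ = ℕₚ.m∸n+n≡m (ℕₚ.≤-trans (ℕₚ.m≤n+m c i) i≤k)
          p = i + ℕ.pred c
          1+p : suc p ≡ i + c
          1+p = trans (sym (ℕₚ.+-suc i (ℕ.pred c))) (cong (λ z → i + z) 1+pred-c)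
          1+p+c : suc (p + c) ≡ i + c + c
          1+p+c = cong (_+ c) 1+p
          falls : ht w (suc (p + c)) ℤ.< ht w (p + c)
          falls = subst (λ z → ht w z ℤ.< ht w (p + c)) (sym 1+p+c)
            (earlier-shift (p + c) (ℕₚ.+-monoˡ-≤ c (ℕₚ.m≤m+n i _)) (subst (p + c <_) 1+p+c (ℕₚ.n<1+n _)))
          contra : (∃ λ s → 0 < s × Match w (p + s) (p + c)) → ⊥
          contra (s , 0<s , M) = ℤₚ.<-irrefl (trans (cong (ht w) (sym 1+p+c)) (Match.closes M))
            (earlier-shift (p + s) (subst (_≤ p + s) 1+p (ℕₚ.m<m+n p 0<s)) (ℕₚ.<-trans (Match.lt M) (subst (p + c <_) 1+p+c (ℕₚ.n<1+n _))))

        slope≡0 : ht w c ≡ ℤ.+ 0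
        slope≡0 with ℤₚ.<-cmp (ht w c) (ℤ.+ 0)
        ... | tri< l _ _ = ⊥-elim (slope≮0 l)
        ... | tri≈ _ eq _ = eq
        ... | tri> _ _ g = ⊥-elim (slope≯0 g)

      reach? : ∀ n x → Dec (x ≡ reach n)
      reach? n free = no λ ()
      reach? n point = no λ ()
      reach? n (reach δ) with δ ℕₚ.≟ n
      ... | yes refl = yes refl
      ... | no δ≢n = no λ { refl → δ≢n refl }

      -- Whether a diameter exists can be decided by inspecting one period. If it does, it fixes the
      -- slope; if not, every letter is matched and the slope is 0.
      balance : Balance e
      balance with e ℕₚ.≟ c
      ... | no e≢c = balanced (NoDiameter.slope≡0 λ i e≡c → contradiction e≡c e≢c)
      ... | yes e≡c with ℕₚ.anyUpTo? (λ i → reach? c (f i)) c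
      ...   | yes (i , _ , fi) = deficient e≡c (proj₂ (middle-diameter e≡c fi))
      ...   | no ∄ = balanced (NoDiameter.slope≡0 λ i _ fi → ∄ (i % c , m%n<n i c ,
                trans (sym (f-periodic-* (i / c) (i % c))) (trans (cong f (sym (m≡m%n+[m/n]*n i c))) fi)))
        where instance _ = ℕ.>-nonZero 0<c

  -- Order 1: an arc opens at its smaller endpoint.
  module Linear (c : ℕ) {{_ : NonZero c}} (w : ℕ → Letter) (w-periodic : ∀ i → w (i + c) ≡ w i) where
    open Periodic w c w-periodic

    -- Nonnegative heights with height 0 at `c` make `c` a barrier: a match that starts before it
    -- and ends at or after it would force a positive height there.
    encode-decodes : (∀ k → k ≤ c → ℤ.+ 0 ℤ.≤ ht w k) → ht w c ≡ ℤ.+ 0 →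
      ∀ {i x} → i < c → Decodes 0 i x → encode (c ∸ i) x ≡ w i
    encode-decodes nonneg end i<c (isFree a) = sym a
    encode-decodes nonneg end i<c (isPoint a) = sym a
    encode-decodes nonneg end {i} i<c (opens {t} t<c M) with ℕₚ.<-≤-connex (i + t) c
    ... | inj₁ l = trans (encode-< (ℕₚ.m+n≤o⇒m≤o∸n (suc t) (subst (_≤ c) (cong suc (ℕₚ.+-comm i t)) l))) (sym (match-opening w M))
    ... | inj₂ g = ⊥-elim (ℤₚ.<⇒≱ (Match.above M c i<c g) (subst (ℤ._≤ ht w i) (sym end) (nonneg i (ℕₚ.<⇒≤ i<c))))
    encode-decodes nonneg end {i} i<c (closes {s} 0<s M) with ℕₚ.<-≤-connex (i + s) c
    ... | inj₁ l = ⊥-elim (ℤₚ.<⇒≱ (Match.above M c l (ℕₚ.m≤n+m c i)) (subst (ℤ._≤ ht w (i + s)) (sym end) (nonneg (i + s) (ℕₚ.<⇒≤ l))))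
    ... | inj₂ g = trans (encode-≥ (subst (c ∸ i ≤_) (sym (ℕₚ.+-identityʳ s)) (ℕₚ.m≤n+o⇒m∸n≤o c i g))) (sym (match-closingˡ M))
    encode-decodes nonneg end {i} i<c (diameter e≡c _) = ⊥-elim (ℕₚ.<⇒≱ i<c (subst (_≤ i) e≡c z≤n))

    module Encoded {f : ℕ → Offset} (circ : Circular (c + 0) f) (w≡ : ∀ i → w i ≡ encode (c ∸ i % c) (f i)) where
      open Circular circ using (partner)
      open Interval w circ (λ {i} fi → trans (w≡ i) (cong (encode (c ∸ i % c)) fi)) (λ {i} fi → trans (w≡ i) (cong (encode (c ∸ i % c)) fi))

      w≡′ : ∀ {i} → i < c → w i ≡ encode (c ∸ i) (f i)
      w≡′ {i} i<c = trans (w≡ i) (cong (λ z → encode (c ∸ z) (f i)) (m<n⇒m%n≡m i<c))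

      w-opening : ∀ {i δ} → i < c → f i ≡ reach δ → i + δ < c → w i ≡ opening
      w-opening {i} {δ} i<c fi l = trans (w≡′ i<c) (trans (cong (encode (c ∸ i)) fi)
        (encode-< (ℕₚ.m+n≤o⇒m≤o∸n (suc δ) (subst (_≤ c) (cong suc (ℕₚ.+-comm i δ)) l))))

      w-closing : ∀ {i δ} → i < c → f i ≡ reach δ → c ≤ i + δ → w i ≡ closing
      w-closing {i} {δ} i<c fi l = trans (w≡′ i<c) (trans (cong (encode (c ∸ i)) fi) (encode-≥ (ℕₚ.m≤n+o⇒m∸n≤o c i l)))

      whole : ht w c ≡ ℤ.+ 0 × (∀ k → 0 ≤ k → k ≤ c → ℤ.+ 0 ℤ.≤ ht w k)
      whole = closed⇒balanced c (ℕₚ.m≤m+n c 0) z≤n (ℕₚ.m≤m+n c 0) closed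
        where
        closed : Closed 0 c
        closed {k} {δ} _ k<c fk with ℕₚ.<-≤-connex (k + δ) c
        ... | inj₁ l = inj₁ (w-opening k<c fk l , l)
        ... | inj₂ g = inj₂ (w-closing k<c fk g , subst (_≤ k + δ) (sym (ℕₚ.+-identityʳ c)) g)

      short-match : ∀ {i δ} → i < c → f i ≡ reach δ → i + δ < c → Match w i (i + δ)
      short-match {i} {δ} i<c fi i+δ<c with partner fi
      ... | δ′ , 0<δ , _ , eq , f′ = match (ℕₚ.m<m+n i 0<δ)
        (trans (closing⇒falling w (w-closing i+δ<c f′ (subst (c ≤_) (sym wrapped) (ℕₚ.m≤n+m c i))))
          (trans (cong ℤ.pred (trans (proj₁ inside) rise)) (ℤₚ.pred-suc (ht w i))))
        (λ k i<k k≤ → ℤₚ.<-≤-trans (subst (ht w i ℤ.<_) (sym rise) (i<suc[i] (ht w i))) (proj₂ inside k i<k k≤))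
        where
        wrapped : i + δ + δ′ ≡ i + c
        wrapped = trans (ℕₚ.+-assoc i δ δ′) (cong (λ z → i + z) (trans eq (ℕₚ.+-identityʳ c)))
        rise : ht w (suc i) ≡ ℤ.suc (ht w i)
        rise = opening⇒rising w (w-opening i<c fi i+δ<c)
        closed : Closed (suc i) (i + δ)
        closed {k} {ε} i<k k<j fk with nested fi fk i<k k<j
        ... | inj₁ l = inj₁ (w-opening (ℕₚ.<-trans k<j i+δ<c) fk (ℕₚ.<-trans l i+δ<c) , l)
        ... | inj₂ l = inj₂ (w-closing (ℕₚ.<-trans k<j i+δ<c) fk
          (ℕₚ.≤-trans (ℕₚ.≤-trans (ℕₚ.m≤n+m c i) (ℕₚ.+-monoʳ-≤ i (ℕₚ.m≤m+n c 0))) (ℕₚ.<⇒≤ l)) , l)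
        inside = closed⇒balanced (i + δ) (ℕₚ.m≤m+n (i + δ) (suc i)) (ℕₚ.m<m+n i 0<δ)
          (ℕₚ.≤-trans (ℕₚ.<⇒≤ i+δ<c) (ℕₚ.≤-trans (ℕₚ.m≤m+n c 0) (ℕₚ.m≤n+m (c + 0) (suc i)))) closed

      decodes : ∀ {i} → i < c → Decodes 0 i (f i)
      decodes {i} i<c = go refl
        where
        go : ∀ {x} → f i ≡ x → Decodes 0 i x
        go {free} fi = isFree (trans (w≡ i) (cong (encode (c ∸ i % c)) fi))
        go {point} fi = isPoint (trans (w≡ i) (cong (encode (c ∸ i % c)) fi))
        go {reach δ} fi with ℕₚ.<-≤-connex (i + δ) c
        ... | inj₁ l = opens (ℕₚ.≤-<-trans (ℕₚ.m≤n+m δ i) l) (short-match i<c fi l)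
        ... | inj₂ g with partner fi
        ...   | δ′ , 0<δ , 0<δ′ , eq , f′ with wrapped-partner fi i+δ≡
          where
          i+δ≡ : i + δ ≡ (i + δ ∸ c) + (c + 0)
          i+δ≡ = sym (trans (cong (λ z → (i + δ ∸ c) + z) (ℕₚ.+-identityʳ c)) (ℕₚ.m∸n+n≡m g))
        -- Here i is the right end of its arc. The match is found at the left end `i + δ ∸ c` and
        -- moved forward by one period.
        ...     | fl , l+ = subst (λ z → Decodes 0 i (reach z)) (ℕₚ.+-identityʳ δ)
                    (closes 0<δ (match-at (match-shift (short-match l<c fl (subst (_< c) (sym l+) i<c)))
                      (ℕₚ.m∸n+n≡m g) (cong (_+ c) l+)))
          where
          l<c : i + δ ∸ c < c
          l<c = ℕₚ.≤-<-trans (subst (i + δ ∸ c ≤_) l+ (ℕₚ.m≤m+n _ _)) i<c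

-- Counting words by weight and by height.

module WordCounts where
  open QAnalogues using (nC0≡1)
  open PeriodicMatching
  open import Data.Maybe using (Maybe; just; nothing)
  open import Data.List.Membership.Propositional using (_∈_)
  open import Data.List.Relation.Unary.Any using (here)
  open import Data.List.Relation.Unary.All as All using ([]; _∷_)
  open import Data.List.Relation.Unary.AllPairs using ([]; _∷_)
  open import Data.List.Relation.Unary.Unique.Propositional using (Unique)
  import Data.List.Relation.Unary.Unique.Propositional.Properties as Uniqueₚ
  open import Relation.Binary.PropositionalEquality.WithK using (≡-irrelevant)

  ht-cong : ∀ {w w′} n → (∀ {i} → i < n → w i ≡ w′ i) → ht w n ≡ ht w′ n
  ht-cong zero e = refl
  ht-cong (suc n) e = cong₂ next (e (ℕₚ.n<1+n n)) (ht-cong n λ i<n → e (ℕₚ.m<n⇒m<1+n i<n))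

  ht-tail : ∀ w n → ht w (suc n) ≡ ht (λ i → w (suc i)) n ℤ.+ next (w 0) (ℤ.+ 0)
  ht-tail w zero = sym (ℤₚ.+-identityˡ _)
  ht-tail w (suc n) = trans (cong (next (w (suc n))) (ht-tail w n)) (next-+ (w (suc n)) _ _)

  -- Words accepted, from the given state, by a partial automaton with final state 0.
  module Automaton (step : Letter → ℕ → Maybe ℕ) where

    data Walk : ℕ → ℕ → Set where
      []   : Walk 0 0
      cons : ∀ {l s s′} x → step x s ≡ just s′ → Walk l s′ → Walk (suc l) s

    letters : ∀ {l s} → Walk l s → ℕ → Letter
    letters [] _ = none
    letters (cons x _ v) zero = x
    letters (cons x _ v) (suc i) = letters v i

    head : ∀ {l s} → Walk (suc l) s → Letter
    head (cons x _ _) = x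

    letters-injective : ∀ {l s} (v v′ : Walk l s) → (∀ {i} → i < l → letters v i ≡ letters v′ i) → v ≡ v′
    letters-injective [] [] e = refl
    letters-injective (cons x p v) (cons y q v′) e with e z<s
    ... | refl with trans (sym p) q
    ...   | refl = cong₂ (cons x) (≡-irrelevant p q) (letters-injective v v′ λ i<l → e (s<s i<l))

    cons-injective : ∀ {l s s′ x} {p : step x s ≡ just s′} {v v′ : Walk l s′} → cons x p v ≡ cons x p v′ → v ≡ v′
    cons-injective refl = refl

    -- `prepend` takes the outcome of `step` together with its equation, so that lemmas can match on
    -- the outcome without abstracting over it.
    walks : ∀ l s → List (Walk l s)
    prepend : ∀ l s x n → step x s ≡ n → List (Walk (suc l) s)
    walks zero zero = [ [] ]
    walks zero (suc s) = []
    walks (suc l) s = prepend l s none _ refl ++ prepend l s single _ refl ++ prepend l s opening _ refl ++ prepend l s closing _ refl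
    prepend l s x nothing _ = []
    prepend l s x (just s′) p = map (cons x p) (walks l s′)

    prepend-head : ∀ {l s x n} (p : step x s ≡ n) {v} → v ∈ prepend l s x n p → head v ≡ x
    prepend-head {n = just s′} p v∈ with ∈-map⁻ _ v∈
    ... | _ , _ , refl = refl

    walks-unique : ∀ l s → Unique (walks l s)
    prepend-unique : ∀ l s x n (p : step x s ≡ n) → Unique (prepend l s x n p)
    walks-unique zero zero = [] ∷ []
    walks-unique zero (suc s) = []
    walks-unique (suc l) s =
      Uniqueₚ.++⁺ (prepend-unique l s none _ refl)
        (Uniqueₚ.++⁺ (prepend-unique l s single _ refl)
          (Uniqueₚ.++⁺ (prepend-unique l s opening _ refl) (prepend-unique l s closing _ refl)
            λ (a , b) → contradiction (trans (sym (prepend-head refl a)) (prepend-head refl b)) λ ())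
          λ (a , b) → disjoint (prepend-head refl a) (∈-++⁻ (prepend l s opening _ refl) b) (λ ()) (λ ()))
        λ (a , b) → disjoint′ (prepend-head refl a) (∈-++⁻ (prepend l s single _ refl) b)
      where
      disjoint : ∀ {x v} → head v ≡ x → v ∈ prepend l s opening _ refl ⊎ v ∈ prepend l s closing _ refl →
        x ≢ opening → x ≢ closing → ⊥
      disjoint h (inj₁ o) x≢o _ = x≢o (trans (sym h) (prepend-head refl o))
      disjoint h (inj₂ c) _ x≢c = x≢c (trans (sym h) (prepend-head refl c))
      disjoint′ : ∀ {v} → head v ≡ none → v ∈ prepend l s single _ refl ⊎ v ∈ prepend l s opening _ refl ++ prepend l s closing _ refl → ⊥
      disjoint′ h (inj₁ b) = contradiction (trans (sym h) (prepend-head refl b)) λ ()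
      disjoint′ h (inj₂ b) = disjoint h (∈-++⁻ (prepend l s opening _ refl) b) (λ ()) λ ()
    prepend-unique l s x nothing p = []
    prepend-unique l s x (just s′) p = Uniqueₚ.map⁺ cons-injective (walks-unique l s′)

    walks-complete : ∀ {l s} (v : Walk l s) → v ∈ walks l s
    prepend-complete : ∀ {l s s′} x (p : step x s ≡ just s′) (v : Walk l s′) n (q : step x s ≡ n) → cons x p v ∈ prepend l s x n q
    walks-complete [] = here refl
    walks-complete {suc l} {s} (cons none p v) = ∈-++⁺ˡ (prepend-complete none p v _ refl)
    walks-complete {suc l} {s} (cons single p v) =
      ∈-++⁺ʳ (prepend l s none _ refl) (∈-++⁺ˡ (prepend-complete single p v _ refl))
    walks-complete {suc l} {s} (cons opening p v) =
      ∈-++⁺ʳ (prepend l s none _ refl) (∈-++⁺ʳ (prepend l s single _ refl) (∈-++⁺ˡ (prepend-complete opening p v _ refl)))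
    walks-complete {suc l} {s} (cons closing p v) =
      ∈-++⁺ʳ (prepend l s none _ refl) (∈-++⁺ʳ (prepend l s single _ refl)
        (∈-++⁺ʳ (prepend l s opening _ refl) (prepend-complete closing p v _ refl)))
    prepend-complete x p v nothing q = contradiction (trans (sym p) q) λ ()
    prepend-complete x p v (just s′) q with trans (sym p) q
    ... | refl rewrite ≡-irrelevant p q = ∈-map⁺ (cons x q) (walks-complete v)

    count : ℕ → ℕ → ℕ
    countAfter : ℕ → Maybe ℕ → ℕ
    count zero zero = 1
    count zero (suc s) = 0
    count (suc l) s = countAfter l (step none s) + (countAfter l (step single s) + (countAfter l (step opening s) + countAfter l (step closing s)))
    countAfter l nothing = 0
    countAfter l (just s) = count l s

    length-walks : ∀ l s → length (walks l s) ≡ count l s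
    length-prepend : ∀ l s x n (p : step x s ≡ n) → length (prepend l s x n p) ≡ countAfter l n
    length-walks zero zero = refl
    length-walks zero (suc s) = refl
    length-walks (suc l) s = begin
      length (N ++ S ++ O ++ K)                           ≡⟨ Listₚ.length-++ N ⟩
      length N + length (S ++ O ++ K)                     ≡⟨ cong (λ z → length N + z) (Listₚ.length-++ S) ⟩
      length N + (length S + length (O ++ K))             ≡⟨ cong (λ z → length N + (length S + z)) (Listₚ.length-++ O) ⟩
      length N + (length S + (length O + length K))       ≡⟨ cong₂ _+_ (length-prepend l s none _ refl) (cong₂ _+_ (length-prepend l s single _ refl)
                                                               (cong₂ _+_ (length-prepend l s opening _ refl) (length-prepend l s closing _ refl))) ⟩
      count (suc l) s                                     ∎
      where
      open ≡-Reasoning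
      N = prepend l s none _ refl
      S = prepend l s single _ refl
      O = prepend l s opening _ refl
      K = prepend l s closing _ refl
    length-prepend l s x nothing p = refl
    length-prepend l s x (just s′) p = trans (Listₚ.length-map (cons x p) (walks l s′)) (length-walks l s′)

  -- The state is the remaining weight, where opening, none, single, closing weigh 0, 1, 1, 2.
  weightStep : Letter → ℕ → Maybe ℕ
  weightStep opening s = just s
  weightStep none (suc s) = just s
  weightStep single (suc s) = just s
  weightStep closing (suc (suc s)) = just s
  weightStep _ _ = nothing

  module Words = Automaton weightStep

  -- The state is the current height, which may not become negative.
  heightStep : Letter → ℕ → Maybe ℕ
  heightStep none h = just h
  heightStep single h = just h
  heightStep opening h = just (suc h)
  heightStep closing (suc h) = just h
  heightStep closing zero = nothing

  module Paths = Automaton heightStep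

  pascal : ∀ n k → suc n C suc k ≡ n C k + n C suc k
  pascal n k = sym (nCk+nC[k+1]≡[n+1]C[k+1] n k)

  pascal² : ∀ {N} n k → N ≡ suc (suc n) → N C suc (suc k) ≡ n C k + n C suc k + (n C suc k + n C suc (suc k))
  pascal² n k refl = trans (pascal (suc n) (suc k)) (cong₂ _+_ (pascal n k) (pascal n (suc k)))

  2*suc : ∀ l → 2 * suc l ≡ suc (suc (2 * l))
  2*suc = solve-∀

  -- With weights 0, 1, 1, 2 a single letter has generating function (1 + x)^2, so l letters give
  -- the coefficients of (1 + x)^(2l). Adding a letter is Pascal's rule applied twice.
  count-words : ∀ l s → Words.count l s ≡ (2 * l) C s
  count-words zero zero = refl
  count-words zero (suc s) = sym (k>n⇒nCk≡0 {0} {suc s} z<s)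
  count-words (suc l) zero = trans (trans (ℕₚ.+-identityʳ _) (count-words l 0)) (trans (nC0≡1 (2 * l)) (sym (nC0≡1 (2 * suc l))))
  count-words (suc l) (suc zero) = trans
    (cong₂ (λ a b → a + (a + (b + 0))) (trans (count-words l 0) (nC0≡1 (2 * l))) (trans (count-words l 1) (nC1≡n (2 * l))))
    (trans (rearrange l) (sym (nC1≡n (2 * suc l))))
    where
    rearrange : ∀ l → 1 + (1 + (2 * l + 0)) ≡ 2 * suc l
    rearrange = solve-∀
  count-words (suc l) (suc (suc s)) = trans
    (combine (count-words l s) (count-words l (suc s)) (count-words l (suc (suc s))))
    (sym (pascal² (2 * l) s (2*suc l)))
    where
    rearrange : ∀ a b c → b + (b + (c + a)) ≡ a + b + (b + c)
    rearrange = solve-∀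
    combine : ∀ {a b c A B D} → a ≡ A → b ≡ B → c ≡ D → b + (b + (c + a)) ≡ A + B + (B + D)
    combine {a} {b} {c} refl refl refl = rearrange a b c

  central-symmetry : ∀ l → suc (2 * l) C suc l ≡ suc (2 * l) C l
  central-symmetry l = trans (nCk≡nC[n∸k] {suc l} {suc (2 * l)} (s≤s (ℕₚ.m≤m+n l (l + 0))))
    (cong (suc (2 * l) C_) (trans (ℕₚ.m+n∸m≡n l (l + 0)) (ℕₚ.+-identityʳ l)))

  -- The reflection principle, in the form a(l , h) = C(2l+1 , l+h+1) − C(2l+1 , l+h+2).
  count-paths : ∀ l h k → k ≡ l + h → Paths.count l h + suc (2 * l) C suc (suc k) ≡ suc (2 * l) C suc k
  count-paths zero zero _ refl = refl
  count-paths zero (suc h) _ refl = trans (k>n⇒nCk≡0 {1} {suc (suc (suc h))} (s<s z<s)) (sym (k>n⇒nCk≡0 {1} {suc (suc h)} (s<s z<s)))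
  -- At height 0 the closing step is missing. By central symmetry the formula is 0 at height -1, so
  -- the general recursion still applies.
  count-paths (suc l) zero (suc k) e = trans
    (cong (λ z → Paths.count (suc l) 0 + z) (pascal² (suc (2 * l)) (suc k) (cong suc (2*suc l))))
    (trans (combine (count-paths l 0 k k≡) (count-paths l 1 (suc k) (trans (cong suc k≡) (sym (ℕₚ.+-suc l 0))))
        (subst (λ k → suc (2 * l) C suc k ≡ suc (2 * l) C k) (trans (sym (ℕₚ.+-identityʳ l)) (sym k≡)) (central-symmetry l)))
      (sym (pascal² (suc (2 * l)) k (cong suc (2*suc l)))))
    where
    k≡ : k ≡ l + 0
    k≡ = ℕₚ.suc-injective e
    rearrange : ∀ a b x → (a + (a + (b + 0))) + ((a + (b + x)) + (b + x) + ((b + x) + x))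
      ≡ (a + (b + x)) + (a + (b + x)) + ((a + (b + x)) + (b + x))
    rearrange = solve-∀
    combine : ∀ {a b C₀ C₁ C₂ C₃} → a + C₂ ≡ C₁ → b + C₃ ≡ C₂ → C₁ ≡ C₀ →
      (a + (a + (b + 0))) + (C₁ + C₂ + (C₂ + C₃)) ≡ C₀ + C₁ + (C₁ + C₂)
    combine {a} {b} {C₃ = C₃} refl refl refl = rearrange a b C₃
  count-paths (suc l) (suc h) (suc zero) e = contradiction (trans (ℕₚ.suc-injective e) (ℕₚ.+-suc l h)) λ ()
  count-paths (suc l) (suc h) (suc (suc k)) e = trans
    (cong (λ z → Paths.count (suc l) (suc h) + z) (pascal² (suc (2 * l)) (suc (suc k)) (cong suc (2*suc l))))
    (trans (combine (count-paths l h k k≡) (count-paths l (suc h) (suc k) (trans (cong suc k≡) (sym (ℕₚ.+-suc l h))))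
        (count-paths l (suc (suc h)) (suc (suc k))
          (trans (cong (λ z → suc (suc z)) k≡) (sym (trans (ℕₚ.+-suc l (suc h)) (cong suc (ℕₚ.+-suc l h)))))))
      (sym (pascal² (suc (2 * l)) (suc k) (cong suc (2*suc l)))))
    where
    k≡ : k ≡ l + h
    k≡ = ℕₚ.suc-injective (trans (ℕₚ.suc-injective e) (ℕₚ.+-suc l h))
    rearrange : ∀ a b c x → (b + (b + (c + a))) + ((b + (c + x)) + (c + x) + ((c + x) + x))
      ≡ (a + (b + (c + x))) + (b + (c + x)) + ((b + (c + x)) + (c + x))
    rearrange = solve-∀
    combine : ∀ {a b c C₁ C₂ C₃ C₄} → a + C₂ ≡ C₁ → b + C₃ ≡ C₂ → c + C₄ ≡ C₃ →
      (b + (b + (c + a))) + (C₂ + C₃ + (C₃ + C₄)) ≡ C₁ + C₂ + (C₂ + C₃)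
    combine {a} {b} {c} {C₄ = C₄} refl refl refl = rearrange a b c C₄

  -- Pascal's rule and central symmetry move the difference from row 2m + 1 to row 2(m + 1). There
  -- it is the Catalan number of index m + 1, in the form required at q = 1.
  count-closed-paths : ∀ m → Paths.count m 0 + (2 * suc m) C suc (suc m) ≡ (2 * suc m) C suc m
  count-closed-paths m = trans
    (cong (λ z → Paths.count m 0 + z) (trans (cong (_C suc (suc m)) (2*suc m)) (pascal (suc (2 * m)) (suc m))))
    (trans (combine {Paths.count m 0} {C₂ = suc (2 * m) C suc (suc m)} (count-paths m 0 m (sym (ℕₚ.+-identityʳ m))) (central-symmetry m))
      (sym (trans (cong (_C suc m) (2*suc m)) (pascal (suc (2 * m)) m))))
    where
    rearrange : ∀ a x → a + ((a + x) + x) ≡ (a + x) + (a + x)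
    rearrange = solve-∀
    combine : ∀ {a C₀ C₁ C₂} → a + C₂ ≡ C₁ → C₁ ≡ C₀ → a + (C₁ + C₂) ≡ C₀ + C₁
    combine {a} {C₂ = C₂} refl refl = rearrange a C₂

  -- Every letter contributes 1 when its weight is added to its change of height. Weight c over c
  -- letters thus means slope 0, and weight c + 1 means slope -1.
  word-height : ∀ {l s} (v : Words.Walk l s) → ht (Words.letters v) l ℤ.+ ℤ.+ s ≡ ℤ.+ l
  word-height Words.[] = refl
  word-height {suc l} {s} (Words.cons {s′ = s′} x p v) =
    trans (cong (ℤ._+ ℤ.+ s) (ht-tail (Words.letters (Words.cons x p v)) l)) (trans (ℤₚ.+-assoc h _ (ℤ.+ s))
      (trans (cong (λ z → h ℤ.+ z) (letter x s p)) (trans (cong (λ z → h ℤ.+ z) (ℤₚ.+-comm (ℤ.+ 1) (ℤ.+ s′)))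
        (trans (sym (ℤₚ.+-assoc h (ℤ.+ s′) (ℤ.+ 1))) (trans (cong (ℤ._+ ℤ.+ 1) (word-height v)) (ℤₚ.+-comm (ℤ.+ l) (ℤ.+ 1)))))))
    where
    h = ht (Words.letters v) l
    letter : ∀ x s → weightStep x s ≡ just s′ → next x (ℤ.+ 0) ℤ.+ ℤ.+ s ≡ ℤ.+ 1 ℤ.+ ℤ.+ s′
    letter none (suc s) refl = refl
    letter single (suc s) refl = refl
    letter opening s refl = refl
    letter closing (suc (suc s)) refl = refl

  -- Any word is accepted from its total weight, so the initial state is part of the result, found
  -- by recursion from the end of the word.
  toWord : ∀ w l → ∃ λ s → Σ (Words.Walk l s) λ v → ∀ {i} → i < l → Words.letters v i ≡ w i
  toWord w zero = 0 , Words.[] , λ ()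
  toWord w (suc l) with toWord (λ i → w (suc i)) l
  ... | s , v , e = cons′ (w 0) refl
    where
    found : ∀ {s′} (p : weightStep (w 0) s′ ≡ just s) →
      ∃ λ s → Σ (Words.Walk (suc l) s) λ v → ∀ {i} → i < suc l → Words.letters v i ≡ w i
    found p = _ , Words.cons (w 0) p v , λ { {zero} _ → refl ; {suc i} (s<s i<l) → e i<l }
    cons′ : ∀ x → w 0 ≡ x → ∃ λ s → Σ (Words.Walk (suc l) s) λ v → ∀ {i} → i < suc l → Words.letters v i ≡ w i
    cons′ none q = found {suc s} (cong (λ x → weightStep x (suc s)) q)
    cons′ single q = found {suc s} (cong (λ x → weightStep x (suc s)) q)
    cons′ opening q = found {s} (cong (λ x → weightStep x s) q)
    cons′ closing q = found {suc (suc s)} (cong (λ x → weightStep x (suc (suc s))) q)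

  heightStep-next : ∀ x h {h′} → heightStep x h ≡ just h′ → ℤ.+ h ℤ.+ next x (ℤ.+ 0) ≡ ℤ.+ h′
  heightStep-next none h refl = ℤₚ.+-identityʳ _
  heightStep-next single h refl = ℤₚ.+-identityʳ _
  heightStep-next opening h refl = ℤₚ.+-comm (ℤ.+ h) (ℤ.+ 1)
  heightStep-next closing (suc h) refl = refl

  ht-tail-from : ∀ w n h {h′} → heightStep (w 0) h ≡ just h′ →
    ℤ.+ h ℤ.+ ht w (suc n) ≡ ℤ.+ h′ ℤ.+ ht (λ i → w (suc i)) n
  ht-tail-from w n h {h′} p = trans (cong (λ z → ℤ.+ h ℤ.+ z) (trans (ht-tail w n) (ℤₚ.+-comm (ht (λ i → w (suc i)) n) _)))
    (trans (sym (ℤₚ.+-assoc (ℤ.+ h) (next (w 0) (ℤ.+ 0)) _)) (cong (ℤ._+ ht (λ i → w (suc i)) n) (heightStep-next (w 0) h p)))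

  path-height : ∀ {l h} (v : Paths.Walk l h) →
    (∀ k → k ≤ l → ℤ.+ 0 ℤ.≤ ℤ.+ h ℤ.+ ht (Paths.letters v) k) × ℤ.+ h ℤ.+ ht (Paths.letters v) l ≡ ℤ.+ 0
  path-height Paths.[] = (λ { zero z≤n → ℤₚ.≤-refl }) , refl
  path-height {suc l} {h} (Paths.cons x p v) with path-height v
  ... | up , end = up′ , trans (ht-tail-from (Paths.letters (Paths.cons x p v)) l h p) end
    where
    up′ : ∀ k → k ≤ suc l → ℤ.+ 0 ℤ.≤ ℤ.+ h ℤ.+ ht (Paths.letters (Paths.cons x p v)) k
    up′ zero _ = ℤ.+≤+ z≤n
    up′ (suc k) (s≤s k≤l) = subst (ℤ.+ 0 ℤ.≤_) (sym (ht-tail-from (Paths.letters (Paths.cons x p v)) k h p)) (up k k≤l)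

  toPath : ∀ w l h → (∀ k → k ≤ l → ℤ.+ 0 ℤ.≤ ℤ.+ h ℤ.+ ht w k) → ℤ.+ h ℤ.+ ht w l ≡ ℤ.+ 0 →
    Σ (Paths.Walk l h) λ v → ∀ {i} → i < l → Paths.letters v i ≡ w i
  toPath w zero zero up end = Paths.[] , λ ()
  toPath w zero (suc h) up ()
  toPath w (suc l) h up end = cons′ (w 0) h refl refl
    where
    found : ∀ {h′} → heightStep (w 0) h ≡ just h′ → Σ (Paths.Walk (suc l) h) λ v → ∀ {i} → i < suc l → Paths.letters v i ≡ w i
    found {h′} p with toPath (λ i → w (suc i)) l h′
      (λ k k≤l → subst (ℤ.+ 0 ℤ.≤_) (ht-tail-from w k h p) (up (suc k) (s≤s k≤l)))
      (trans (sym (ht-tail-from w l h p)) end)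
    ... | v , e = Paths.cons (w 0) p v , λ { {zero} _ → refl ; {suc i} (s<s i<l) → e i<l }
    cons′ : ∀ x h₀ → w 0 ≡ x → h ≡ h₀ → Σ (Paths.Walk (suc l) h) λ v → ∀ {i} → i < suc l → Paths.letters v i ≡ w i
    cons′ none h₀ q r = found (cong (λ x → heightStep x h) q)
    cons′ single h₀ q r = found (cong (λ x → heightStep x h) q)
    cons′ opening h₀ q r = found (cong (λ x → heightStep x h) q)
    cons′ closing (suc h₀) q r = found (cong₂ heightStep q r)
    cons′ closing zero q refl = contradiction (subst (λ x → ℤ.+ 0 ℤ.≤ ℤ.+ 0 ℤ.+ next x (ℤ.+ 0)) q (up 1 (s≤s z≤n))) λ ()

-- Labelled configurations as periodic offset functions, and rotation as translation.

module Circles where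
  open PeriodicMatching
  open import Data.Fin as Fin using (Fin; toℕ)
  import Data.Fin.Properties as Finₚ
  open import Data.Vec using (lookup; tabulate)
  import Data.Vec.Properties as Vecₚ

  toℕ-rot : ∀ {m} .{{_ : NonZero m}} (p : Fin m) → toℕ (rot p) ≡ suc (toℕ p) % m
  toℕ-rot {suc m} p = Finₚ.toℕ-fromℕ< (m%n<n (suc (toℕ p)) (suc m))

  toℕ-rotInv : ∀ {m} .{{_ : NonZero m}} (p : Fin m) → toℕ (rotInv p) ≡ (toℕ p + ℕ.pred m) % m
  toℕ-rotInv {suc m} p = Finₚ.toℕ-fromℕ< (m%n<n (toℕ p + m) (suc m))

  module Circle (m : ℕ) .{{nonZero : NonZero m}} where

    0<m : 0 < m
    0<m = ℕ.>-nonZero⁻¹ m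

    -- -1 modulo m
    r : ℕ
    r = ℕ.pred m

    1+r≡m : suc r ≡ m
    1+r≡m = ℕₚ.suc-pred m

    infix 4 _≋_
    -- A record instead of a bare equation of remainders, so that `x` and `y` can be recovered by
    -- unification.
    record _≋_ (x y : ℕ) : Set where
      constructor mk≋
      field %≡ : x % m ≡ y % m
    open _≋_

    infixr 5 _⨾_
    _⨾_ : ∀ {x y z} → x ≋ y → y ≋ z → x ≋ z
    mk≋ p ⨾ mk≋ q = mk≋ (trans p q)

    ≋-sym : ∀ {x y} → x ≋ y → y ≋ x
    ≋-sym (mk≋ p) = mk≋ (sym p)

    ≋-refl : ∀ {x} → x ≋ x
    ≋-refl = mk≋ refl

    ≡⇒≋ : ∀ {x y} → x ≡ y → x ≋ y
    ≡⇒≋ e = mk≋ (cong (_% m) e)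

    %≋ : ∀ x → x % m ≋ x
    %≋ x = mk≋ (m%n%n≡m%n x m)

    +*m≋ : ∀ x k → x + k * m ≋ x
    +*m≋ x k = mk≋ ([m+kn]%n≡m%n x k m)

    +m≋ : ∀ x → x + m ≋ x
    +m≋ x = mk≋ ([m+n]%n≡m%n x m)

    ≋-+ʳ : ∀ {x y} z → x ≋ y → x + z ≋ y + z
    ≋-+ʳ {x} {y} z (mk≋ e) = mk≋
      (trans (%-distribˡ-+ x z m) (trans (cong (λ u → (u + z % m) % m) e) (sym (%-distribˡ-+ y z m))))

    ≋-+ˡ : ∀ {x y} z → x ≋ y → z + x ≋ z + y
    ≋-+ˡ {x} {y} z e = ≡⇒≋ (ℕₚ.+-comm z x) ⨾ ≋-+ʳ z e ⨾ ≡⇒≋ (ℕₚ.+-comm y z)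

    -- `r * i` is -i modulo `m`, and adding it undoes the addition of `i`.
    ≋-cancelˡ : ∀ i {x y} → i + x ≋ i + y → x ≋ y
    ≋-cancelˡ i {x} {y} e = ≋-sym (undo x) ⨾ ≋-+ˡ (r * i) e ⨾ undo y
      where
      rearrange : ∀ r i x → r * i + (i + x) ≡ x + i * suc r
      rearrange = solve-∀
      undo : ∀ x → r * i + (i + x) ≋ x
      undo x = ≡⇒≋ (trans (rearrange r i x) (cong (λ z → x + i * z) 1+r≡m)) ⨾ +*m≋ x i

    ≋-small : ∀ {x y} → x < m → y < m → x ≋ y → x ≡ y
    ≋-small x<m y<m (mk≋ e) = trans (sym (m<n⇒m%n≡m x<m)) (trans e (m<n⇒m%n≡m y<m))

    toℕ-mod : ∀ x → toℕ (x mod m) ≡ x % m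
    toℕ-mod x = Finₚ.toℕ-fromℕ< (m%n<n x m)

    toℕ-mod≋ : ∀ x → toℕ (x mod m) ≋ x
    toℕ-mod≋ x = ≡⇒≋ (toℕ-mod x) ⨾ %≋ x

    mod-cong : ∀ {x y} → x ≋ y → x mod m ≡ y mod m
    mod-cong {x} {y} (mk≋ e) = Finₚ.toℕ-injective (trans (toℕ-mod x) (trans e (sym (toℕ-mod y))))

    mod≡⇒≋ : ∀ {x y} → x mod m ≡ y mod m → x ≋ y
    mod≡⇒≋ {x} {y} e = ≋-sym (toℕ-mod≋ x) ⨾ ≡⇒≋ (cong toℕ e) ⨾ toℕ-mod≋ y

    mod-toℕ : ∀ (p : Fin m) → toℕ p mod m ≡ p
    mod-toℕ p = Finₚ.toℕ-injective (trans (toℕ-mod (toℕ p)) (m<n⇒m%n≡m (Finₚ.toℕ<n p)))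

    ≋⇒mod≡ : ∀ {x} {p : Fin m} → x ≋ toℕ p → x mod m ≡ p
    ≋⇒mod≡ {p = p} e = trans (mod-cong e) (mod-toℕ p)

    place : ℕ → Offset → Label m
    place i free = uncovered
    place i point = ball
    place i (reach δ) = arc ((i + δ) mod m)

    -- `toℕ j + r * i` stands for j - i modulo `m`.
    offsetOf : ℕ → Label m → Offset
    offsetOf i uncovered = free
    offsetOf i ball = point
    offsetOf i (arc j) = reach ((toℕ j + r * i) % m)

    toOffset : Config m → ℕ → Offset
    toOffset F i = offsetOf i (lookup F (i mod m))

    fromOffset : (ℕ → Offset) → Config m
    fromOffset f = tabulate λ p → place (toℕ p) (f (toℕ p))

    -- `place` sees a distance only modulo `m`, so it is inverted by `offsetOf` exactly on distances
    -- below `m`.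
    Bounded : Offset → Set
    Bounded x = ∀ {δ} → x ≡ reach δ → δ < m

    rearrange : ∀ i x → i + (x + r * i) ≡ x + i * m
    rearrange i x = trans (lemma r i x) (cong (λ z → x + i * z) 1+r≡m)
      where
      lemma : ∀ r i x → i + (x + r * i) ≡ x + i * suc r
      lemma = solve-∀

    place-offsetOf : ∀ i L → place i (offsetOf i L) ≡ L
    place-offsetOf i uncovered = refl
    place-offsetOf i ball = refl
    place-offsetOf i (arc j) = cong arc (≋⇒mod≡ (≋-+ˡ i (%≋ (toℕ j + r * i)) ⨾ ≡⇒≋ (rearrange i (toℕ j)) ⨾ +*m≋ (toℕ j) i))

    offsetOf-place : ∀ i x → Bounded x → offsetOf i (place i x) ≡ x
    offsetOf-place i free _ = refl
    offsetOf-place i point _ = refl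
    offsetOf-place i (reach δ) δ<m = cong reach (≋-small (m%n<n _ m) (δ<m refl) (≋-cancelˡ i
      (≋-+ˡ i (%≋ (toℕ ((i + δ) mod m) + r * i)) ⨾ ≡⇒≋ (rearrange i (toℕ ((i + δ) mod m)))
        ⨾ +*m≋ (toℕ ((i + δ) mod m)) i ⨾ toℕ-mod≋ (i + δ))))

    offsetOf-bounded : ∀ i L → Bounded (offsetOf i L)
    offsetOf-bounded i (arc j) refl = m%n<n _ m

    toOffset-bounded : ∀ F i → Bounded (toOffset F i)
    toOffset-bounded F i = offsetOf-bounded i (lookup F (i mod m))

    place-injective : ∀ i {x y} → Bounded x → Bounded y → place i x ≡ place i y → x ≡ y
    place-injective i {x} {y} bx by e = trans (sym (offsetOf-place i x bx)) (trans (cong (offsetOf i) e) (offsetOf-place i y by))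

    place-cong : ∀ {i j} x → i ≋ j → place i x ≡ place j x
    place-cong free e = refl
    place-cong point e = refl
    place-cong (reach δ) e = cong arc (mod-cong (≋-+ʳ δ e))

    lookup-toOffset : ∀ F i → lookup F (i mod m) ≡ place i (toOffset F i)
    lookup-toOffset F i = sym (place-offsetOf i (lookup F (i mod m)))

    toOffset-≋ : ∀ F {i j} → i ≋ j → toOffset F i ≡ toOffset F j
    toOffset-≋ F {i} {j} e = place-injective i (toOffset-bounded F i) (toOffset-bounded F j)
      (trans (sym (lookup-toOffset F i)) (trans (cong (lookup F) (mod-cong e))
        (trans (lookup-toOffset F j) (place-cong (toOffset F j) (≋-sym e)))))

    fromOffset-toOffset : ∀ F → fromOffset (toOffset F) ≡ F
    fromOffset-toOffset F = trans (Vecₚ.tabulate-cong λ p → trans (sym (lookup-toOffset F (toℕ p))) (cong (lookup F) (mod-toℕ p)))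
      (Vecₚ.tabulate∘lookup F)

    fromOffset-cong : ∀ {f f′} → (∀ {i} → i < m → f i ≡ f′ i) → fromOffset f ≡ fromOffset f′
    fromOffset-cong e = Vecₚ.tabulate-cong λ p → cong (place (toℕ p)) (e (Finₚ.toℕ<n p))

    module _ {f : ℕ → Offset} (f-periodic : ∀ i → f (i + m) ≡ f i) where

      periodic-* : ∀ k i → f (i + k * m) ≡ f i
      periodic-* zero i = cong f (ℕₚ.+-identityʳ i)
      periodic-* (suc k) i = trans (cong f (sym (ℕₚ.+-assoc i m (k * m)))) (trans (periodic-* k (i + m)) (f-periodic i))

      periodic-≋ : ∀ {i j} → i ≋ j → f i ≡ f j
      periodic-≋ {i} {j} (mk≋ e) = trans (reduce i) (trans (cong f e) (sym (reduce j)))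
        where
        reduce : ∀ i → f i ≡ f (i % m)
        reduce i = trans (cong f (m≡m%n+[m/n]*n i m)) (periodic-* (i / m) (i % m))

      lookup-fromOffset : ∀ i → lookup (fromOffset f) (i mod m) ≡ place i (f i)
      lookup-fromOffset i = trans (Vecₚ.lookup∘tabulate (λ p → place (toℕ p) (f (toℕ p))) (i mod m))
        (trans (cong (place (toℕ (i mod m))) (periodic-≋ (toℕ-mod≋ i)))
          (place-cong (f i) (toℕ-mod≋ i)))

      toOffset-fromOffset : (∀ i → Bounded (f i)) → ∀ i → toOffset (fromOffset f) i ≡ f i
      toOffset-fromOffset b i = trans (cong (offsetOf i) (lookup-fromOffset i)) (offsetOf-place i (f i) (b i))

    place-arc : ∀ {i x j} → place i x ≡ arc j → ∃ λ δ → x ≡ reach δ × (i + δ) mod m ≡ j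
    place-arc {x = reach δ} refl = δ , refl , refl

    module FromCircular {f : ℕ → Offset} (circ : Circular m f) where
      open Circular circ

      bounded : ∀ i → Bounded (f i)
      bounded i {δ} fi with partner fi
      ... | δ′ , _ , 0<δ′ , e , _ = subst (δ <_) e (ℕₚ.m<m+n δ 0<δ′)

      arc⇒reach : ∀ {i j} → lookup (fromOffset f) i ≡ arc j → ∃ λ δ → f (toℕ i) ≡ reach δ × (toℕ i + δ) mod m ≡ j
      arc⇒reach {i} e = place-arc (trans (sym (lookup-fromOffset periodic (toℕ i)))
        (trans (cong (lookup (fromOffset f)) (mod-toℕ i)) e))

      valid : ValidConfig (fromOffset f)
      valid i j e with arc⇒reach {i} {j} e
      ... | δ , fi , refl with partner fi
      ...   | δ′ , 0<δ , _ , eq , f′ = i≢j , trans (lookup-fromOffset periodic (toℕ i + δ))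
                (trans (cong (place (toℕ i + δ)) f′) (cong arc (≋⇒mod≡ (≡⇒≋
                  (trans (ℕₚ.+-assoc (toℕ i) δ δ′) (cong (λ z → toℕ i + z) eq)) ⨾ +m≋ (toℕ i)))))
        where
        i≢j : i ≢ (toℕ i + δ) mod m
        i≢j h = ℕₚ.<⇒≢ 0<δ (≋-small 0<m (bounded (toℕ i) fi) (≋-cancelˡ (toℕ i) {0} {δ}
          (≡⇒≋ (trans (ℕₚ.+-identityʳ (toℕ i)) (cong toℕ h)) ⨾ toℕ-mod≋ (toℕ i + δ))))

      -- A distance below `m` that wraps past the end lands strictly before `i`, contrary to i < j.
      ascending : ∀ {i j : Fin m} {δ} → i Fin.< j → f (toℕ i) ≡ reach δ → (toℕ i + δ) mod m ≡ j → toℕ i + δ ≡ toℕ j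
      ascending {i} {j} {δ} i<j fi refl with ℕₚ.<-≤-connex (toℕ i + δ) m
      ... | inj₁ l = sym (trans (toℕ-mod (toℕ i + δ)) (m<n⇒m%n≡m l))
      ... | inj₂ g = ⊥-elim (ℕₚ.<⇒≱ i<j (ℕₚ.<⇒≤ (subst (_< toℕ i) (sym wrapped) below)))
        where
        x = toℕ i + δ ∸ m
        x+m : x + m ≡ toℕ i + δ
        x+m = ℕₚ.m∸n+n≡m g
        below : x < toℕ i
        below = ℕₚ.+-cancelʳ-< m x (toℕ i) (subst (_< toℕ i + m) (sym x+m) (ℕₚ.+-monoʳ-< (toℕ i) (bounded (toℕ i) fi)))
        wrapped : toℕ ((toℕ i + δ) mod m) ≡ x
        wrapped = trans (toℕ-mod (toℕ i + δ)) (trans (cong (_% m) (sym x+m)) (trans ([m+n]%n≡m%n x m)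
          (m<n⇒m%n≡m (ℕₚ.<-trans below (Finₚ.toℕ<n i)))))

      noncrossingConfig : NoncrossingConfig (fromOffset f)
      noncrossingConfig = valid , crossing
        where
        crossing : ¬ HasCrossing (fromOffset f)
        crossing (i₁ , j₁ , i₂ , j₂ , e , e′ , i₁<j₁ , j₁<i₂ , i₂<j₂) with arc⇒reach {i₁} {i₂} e | arc⇒reach {j₁} {j₂} e′
        ... | δ , fi , p | ε , fj , q = noncrossing fi fj i₁<j₁
          (subst (toℕ j₁ <_) (sym i₁+δ) j₁<i₂)
          (subst₂ _<_ (sym i₁+δ) (sym j₁+ε) i₂<j₂)
          (subst (_< toℕ i₁ + m) (sym j₁+ε) (ℕₚ.<-≤-trans (Finₚ.toℕ<n j₂) (ℕₚ.m≤n+m m (toℕ i₁))))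
          where
          i₁+δ = ascending {i₁} {i₂} (ℕₚ.<-trans i₁<j₁ j₁<i₂) fi p
          j₁+ε = ascending {j₁} {j₂} (ℕₚ.<-trans j₁<i₂ i₂<j₂) fj q

    module ToCircular (F : Config m) (nc : NoncrossingConfig F) where
      private f = toOffset F

      Joined : ℕ → ℕ → Set
      Joined a b = lookup F (a mod m) ≡ arc (b mod m)

      joined : ∀ {i δ} → f i ≡ reach δ → Joined i (i + δ)
      joined {i} e = trans (lookup-toOffset F i) (cong (place i) e)

      joined-sym : ∀ {a b} → Joined a b → Joined b a
      joined-sym h = proj₂ (proj₁ nc _ _ h)

      joined-≋ : ∀ {a a′ b b′} → a ≋ a′ → b ≋ b′ → Joined a b → Joined a′ b′
      joined-≋ p q h = subst₂ (λ x y → lookup F x ≡ arc y) (mod-cong p) (mod-cong q) h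

      joined⇒reach : ∀ {a b} → Joined a b → ∃ λ δ → f a ≡ reach δ × a + δ ≋ b
      joined⇒reach {a} h with place-arc (trans (sym (lookup-toOffset F a)) h)
      ... | δ , e , p = δ , e , mod≡⇒≋ p

      noCrossing : ∀ {x₁ x₂ x₃ x₄} → x₁ < x₂ → x₂ < x₃ → x₃ < x₄ → x₄ < m → Joined x₁ x₃ → Joined x₂ x₄ → ⊥
      noCrossing {x₁} {x₂} {x₃} {x₄} l₁ l₂ l₃ l₄ h h′ = proj₂ nc
        (x₁ mod m , x₂ mod m , x₃ mod m , x₄ mod m , h , h′ ,
         small x₁<m x₂<m l₁ , small x₂<m x₃<m l₂ , small x₃<m l₄ l₃)
        where
        x₃<m = ℕₚ.<-trans l₃ l₄
        x₂<m = ℕₚ.<-trans l₂ x₃<m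
        x₁<m = ℕₚ.<-trans l₁ x₂<m
        small : ∀ {x y} → x < m → y < m → x < y → (x mod m) Fin.< (y mod m)
        small {x} {y} x<m y<m = subst₂ _<_ (sym (trans (toℕ-mod x) (m<n⇒m%n≡m x<m))) (sym (trans (toℕ-mod y) (m<n⇒m%n≡m y<m)))

      periodic : ∀ i → f (i + m) ≡ f i
      periodic i = toOffset-≋ F (+m≋ i)

      partner : ∀ {i δ} → f i ≡ reach δ → ∃ λ δ′ → 0 < δ × 0 < δ′ × δ + δ′ ≡ m × f (i + δ) ≡ reach δ′
      partner {i} {δ} fi with joined⇒reach (joined-sym (joined {i} fi))
      ... | δ′ , e , p = δ′ , 0<δ , 0<δ′ , δ+δ′≡m , e
        where
        δ<m = toOffset-bounded F i fi
        δ′<m = toOffset-bounded F (i + δ) e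
        0<δ : 0 < δ
        0<δ = ℕₚ.n≢0⇒n>0 λ { refl → proj₁ (proj₁ nc _ _ (joined {i} fi)) (cong (_mod m) (sym (ℕₚ.+-identityʳ i))) }
        sum≋0 : δ + δ′ ≋ 0
        sum≋0 = ≋-cancelˡ i (≡⇒≋ (sym (ℕₚ.+-assoc i δ δ′)) ⨾ p ⨾ ≡⇒≋ (sym (ℕₚ.+-identityʳ i)))
        δ+δ′≡m : δ + δ′ ≡ m
        δ+δ′≡m with ℕₚ.<-≤-connex (δ + δ′) m
        ... | inj₁ l = ⊥-elim (ℕₚ.<⇒≢ 0<δ (sym (ℕₚ.m+n≡0⇒m≡0 δ (≋-small l 0<m sum≋0))))
        ... | inj₂ g = trans (sym (ℕₚ.m∸n+n≡m g)) (cong (_+ m) (≋-small {δ + δ′ ∸ m} {0}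
          (ℕₚ.+-cancelʳ-< m (δ + δ′ ∸ m) m (subst (_< m + m) (sym (ℕₚ.m∸n+n≡m g)) (ℕₚ.+-mono-< δ<m δ′<m))) 0<m
          (≋-sym (+m≋ (δ + δ′ ∸ m)) ⨾ ≡⇒≋ (ℕₚ.m∸n+n≡m g) ⨾ sum≋0)))
        0<δ′ : 0 < δ′
        0<δ′ = ℕₚ.n≢0⇒n>0 λ { refl → ℕₚ.<⇒≢ δ<m (trans (sym (ℕₚ.+-identityʳ δ)) δ+δ′≡m) }

      unwrap≋ : ∀ {x} → m ≤ x → x ≋ x ∸ m
      unwrap≋ {x} le = ≡⇒≋ (sym (ℕₚ.m∸n+n≡m le)) ⨾ +m≋ (x ∸ m)
      unwrap< : ∀ {x y} → m ≤ x → x < y + m → x ∸ m < y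
      unwrap< {x} {y} le l = ℕₚ.+-cancelʳ-< m (x ∸ m) y (subst (_< y + m) (sym (ℕₚ.m∸n+n≡m le)) l)

      -- Two crossing chords through p₀ < p₁ < p₂ < p₃ < p₀ + m, according to how many of the points wrap around.
      cyclic : ∀ {p₀ p₁ p₂ p₃} → p₀ < m → p₀ < p₁ → p₁ < p₂ → p₂ < p₃ → p₃ < p₀ + m → Joined p₀ p₂ → Joined p₁ p₃ → ⊥
      cyclic {p₀} {p₁} {p₂} {p₃} p₀<m l₁ l₂ l₃ l₄ h h′ with ℕₚ.<-≤-connex p₃ m | ℕₚ.<-≤-connex p₂ m | ℕₚ.<-≤-connex p₁ m
      ... | inj₁ p₃<m | _ | _ = noCrossing l₁ l₂ l₃ p₃<m h h′
      ... | inj₂ m≤p₃ | inj₁ p₂<m | _ = noCrossing (unwrap< m≤p₃ l₄) l₁ l₂ p₂<m (joined-≋ (unwrap≋ m≤p₃) ≋-refl (joined-sym h′)) h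
      ... | inj₂ m≤p₃ | inj₂ m≤p₂ | inj₁ p₁<m =
        noCrossing (ℕₚ.∸-monoˡ-< l₃ m≤p₂) (unwrap< m≤p₃ l₄) l₁ p₁<m
          (joined-≋ (unwrap≋ m≤p₂) ≋-refl (joined-sym h)) (joined-≋ (unwrap≋ m≤p₃) ≋-refl (joined-sym h′))
      ... | inj₂ m≤p₃ | inj₂ m≤p₂ | inj₂ m≤p₁ =
        noCrossing (ℕₚ.∸-monoˡ-< l₂ m≤p₁) (ℕₚ.∸-monoˡ-< l₃ m≤p₂) (unwrap< m≤p₃ l₄) p₀<m
          (joined-≋ (unwrap≋ m≤p₁) (unwrap≋ m≤p₃) h′) (joined-≋ (unwrap≋ m≤p₂) ≋-refl (joined-sym h))

      noncrossing : ∀ {i j δ ε} → f i ≡ reach δ → f j ≡ reach ε →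
        i < j → j < i + δ → i + δ < j + ε → j + ε < i + m → ⊥
      noncrossing {i} {j} {δ} {ε} fi fj l₁ l₂ l₃ l₄ = cyclic (m%n<n i m) (shift i<j′) (shift j<′) (shift <j′) (shift <m′)
        (joined-≋ (+*m≋ i₀ t) (+*m≋ (i₀ + δ) t) (subst₂ Joined (sym i≡) (sym i+δ≡) (joined fi)))
        (joined-≋ (+*m≋ j₀ t) (+*m≋ (j₀ + ε) t) (subst₂ Joined (sym j≡) (sym j+ε≡) (joined fj)))
        where
        -- All four points go back by the same number of full turns, chosen so that the first one
        -- lands below `m`.
        t = i / m
        i₀ = i % m
        j₀ = j ∸ t * m
        i≡ : i₀ + t * m ≡ i
        i≡ = sym (m≡m%n+[m/n]*n i m)
        j≡ : j₀ + t * m ≡ j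
        j≡ = ℕₚ.m∸n+n≡m (ℕₚ.≤-trans (subst (t * m ≤_) i≡ (ℕₚ.m≤n+m (t * m) i₀)) (ℕₚ.<⇒≤ l₁))
        swap : ∀ a b c → a + b + c ≡ a + c + b
        swap = solve-∀
        i+δ≡ : i₀ + δ + t * m ≡ i + δ
        i+δ≡ = trans (swap i₀ δ (t * m)) (cong (_+ δ) i≡)
        j+ε≡ : j₀ + ε + t * m ≡ j + ε
        j+ε≡ = trans (swap j₀ ε (t * m)) (cong (_+ ε) j≡)
        i+m≡ : i₀ + m + t * m ≡ i + m
        i+m≡ = trans (swap i₀ m (t * m)) (cong (_+ m) i≡)
        shift : ∀ {x y} → x + t * m < y + t * m → x < y
        shift = ℕₚ.+-cancelʳ-< (t * m) _ _
        i<j′ = subst₂ _<_ (sym i≡) (sym j≡) l₁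
        j<′ = subst₂ _<_ (sym j≡) (sym i+δ≡) l₂
        <j′ = subst₂ _<_ (sym i+δ≡) (sym j+ε≡) l₃
        <m′ = subst₂ _<_ (sym j+ε≡) (sym i+m≡) l₄

      circular : Circular m f
      circular = record { periodic = periodic ; partner = λ {i} → partner {i} ; noncrossing = λ {i} {j} → noncrossing {i} {j} }

    -- g^k as a translation by a natural number
    amount : ℤ → ℕ
    amount (+ k) = k
    amount -[1+ k ] = suc k * r

    iter-rot : ∀ k (p : Fin m) → toℕ (iter k rot p) ≡ (toℕ p + k) % m
    iter-rot zero p = sym (trans (cong (_% m) (ℕₚ.+-identityʳ (toℕ p))) (m<n⇒m%n≡m (Finₚ.toℕ<n p)))
    iter-rot (suc k) p = trans (toℕ-rot (iter k rot p)) (trans (cong (λ x → suc x % m) (iter-rot k p))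
      (%≡ (≋-+ˡ 1 (%≋ (toℕ p + k)) ⨾ ≡⇒≋ (sym (ℕₚ.+-suc (toℕ p) k)))))

    iter-rotInv : ∀ k (p : Fin m) → toℕ (iter k rotInv p) ≡ (toℕ p + k * r) % m
    iter-rotInv zero p = sym (trans (cong (_% m) (ℕₚ.+-identityʳ (toℕ p))) (m<n⇒m%n≡m (Finₚ.toℕ<n p)))
    iter-rotInv (suc k) p = trans (toℕ-rotInv (iter k rotInv p)) (trans (cong (λ x → (x + r) % m) (iter-rotInv k p))
      (%≡ (≋-+ʳ r (%≋ (toℕ p + k * r)) ⨾ ≡⇒≋ (trans (ℕₚ.+-assoc (toℕ p) (k * r) r) (cong (λ z → toℕ p + z) (ℕₚ.+-comm (k * r) r))))))

    rotPow≋ : ∀ k (p : Fin m) → toℕ (rotPow k p) ≡ (toℕ p + amount k) % m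
    rotPow≋ (+ k) p = iter-rot k p
    rotPow≋ -[1+ k ] p = iter-rotInv (suc k) p

    r-negates : ∀ k → k + k * r ≋ 0
    r-negates k = ≡⇒≋ (trans (sym (ℕₚ.*-suc k r)) (cong (k *_) 1+r≡m)) ⨾ +*m≋ 0 k

    amount-neg : ∀ k → amount k + amount (ℤ.- k) ≋ 0
    amount-neg (+ zero) = ≋-refl
    amount-neg (+ suc k) = r-negates (suc k)
    amount-neg -[1+ k ] = ≡⇒≋ (ℕₚ.+-comm (suc k * r) (suc k)) ⨾ r-negates (suc k)

    -- For a negative integer `_%ℕ_` branches on whether the remainder of the absolute value is 0.
    -- In both branches the result and the absolute value add up to 0 modulo `m`.
    amount≋ : ∀ k → amount k ≋ k %ℕ m
    amount≋ (+ k) = ≋-sym (%≋ k)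
    amount≋ -[1+ k ] = ≋-cancelˡ (suc k) (r-negates (suc k) ⨾ ≋-sym residue)
      where
      residue : suc k + (-[1+ k ] %ℕ m) ≋ 0
      residue with suc k % m in e
      ... | zero = ≡⇒≋ (ℕₚ.+-identityʳ (suc k)) ⨾ mk≋ (trans e (sym (m<n⇒m%n≡m 0<m)))
      ... | suc x = ≋-+ʳ (m ∸ suc x) (mk≋ (trans e (sym (m<n⇒m%n≡m x<m))))
          ⨾ ≡⇒≋ (ℕₚ.m+[n∸m]≡n (ℕₚ.<⇒≤ x<m)) ⨾ +m≋ 0
        where
        x<m : suc x < m
        x<m = subst (_< m) e (m%n<n (suc k) m)

    mapLabel-place : ∀ k i x → mapLabel (rotPow k) (place i x) ≡ place (i + amount k) x
    mapLabel-place k i free = refl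
    mapLabel-place k i point = refl
    mapLabel-place k i (reach δ) = cong arc (Finₚ.toℕ-injective (trans (rotPow≋ k ((i + δ) mod m))
      (trans (%≡ (≋-+ʳ (amount k) (toℕ-mod≋ (i + δ)) ⨾ ≡⇒≋ (swap i δ (amount k)))) (sym (toℕ-mod (i + amount k + δ))))))
      where
      swap : ∀ a b c → a + b + c ≡ a + c + b
      swap = solve-∀

    rotate-back : ∀ k i → rotPow (ℤ.- k) ((i + amount k) mod m) ≡ i mod m
    rotate-back k i = Finₚ.toℕ-injective (trans (rotPow≋ (ℤ.- k) ((i + amount k) mod m))
      (trans (%≡ (≋-+ʳ (amount (ℤ.- k)) (toℕ-mod≋ (i + amount k)) ⨾ ≡⇒≋ (ℕₚ.+-assoc i (amount k) _)
        ⨾ ≋-+ˡ i (amount-neg k) ⨾ ≡⇒≋ (ℕₚ.+-identityʳ i))) (sym (toℕ-mod i))))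

    lookup-actPow : ∀ k F i → lookup (actPow k F) ((i + amount k) mod m) ≡ place (i + amount k) (toOffset F i)
    lookup-actPow k F i = trans (Vecₚ.lookup∘tabulate (λ p → mapLabel (rotPow k) (lookup F (rotPow (ℤ.- k) p))) ((i + amount k) mod m))
      (trans (cong (λ p → mapLabel (rotPow k) (lookup F p)) (rotate-back k i))
        (trans (cong (mapLabel (rotPow k)) (lookup-toOffset F i)) (mapLabel-place k i (toOffset F i))))

    fixed⇒periodic : ∀ k F → actPow k F ≡ F → ∀ i → toOffset F (i + (k %ℕ m)) ≡ toOffset F i
    fixed⇒periodic k F e i = trans (toOffset-≋ F (≋-+ˡ i (≋-sym (amount≋ k))))
      (place-injective (i + amount k) (toOffset-bounded F (i + amount k)) (toOffset-bounded F i)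
        (trans (sym (lookup-toOffset F (i + amount k))) (trans (cong (λ G → lookup G ((i + amount k) mod m)) (sym e)) (lookup-actPow k F i))))

    periodic⇒fixed : ∀ k F → (∀ i → toOffset F (i + (k %ℕ m)) ≡ toOffset F i) → actPow k F ≡ F
    periodic⇒fixed k F h = trans (sym (Vecₚ.tabulate∘lookup (actPow k F))) (trans (Vecₚ.tabulate-cong pointwise) (Vecₚ.tabulate∘lookup F))
      where
      at : ∀ i → lookup (actPow k F) ((i + amount k) mod m) ≡ lookup F ((i + amount k) mod m)
      at i = trans (lookup-actPow k F i) (trans (cong (place (i + amount k)) (trans (sym (h i)) (toOffset-≋ F (≋-+ˡ i (≋-sym (amount≋ k))))))
        (sym (lookup-toOffset F (i + amount k))))
      pointwise : ∀ p → lookup (actPow k F) p ≡ lookup F p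
      -- Every position has the form i + `amount k`; here i is p translated by the amount of the
      -- inverse rotation.
      pointwise p = subst (λ q → lookup (actPow k F) q ≡ lookup F q) (≋⇒mod≡ back) (at (toℕ p + amount (ℤ.- k)))
        where
        back : toℕ p + amount (ℤ.- k) + amount k ≋ toℕ p
        back = ≡⇒≋ (trans (ℕₚ.+-assoc (toℕ p) _ _) (cong (λ z → toℕ p + z) (ℕₚ.+-comm (amount (ℤ.- k)) (amount k))))
          ⨾ ≋-+ˡ (toℕ p) (amount-neg k) ⨾ ≡⇒≋ (ℕₚ.+-identityʳ (toℕ p))

    module _ {f : ℕ → Offset} where

      multiples : ∀ {a} → (∀ i → f (i + a) ≡ f i) → ∀ x i → f (i + x * a) ≡ f i
      multiples h zero i = cong f (ℕₚ.+-identityʳ i)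
      multiples {a} h (suc x) i = trans (cong f (sym (ℕₚ.+-assoc i a (x * a)))) (trans (multiples h x (i + a)) (h i))

      gcd-periodic : ∀ {a b} → (∀ i → f (i + a) ≡ f i) → (∀ i → f (i + b) ≡ f i) → ∀ i → f (i + gcd a b) ≡ f i
      gcd-periodic {a} {b} ha hb i = go (Bézout.identity (gcd-GCD a b))
        where
        difference : ∀ {x y} → gcd a b + x ≡ y → (∀ i → f (i + x) ≡ f i) → (∀ i → f (i + y) ≡ f i) → f (i + gcd a b) ≡ f i
        difference {x} e hx hy = trans (sym (hx (i + gcd a b))) (trans (cong f (trans (ℕₚ.+-assoc i (gcd a b) x) (cong (λ z → i + z) e))) (hy i))
        go : Bézout.Identity (gcd a b) a b → f (i + gcd a b) ≡ f i
        go (Bézout.+- x y e) = difference e (multiples hb y) (multiples ha x)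
        go (Bézout.-+ x y e) = difference e (multiples ha x) (multiples hb y)

      gcd-periodic⁻ : ∀ {a b} → (∀ i → f (i + gcd a b) ≡ f i) → ∀ i → f (i + a) ≡ f i
      gcd-periodic⁻ {a} {b} h i with gcd[m,n]∣m a b
      ... | divides q e = trans (cong (λ z → f (i + z)) e) (multiples h q i)

-- Enumerating the fixed configurations and matching the counts with the values.

module FixedConfigurations where
  open CatalanValues using (qCatalan-value)
  open PeriodicMatching
  open WordCounts
  open Circles
  import Algebra.Properties.AbelianGroup ℤₚ.+-0-abelianGroup as ℤ+
  open import Data.List.Membership.Propositional using (_∈_)
  open import Data.List.Relation.Unary.Any using (here)
  open import Data.List.Relation.Unary.All using ([]; _∷_)
  open import Data.List.Relation.Unary.AllPairs using ([]; _∷_)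
  open import Data.List.Relation.Unary.Unique.Propositional using (Unique)
  import Data.List.Relation.Unary.Unique.Propositional.Properties as Uniqueₚ
  open import Data.Sum.Properties using (inj₁-injective; inj₂-injective)
  import Data.Vec as Vec
  open import Function.Bundles using (_⇔_; mk⇔)

  -- The order of the rotation is d + 1, and `d * c` is the complement m - c that served as `e`
  -- above.
  module FixedConfigs (m : ℕ) .{{_ : NonZero m}} (k : ℤ) (c d : ℕ) {{_ : NonZero c}}
    (c≡ : c ≡ gcd (k %ℕ m) m) (m≡ : m ≡ c + d * c) where
    open Circle m

    Fixed : Config m → Set
    Fixed F = NoncrossingConfig F × actPow k F ≡ F

    extend : (ℕ → Letter) → ℕ → Letter
    extend w i = w (i % c)

    extend-periodic : ∀ w i → extend w (i + c) ≡ extend w i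
    extend-periodic w i = cong w ([m+n]%n≡m%n i c)

    extend-< : ∀ w {i} → i < c → extend w i ≡ w i
    extend-< w i<c = cong w (m<n⇒m%n≡m i<c)

    ht-extend : ∀ w → ht (extend w) c ≡ ht w c
    ht-extend w = ht-cong c (extend-< w)

    module P (w : ℕ → Letter) = Periodic (extend w) c (extend-periodic w)

    fixed⇒circular : ∀ {F} → Fixed F → Circular (c + d * c) (toOffset F)
    fixed⇒circular {F} (nc , _) = subst (λ m → Circular m (toOffset F)) m≡ (ToCircular.circular F nc)

    fixed⇒periodic-c : ∀ {F} → Fixed F → ∀ i → toOffset F (i + c) ≡ toOffset F i
    fixed⇒periodic-c {F} (nc , fix) i = trans (cong (λ z → toOffset F (i + z)) c≡)
      (gcd-periodic (fixed⇒periodic k F fix) (ToCircular.periodic F nc) i)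

    module _ (w : ℕ → Letter) (bal : P.Balance w (d * c)) where
      open P.Decoded w (ℕ.>-nonZero⁻¹ c) bal d refl hiding (m)

      circular-m : Circular m offset
      circular-m = subst (λ m → Circular m offset) (sym m≡) circular

      decodeConfig : Config m
      decodeConfig = fromOffset offset

      toOffset-decodeConfig : ∀ i → toOffset decodeConfig i ≡ offset i
      toOffset-decodeConfig = toOffset-fromOffset (Circular.periodic circular-m) (FromCircular.bounded circular-m)

      decodeConfig-fixed : Fixed decodeConfig
      decodeConfig-fixed = FromCircular.noncrossingConfig circular-m , periodic⇒fixed k decodeConfig
        (gcd-periodic⁻ {a = k %ℕ m} {m} λ i → trans (toOffset-decodeConfig (i + gcd (k %ℕ m) m))
          (trans (cong (λ z → offset (i + z)) (sym c≡)) (trans (offset-periodic i) (sym (toOffset-decodeConfig i)))))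

      decodeConfig-decodes : ∀ i → P.Decodes w (d * c) i (toOffset decodeConfig i)
      decodeConfig-decodes i = subst (P.Decodes w (d * c) i) (sym (toOffset-decodeConfig i)) (offset-decodes i)

      decodeConfig-unique : ∀ F → (∀ {i} → i < m → P.Decodes w (d * c) i (toOffset F i)) → decodeConfig ≡ F
      decodeConfig-unique F D = trans (fromOffset-cong λ i<m → decodes⇒≡ (D i<m)) (fromOffset-toOffset F)

    -- What a family of words must supply to enumerate the fixed configurations. `encodes` recovers
    -- the word from its configuration and so gives injectivity, and `complete` gives surjectivity.
    -- `encoding` takes a position because the threshold for order 1 depends on it.
    record Coding (A : Set) : Set where
      field
        word      : A → ℕ → Letter
        balance   : ∀ a → P.Balance (word a) (d * c)
        encoding  : ℕ → Offset → Letter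
        encodes   : ∀ a {i x} → i < c → P.Decodes (word a) (d * c) i x → encoding i x ≡ word a i
        injective : ∀ {a b} → (∀ {i} → i < c → word a i ≡ word b i) → a ≡ b
        complete  : ∀ F → Fixed F → ∃ λ a → ∀ {i} → i < m → P.Decodes (word a) (d * c) i (toOffset F i)

      config : A → Config m
      config a = decodeConfig (word a) (balance a)

      config-injective : ∀ {a b} → config a ≡ config b → a ≡ b
      config-injective {a} {b} e = injective λ {i} i<c →
        trans (sym (encodes a i<c (decodeConfig-decodes (word a) (balance a) i)))
          (trans (cong (λ F → encoding i (toOffset F i)) e) (encodes b i<c (decodeConfig-decodes (word b) (balance b) i)))

      enumerate : (xs : List A) → Unique xs → (∀ a → a ∈ xs) →
        Unique (map config xs) × (∀ F → (F ∈ map config xs) ⇔ Fixed F)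
      enumerate xs unique all = Uniqueₚ.map⁺ config-injective unique , λ F → mk⇔ (sound F) (found F)
        where
        sound : ∀ F → F ∈ map config xs → Fixed F
        sound F F∈ with ∈-map⁻ config F∈
        ... | a , _ , refl = decodeConfig-fixed (word a) (balance a)
        found : ∀ F → Fixed F → F ∈ map config xs
        found F fix with complete F fix
        ... | a , D = subst (_∈ map config xs) (decodeConfig-unique (word a) (balance a) F D) (∈-map⁺ config (all a))

    word-balanced : (v : Words.Walk c c) → P.Balance (Words.letters v) (d * c)
    word-balanced v = P.balanced (trans (ht-extend (Words.letters v))
      (ℤ+.∙-cancelʳ (+ c) _ (+ 0) (trans (word-height v) (sym (ℤₚ.+-identityˡ (+ c))))))

    word-deficient : d * c ≡ c → (v : Words.Walk c (suc c)) → P.Balance (Words.letters v) (d * c)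
    word-deficient e v = P.deficient e (trans (ht-extend (Words.letters v))
      (ℤ+.∙-cancelʳ (+ suc c) _ (ℤ.- (+ 1)) (trans (word-height v) refl)))

    -- The word read off the configuration is accepted from an unknown weight. Its slope, 0 without
    -- a diameter and -1 with one, determines that weight as c or c + 1.
    rotational-complete : c ≤ d * c → ∀ F → Fixed F →
      (∃ λ (v : Words.Walk c c) → ∀ i → P.Decodes (Words.letters v) (d * c) i (toOffset F i)) ⊎
      (d * c ≡ c × ∃ λ (v : Words.Walk c (suc c)) → ∀ i → P.Decodes (Words.letters v) (d * c) i (toOffset F i))
    rotational-complete c≤dc F fix with toWord (λ i → encode c (toOffset F i)) c
    ... | s , v , e = go E.balance
      where
      w = Words.letters v
      f = toOffset F
      f-periodic-* : ∀ q i → f (i + q * c) ≡ f i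
      f-periodic-* = multiples (fixed⇒periodic-c fix)
      w≡ : ∀ i → extend w i ≡ encode c (f i)
      w≡ i = trans (e (m%n<n i c)) (cong (encode c) (trans (sym (f-periodic-* (i / c) (i % c))) (cong f (sym (m≡m%n+[m/n]*n i c)))))
      module E = Rotational.Encoded c (d * c) d (ℕ.>-nonZero⁻¹ c) c≤dc refl (extend w) (extend-periodic w)
                   (fixed⇒circular fix) (fixed⇒periodic-c fix) w≡
      weight : ∀ {h t} → ht (extend w) c ≡ h → h ℤ.+ + t ≡ + c → t ≡ s
      weight {h} {t} p q = ℤₚ.+-injective (ℤ+.∙-cancelˡ h (+ t) (+ s)
        (trans q (trans (sym (word-height v)) (cong (ℤ._+ + s) (trans (sym (ht-extend w)) p)))))
      go : P.Balance w (d * c) → _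
      go (P.balanced b) with weight {t = c} b (ℤₚ.+-identityˡ (+ c))
      ... | refl = inj₁ (v , E.decodes)
      go (P.deficient e b) with weight {t = suc c} b refl
      ... | refl = inj₂ (e , v , E.decodes)

    rotational-encodes : c ≤ d * c → ∀ w {i x} → i < c → P.Decodes w (d * c) i x → encode c x ≡ w i
    rotational-encodes c≤dc w i<c D =
      trans (Rotational.encode-decodes c (d * c) d (ℕ.>-nonZero⁻¹ c) c≤dc refl (extend w) (extend-periodic w) D) (extend-< w i<c)

    words-coding : c < d * c → Coding (Words.Walk c c)
    words-coding c<dc = record
      { word = Words.letters
      ; balance = word-balanced
      ; encoding = λ _ → encode c
      ; encodes = λ v → rotational-encodes (ℕₚ.<⇒≤ c<dc) (Words.letters v)
      ; injective = λ {v} {v′} → Words.letters-injective v v′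
      ; complete = complete }
      where
      complete : ∀ F → Fixed F → ∃ λ v → ∀ {i} → i < m → P.Decodes (Words.letters v) (d * c) i (toOffset F i)
      complete F fix with rotational-complete (ℕₚ.<⇒≤ c<dc) F fix
      ... | inj₁ (v , D) = v , λ {i} _ → D i
      ... | inj₂ (e , _) = ⊥-elim (ℕₚ.<⇒≢ c<dc (sym e))

    -- The two weights are the configurations without and with a diameter. Their sizes C(2c, c) and
    -- C(2c, c+1) are summed by Pascal's rule to the value at order 2.
    halfTurn-coding : d * c ≡ c → Coding (Words.Walk c c ⊎ Words.Walk c (suc c))
    halfTurn-coding dc≡c = record
      { word = word
      ; balance = λ { (inj₁ v) → word-balanced v ; (inj₂ v) → word-deficient dc≡c v }
      ; encoding = λ _ → encode c
      ; encodes = λ a → rotational-encodes (ℕₚ.≤-reflexive (sym dc≡c)) (word a)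
      ; injective = λ {a} {b} → injective a b
      ; complete = complete }
      where
      word : Words.Walk c c ⊎ Words.Walk c (suc c) → ℕ → Letter
      word (inj₁ v) = Words.letters v
      word (inj₂ v) = Words.letters v
      weights-differ : (v : Words.Walk c c) (v′ : Words.Walk c (suc c)) → (∀ {i} → i < c → Words.letters v i ≡ Words.letters v′ i) → ⊥
      weights-differ v v′ e = ℕₚ.1+n≢n (ℤₚ.+-injective (ℤ+.∙-cancelˡ (ht (Words.letters v) c) (+ suc c) (+ c)
        (trans (cong (ℤ._+ + suc c) (ht-cong c e)) (trans (word-height v′) (sym (word-height v))))))
      injective : ∀ a b → (∀ {i} → i < c → word a i ≡ word b i) → a ≡ b
      injective (inj₁ v) (inj₁ v′) e = cong inj₁ (Words.letters-injective v v′ e)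
      injective (inj₂ v) (inj₂ v′) e = cong inj₂ (Words.letters-injective v v′ e)
      injective (inj₁ v) (inj₂ v′) e = ⊥-elim (weights-differ v v′ e)
      injective (inj₂ v) (inj₁ v′) e = ⊥-elim (weights-differ v′ v λ i<c → sym (e i<c))
      complete : ∀ F → Fixed F → ∃ λ a → ∀ {i} → i < m → P.Decodes (word a) (d * c) i (toOffset F i)
      complete F fix with rotational-complete (ℕₚ.≤-reflexive (sym dc≡c)) F fix
      ... | inj₁ (v , D) = inj₁ v , λ {i} _ → D i
      ... | inj₂ (_ , v , D) = inj₂ v , λ {i} _ → D i

    paths-coding : d ≡ 0 → Coding (Paths.Walk c 0)
    paths-coding refl = record
      { word = Paths.letters
      ; balance = λ v → P.balanced (end v)
      ; encoding = λ i → encode (c ∸ i)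
      ; encodes = λ v {i} i<c D → trans
          (Linear.encode-decodes c (extend (Paths.letters v)) (extend-periodic (Paths.letters v)) (nonnegative v) (end v) i<c D)
          (extend-< (Paths.letters v) i<c)
      ; injective = λ {v} {v′} → Paths.letters-injective v v′
      ; complete = complete }
      where
      end : (v : Paths.Walk c 0) → ht (extend (Paths.letters v)) c ≡ + 0
      end v = trans (ht-extend (Paths.letters v)) (trans (sym (ℤₚ.+-identityˡ _)) (proj₂ (path-height v)))
      nonnegative : (v : Paths.Walk c 0) → ∀ k → k ≤ c → + 0 ℤ.≤ ht (extend (Paths.letters v)) k
      nonnegative v k k≤c = subst (+ 0 ℤ.≤_) (trans (ℤₚ.+-identityˡ _)
          (ht-cong k λ i<k → sym (extend-< (Paths.letters v) (ℕₚ.<-≤-trans i<k k≤c))))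
        (proj₁ (path-height v) k k≤c)
      complete : ∀ F → Fixed F → ∃ λ v → ∀ {i} → i < m → P.Decodes (Paths.letters v) 0 i (toOffset F i)
      complete F fix = v , λ i<m → E′.decodes (subst (_ <_) (trans m≡ (ℕₚ.+-identityʳ c)) i<m)
        where
        f = toOffset F
        w : ℕ → Letter
        w i = encode (c ∸ i % c) (f i)
        f-% : ∀ i → f (i % c) ≡ f i
        f-% i = trans (sym (multiples (fixed⇒periodic-c fix) (i / c) (i % c))) (cong f (sym (m≡m%n+[m/n]*n i c)))
        w-% : ∀ i → w (i % c) ≡ w i
        w-% i = cong₂ (λ a x → encode (c ∸ a) x) (m<n⇒m%n≡m (m%n<n i c)) (f-% i)
        w-periodic : ∀ i → w (i + c) ≡ w i
        w-periodic i = cong₂ (λ a x → encode (c ∸ a) x) ([m+n]%n≡m%n i c) (fixed⇒periodic-c fix i)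
        -- Applied first to the word read off the configuration, which shows that it is a path, and
        -- then in `E′` to the letters of that path extended periodically.
        module E = Linear.Encoded c w w-periodic (fixed⇒circular fix) (λ _ → refl)
        path = toPath w c 0 (λ k k≤c → subst (+ 0 ℤ.≤_) (sym (ℤₚ.+-identityˡ _)) (proj₂ E.whole k z≤n k≤c))
                 (trans (ℤₚ.+-identityˡ _) (proj₁ E.whole))
        v = proj₁ path
        module E′ = Linear.Encoded c (extend (Paths.letters v)) (extend-periodic (Paths.letters v)) (fixed⇒circular fix)
                      (λ i → trans (proj₂ path (m%n<n i c)) (w-% i))

  fixed-configurations : (r : ℕ) (k : ℤ) → let m = suc r in
    Σ (List (Config m)) λ fixedList →
      Unique fixedList ×
      (∀ (F : Config m) → (F ∈ fixedList) ⇔ (NoncrossingConfig F × actPow k F ≡ F)) ×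
      EvalAtRootOfUnity≡ (qCatalan (suc m)) m k (+ length fixedList)
  fixed-configurations r k with gcd[m,n]∣n (k %ℕ suc r) (suc r)
  ... | divides zero ()
  ... | divides (suc d) m≡ = result d m≡
    where
    m = suc r
    c = gcd (k %ℕ m) m
    Result : Set
    Result = Σ (List (Config m)) λ fixedList →
      Unique fixedList ×
      (∀ (F : Config m) → (F ∈ fixedList) ⇔ (NoncrossingConfig F × actPow k F ≡ F)) ×
      EvalAtRootOfUnity≡ (qCatalan (suc m)) m k (+ length fixedList)
    result : ∀ d → m ≡ suc d * c → Result
    result d m≡ = cases d refl
      where
      instance
        c≢0 : NonZero c
        c≢0 = ℕ.≢-nonZero λ c≡0 → contradiction (trans m≡ (trans (cong (suc d *_) c≡0) (ℕₚ.*-zeroʳ (suc d)))) λ ()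
      open FixedConfigs m k c d refl m≡
      collect : ∀ {A} → Coding A → (xs : List A) → Unique xs → (∀ a → a ∈ xs) →
        EvalAtRootOfUnity≡ (qCatalan (suc m)) m k (+ length xs) → Result
      collect coding xs unique all value with Coding.enumerate coding xs unique all
      ... | u , iff = map (Coding.config coding) xs , u , iff ,
        subst (λ N → EvalAtRootOfUnity≡ (qCatalan (suc m)) m k (+ N)) (sym (Listₚ.length-map (Coding.config coding) xs)) value
      cases : ∀ d′ → d′ ≡ d → Result
      cases zero refl = collect (paths-coding refl) (Paths.walks c 0) (Paths.walks-unique c 0) Paths.walks-complete
        (qCatalan-value r k d _ m≡ (λ _ → trans (cong (_+ (2 * suc m) C suc (suc m))
          (trans (Paths.length-walks c 0) (cong (λ l → Paths.count l 0) (sym (trans m≡ (ℕₚ.+-identityʳ c)))))) (count-closed-paths m))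
          (λ ()) λ ())
      cases (suc zero) refl = collect (halfTurn-coding (ℕₚ.+-identityʳ c))
        (map inj₁ (Words.walks c c) ++ map inj₂ (Words.walks c (suc c)))
        (Uniqueₚ.++⁺ (Uniqueₚ.map⁺ inj₁-injective (Words.walks-unique c c)) (Uniqueₚ.map⁺ inj₂-injective (Words.walks-unique c (suc c))) disjoint)
        (λ { (inj₁ v) → ∈-++⁺ˡ (∈-map⁺ inj₁ (Words.walks-complete v))
           ; (inj₂ v) → ∈-++⁺ʳ (map inj₁ (Words.walks c c)) (∈-map⁺ inj₂ (Words.walks-complete v)) })
        (qCatalan-value r k d _ m≡ (λ ()) (λ _ → trans (Listₚ.length-++ (map inj₁ (Words.walks c c)))
          (trans (cong₂ _+_ (size c inj₁) (size (suc c) inj₂)) (nCk+nC[k+1]≡[n+1]C[k+1] (2 * c) c))) λ { (s≤s ()) })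
        where
        size : ∀ {B : Set} s (g : Words.Walk c s → B) → length (map g (Words.walks c s)) ≡ (2 * c) C s
        size s g = trans (Listₚ.length-map g (Words.walks c s)) (trans (Words.length-walks c s) (count-words c s))
        disjoint : ∀ {a} → a ∈ map inj₁ (Words.walks c c) × a ∈ map inj₂ (Words.walks c (suc c)) → ⊥
        disjoint (p , q) with ∈-map⁻ inj₁ p | ∈-map⁻ inj₂ q
        ... | _ , _ , refl | _ , _ , ()
      cases (suc (suc d′)) refl = collect (words-coding c<dc) (Words.walks c c) (Words.walks-unique c c) Words.walks-complete
        (qCatalan-value r k d _ m≡ (λ ()) (λ ()) λ _ → trans (Words.length-walks c c) (count-words c c))
        where
        c<dc : c < suc (suc d′) * c
        c<dc = ℕₚ.m<m+n c (ℕₚ.≤-trans (ℕ.>-nonZero⁻¹ c) (ℕₚ.m≤m+n c (d′ * c)))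

  -- For n = 1 the ground set is empty and its only configuration is fixed. The evaluation is taken
  -- modulo the first cyclotomic polynomial, and the remainder is zero by computation.
  fixed-empty : (k : ℤ) →
    Σ (List (Config 0)) λ fixedList →
      Unique fixedList ×
      (∀ (F : Config 0) → (F ∈ fixedList) ⇔ (NoncrossingConfig F × actPow k F ≡ F)) ×
      EvalAtRootOfUnity≡ (qCatalan 1) 0 k (+ length fixedList)
  fixed-empty k = [ Vec.[] ] , [] ∷ [] ,
    (λ { Vec.[] → mk⇔ (λ _ → ((λ ()) , λ { (() , _) }) , refl) (λ _ → here refl) }) , refl ∷ []

theorem1p3 : (n : ℕ) → 0 < n → (k : ℤ) →
    Σ (List (Config (n ∸ 1))) λ fixedList →
    Unique fixedList ×
    (∀ (F : Config (n ∸ 1)) → (F ∈ fixedList) ⇔ (NoncrossingConfig F × actPow k F ≡ F)) ×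
    EvalAtRootOfUnity≡ (qCatalan n) (n ∸ 1) k (+ length fixedList)
theorem1p3 (suc zero) _ k = FixedConfigurations.fixed-empty k
theorem1p3 (suc (suc r)) _ k = FixedConfigurations.fixed-configurations r k
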